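{- There exists a (randomized) algorithm for the graphic matroid secretary problem that is $3.77$-competitive on the family of all finite simple graphs (no parallel edges, no loops) with nonnegative edge weights.
   Context: Graphic matroid secretary problem: the input is a finite undirected multigraph $G=(V,E)$ without loops, with $|V|=n$, $|E|=m$ and edge weights $w:E\to\mathbb{R}_{\ge 0}$. The algorithm knows $V$ and $m$ in advance. The edges arrive one at a time in an order chosen uniformly at random among all orderings of $E$; when an edge arrives the algorithm learns its endpoints and weight and must immediately and irrevocably accept or reject it, subject to the set of accepted edges always being acyclic. The algorithm may use internal randomness. $ALG$ denotes the total weight of accepted edges and $OPT(G)$ the maximum weight of an acyclic edge set of $G$. An algorithm is $\alpha$-competitive on a family of weighted graphs if $\alpha\cdot\mathbb{E}[ALG]\ge OPT(G)$ for every graph in the family (expectation over arrival order and internal randomness). A graph is simple if there is at most one edge between any pair of vertices. -}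

module Defs where

open import Algebra.Definitions.RawMonoid using (_×_)
open import Algebra.Structures using (IsCommutativeRing)
open import Data.Bool.Base using (Bool; if_then_else_)
open import Data.Fin.Base using (Fin; _<_)
open import Data.Fin.Properties using (_≟_; any?; injective⇒≤)
open import Data.List.Base
  using (List; []; _∷_; [_]; _++_; map; concatMap; foldr; filter; length; take; allFin; lookup)
open import Data.List.Membership.DecPropositional using (_∈?_)
open import Data.List.Membership.Propositional using (_∈_)
open import Data.List.Membership.Propositional.Properties using (∈-lookup)
open import Data.List.Relation.Unary.All as All using (All; all?)
open import Data.List.Relation.Unary.Unique.DecPropositional using (unique?)
open import Data.List.Relation.Unary.Unique.Propositional using (Unique; []; _∷_)
open import Data.Nat.Base as ℕ using (ℕ; zero; suc; z≤n; s≤s)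
open import Data.Product.Base using (∃; _,_) renaming (_×_ to _∧_)
open import Data.Sum.Base using (_⊎_; inj₁; inj₂)
open import Level using (0ℓ)
open import Relation.Binary.Bundles using (TotalOrder)
open import Relation.Binary.Core using (Rel)
open import Relation.Binary.PropositionalEquality.Core using (_≡_; _≢_; refl; sym; cong)
open import Relation.Binary.Structures using (IsDecTotalOrder)
open import Relation.Nullary.Decidable using (Dec; yes; no; map′; _×-dec_; _⊎-dec_; ¬?)
open import Relation.Nullary.Negation.Core using (¬_; contradiction)
open import Relation.Unary using (Pred; Decidable)

import Data.List.Extrema as Extrema

-- The real numbers, given axiomatically as a (Dedekind-)complete ordered field.
-- The order is decidable, as it is classically. The value of 0# ⁻¹ is left
-- unspecified.
record CompleteOrderedField : Set₁ where
  infix  8 _⁻¹ -_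
  infixl 7 _*_
  infixl 6 _+_
  infix  4 _≤_
  field
    ℝ       : Set
    _+_ _*_ : ℝ → ℝ → ℝ
    -_ _⁻¹  : ℝ → ℝ
    0# 1#   : ℝ
    _≤_     : Rel ℝ 0ℓ

    isCommutativeRing : IsCommutativeRing _≡_ _+_ _*_ -_ 0# 1#
    0≢1               : 0# ≢ 1#
    *-inverseʳ        : ∀ x → x ≢ 0# → x * x ⁻¹ ≡ 1#

    isDecTotalOrder   : IsDecTotalOrder _≡_ _≤_
    +-monoˡ-≤         : ∀ z {x y} → x ≤ y → x + z ≤ y + z
    *-nonneg          : ∀ {x y} → 0# ≤ x → 0# ≤ y → 0# ≤ x * y

  UpperBound : Pred ℝ 0ℓ → ℝ → Set
  UpperBound P b = ∀ x → P x → x ≤ b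

  field
    supremum : (P : Pred ℝ 0ℓ) → ∃ P → ∃ (UpperBound P) →
               ∃ λ s → UpperBound P s ∧ (∀ b → UpperBound P b → s ≤ b)

sublists : ∀ {A : Set} → List A → List (List A)
sublists []       = [ [] ]
sublists (x ∷ xs) = map (x ∷_) (sublists xs) ++ sublists xs

insertions : ∀ {A : Set} → A → List A → List (List A)
insertions x []       = [ [ x ] ]
insertions x (y ∷ ys) = (x ∷ y ∷ ys) ∷ map (y ∷_) (insertions x ys)

permutations : ∀ {A : Set} → List A → List (List A)
permutations []       = [ [] ]
permutations (x ∷ xs) = concatMap (insertions x) (permutations xs)

-- An unordered pair of distinct vertices, stored in increasing order so that
-- it carries no orientation.
record Endpoints (n : ℕ) : Set where
  constructor endpoints
  field
    lo hi  : Fin n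
    .lo<hi : lo < hi

Joins : ∀ {n} → Endpoints n → Fin n → Fin n → Set
Joins p u v = (lo ≡ u ∧ hi ≡ v) ⊎ (lo ≡ v ∧ hi ≡ u)
  where open Endpoints p

-- Loopless multigraphs on Fin n with edges labelled by Fin m.
Multigraph : ℕ → ℕ → Set
Multigraph n m = Fin m → Endpoints n

Simple : ∀ {n m} → Multigraph n m → Set
Simple G = ∀ u v e f → Joins (G e) u v → Joins (G f) u v → e ≡ f

-- Walk G u vs es v is a walk from u to v along the edges es; vs lists the
-- vertices visited before the final one.
data Walk {n m} (G : Multigraph n m) : Fin n → List (Fin n) → List (Fin m) → Fin n → Set where
  stop : ∀ {u} → Walk G u [] [] u
  step : ∀ {u v w vs e es} → Joins (G e) u v → Walk G v vs es w → Walk G u (u ∷ vs) (e ∷ es) w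

-- Cycles of length two, formed by a pair of parallel edges, are included.
IsCycle : ∀ {n m} → Multigraph n m → Fin n → List (Fin n) → List (Fin m) → Set
IsCycle G u vs es = es ≢ [] ∧ Walk G u vs es u ∧ Unique vs ∧ Unique es

-- Edge sets are represented by lists of edges.
HasCycle : ∀ {n m} → Multigraph n m → List (Fin m) → Set
HasCycle G S = ∃ λ u → ∃ λ vs → ∃ λ es → IsCycle G u vs es ∧ All (_∈ S) es

Acyclic : ∀ {n m} → Multigraph n m → List (Fin m) → Set
Acyclic G S = ¬ HasCycle G S

-- Acyclicity is decidable, since the vertices and edges of a cycle are distinct
-- and hence bounded in number.

private
  joins? : ∀ {n} (p : Endpoints n) u v → Dec (Joins p u v)
  joins? p u v = (lo ≟ u ×-dec hi ≟ v) ⊎-dec (lo ≟ v ×-dec hi ≟ u)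
    where open Endpoints p

  walk? : ∀ {n m} (G : Multigraph n m) u vs es v → Dec (Walk G u vs es v)
  walk? G u []       []       v = map′ (λ { refl → stop }) (λ { stop → refl }) (u ≟ v)
  walk? G u []       (_ ∷ _)  v = no λ ()
  walk? G u (_ ∷ _)  []       v = no λ ()
  walk? G u (x ∷ vs) (e ∷ es) w =
    map′ (λ { (refl , v , j , p) → step j p }) (λ { (step j p) → refl , _ , j , p })
      (u ≟ x ×-dec any? λ v → joins? (G e) u v ×-dec walk? G v vs es w)

  nonempty? : ∀ {A : Set} (xs : List A) → Dec (xs ≢ [])
  nonempty? []      = no λ ne → ne refl
  nonempty? (_ ∷ _) = yes λ ()

  isCycle? : ∀ {n m} (G : Multigraph n m) u vs es → Dec (IsCycle G u vs es)
  isCycle? G u vs es =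
    nonempty? es ×-dec walk? G u vs es u ×-dec unique? _≟_ vs ×-dec unique? _≟_ es

  lookup-injective : ∀ {A : Set} {xs : List A} → Unique xs →
                     ∀ {i j} → lookup xs i ≡ lookup xs j → i ≡ j
  lookup-injective (_ ∷ _)   {Fin.zero}  {Fin.zero}  _  = refl
  lookup-injective {xs = _ ∷ xs} (x∉ ∷ _) {Fin.zero} {Fin.suc j} eq =
    contradiction eq (All.lookup x∉ (∈-lookup {xs = xs} j))
  lookup-injective {xs = _ ∷ xs} (x∉ ∷ _) {Fin.suc i} {Fin.zero} eq =
    contradiction (sym eq) (All.lookup x∉ (∈-lookup {xs = xs} i))
  lookup-injective (_ ∷ uq)  {Fin.suc _} {Fin.suc _} eq = cong Fin.suc (lookup-injective uq eq)

  unique⇒length≤ : ∀ {n} {xs : List (Fin n)} → Unique xs → length xs ℕ.≤ n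
  unique⇒length≤ uq = injective⇒≤ (lookup-injective uq)

  anyList≤? : ∀ {n} {P : Pred (List (Fin n)) 0ℓ} → Decidable P →
              ∀ k → Dec (∃ λ xs → length xs ℕ.≤ k ∧ P xs)
  anyList≤? P? zero =
    map′ (λ p → [] , z≤n , p) (λ { ([] , _ , p) → p ; (_ ∷ _ , () , _) }) (P? [])
  anyList≤? P? (suc k) =
    map′ (λ { (inj₁ p) → [] , z≤n , p ; (inj₂ (x , xs , l , p)) → x ∷ xs , s≤s l , p })
         (λ { ([] , _ , p) → inj₁ p ; (x ∷ xs , s≤s l , p) → inj₂ (x , xs , l , p) })
         (P? [] ⊎-dec any? λ x → anyList≤? (λ xs → P? (x ∷ xs)) k)

hasCycle? : ∀ {n m} (G : Multigraph n m) S → Dec (HasCycle G S)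
hasCycle? {n} {m} G S =
  map′ (λ { (u , vs , _ , es , _ , c) → u , vs , es , c })
       (λ { (u , vs , es , c@((_ , _ , uv , ue) , _)) →
            u , vs , unique⇒length≤ uv , es , unique⇒length≤ ue , c })
       (any? λ u → anyList≤? (λ vs → anyList≤? (λ es →
          isCycle? G u vs es ×-dec all? (λ e → _∈?_ _≟_ e S) es) m) n)

acyclic? : ∀ {n m} (G : Multigraph n m) S → Dec (Acyclic G S)
acyclic? G S = ¬? (hasCycle? G S)

module GraphicSecretary (R : CompleteOrderedField) where

  open CompleteOrderedField R public

  totalOrder : TotalOrder 0ℓ 0ℓ 0ℓ
  totalOrder = record { isTotalOrder = IsDecTotalOrder.isTotalOrder isDecTotalOrder }

  open Extrema totalOrder using (max)

  sum : List ℝ → ℝ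
  sum = foldr _+_ 0#

  fromℕ : ℕ → ℝ
  fromℕ k = _×_ (record { Carrier = ℝ ; _≈_ = _≡_ ; _∙_ = _+_ ; ε = 0# }) k 1#

  average : ∀ {A : Set} → List A → (A → ℝ) → ℝ
  average xs f = sum (map f xs) * fromℕ (length xs) ⁻¹

  record WeightedGraph (n m : ℕ) : Set where
    field
      graph    : Multigraph n m
      weight   : Fin m → ℝ
      weight≥0 : ∀ e → 0# ≤ weight e

    totalWeight : List (Fin m) → ℝ
    totalWeight S = sum (map weight S)

    -- The starting value 0# is the weight of the (acyclic) empty set.
    OPT : ℝ
    OPT = max 0# (map totalWeight (filter (acyclic? graph) (sublists (allFin m))))

  open WeightedGraph

  -- What is revealed when an edge arrives; in particular not its label.
  record Arrival (n : ℕ) : Set where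
    constructor arrival
    field
      ends  : Endpoints n
      value : ℝ

  reveal : ∀ {n m} → WeightedGraph n m → Fin m → Arrival n
  reveal G e = arrival (graph G e) (weight G e)

  -- A deterministic rule maps the earlier arrivals (most recent first) and the
  -- current one to a decision, true meaning acceptance.
  Rule : ℕ → Set
  Rule n = List (Arrival n) → Arrival n → Bool

  acceptedFrom : ∀ {n m} → WeightedGraph n m → Rule n → List (Arrival n) → List (Fin m) → List (Fin m)
  acceptedFrom G rule past []       = []
  acceptedFrom G rule past (e ∷ es) =
    if rule past (reveal G e) then e ∷ later else later
    where later = acceptedFrom G rule (reveal G e ∷ past) es

  accepted : ∀ {n m} → WeightedGraph n m → Rule n → List (Fin m) → List (Fin m)
  accepted G rule es = acceptedFrom G rule [] es

  orders : (m : ℕ) → List (List (Fin m))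
  orders m = permutations (allFin m)

  -- A randomized algorithm for known n and m: a seed is drawn from a finite
  -- probability space and then determines the rule to be followed. The accepted
  -- set must be acyclic at every time t, on every loopless multigraph.
  record Algorithm (n m : ℕ) : Set where
    field
      seeds    : ℕ
      prob     : Fin seeds → ℝ
      prob≥0   : ∀ s → 0# ≤ prob s
      prob-sum : sum (map prob (allFin seeds)) ≡ 1#
      rule     : Fin seeds → Rule n
      feasible : ∀ (G : WeightedGraph n m) s {es} → es ∈ orders m → ∀ t →
                 Acyclic (graph G) (accepted G (rule s) (take t es))

    𝔼[ALG] : WeightedGraph n m → ℝ
    𝔼[ALG] G = average (orders m) λ es →
      sum (map (λ s → prob s * totalWeight G (accepted G (rule s) es)) (allFin seeds))

  Competitive : ℝ → (∀ {n m} → WeightedGraph n m → Set) → (∀ n m → Algorithm n m) → Set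
  Competitive α Family A =
    ∀ n m (G : WeightedGraph n m) → Family G → OPT G ≤ α * Algorithm.𝔼[ALG] (A n m) G

  SimpleGraph : ∀ {n m} → WeightedGraph n m → Set
  SimpleGraph G = Simple (graph G)

{-# OPTIONS --safe #-}
-- The rule rejects the first k = ⌊m/2⌋ edges. At each time s the edges seen so far have a
-- maximum-weight forest, rooted so that every vertex has at most one parent edge. A vertex is
-- hit at time s when the s-th edge is its parent edge or, if it is a root, when a coin of bias
-- 1/s shows heads; hence each vertex is hit with probability exactly 1/s, given the set of
-- edges seen. An arc u → v is accepted if u has not been hit since the sample and v is not
-- strict, where v is strict if it was first hit by an arc v → x with x not yet hit. On a cycle
-- of accepted arcs, the vertex hit first would be strict when the arc into it arrives; so the
-- accepted edges form a forest.
--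
-- To bound the probability of acceptance, run time backwards: the last edge is uniformly random
-- among those seen. In a simple graph an earlier arc v → x has x ≠ u, so three different
-- vertices have to be spared for v to become strict. With r = k/s, the vertex u is unhit and v
-- is not strict with probability about (r + r³)/2, instead of the r² obtained by asking that
-- neither is hit. Summing over s gives every edge of the optimal forest a probability of about
-- (ln 2 + 3/8)/4 > 13/49 > 1/3.77.
module Submission where

open import Defs
open import Algebra.Bundles using (CommutativeRing)
open import Data.Bool.Base using (Bool; true; false; if_then_else_; _∧_; _∨_; T)
open import Data.Bool.Properties using (∨-zeroʳ)
open import Data.Empty using (⊥-elim; ⊥)
open import Data.Fin.Base using (Fin; zero; suc)
open import Data.Fin.Properties using (_≟_; _<?_; <-irrefl; ≤-decTotalOrder)
open import Data.List.Base
  using (List; []; _∷_; _++_; map; concatMap; length; [_]; lookup; allFin; tabulate; _∷ʳ_; foldl;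
         reverse; take; filter)
open import Data.List.Extrema using (max≤v⁺)
open import Data.List.Membership.DecPropositional using (_∈?_)
open import Data.List.Membership.Propositional using (_∈_; _∉_)
open import Data.List.Membership.Propositional.Properties
  using (∈-++⁻; ∈-map⁻; ∈-map⁺; ∈-∃++; ∈-++⁺ʳ; ∈-filter⁺; ∈-filter⁻; ∈-allFin; ∈-lookup)
open import Data.List.Membership.Propositional.Properties.WithK using (unique∧set⇒bag)
open import Data.List.Properties
  using (map-tabulate; tabulate-lookup; ++-assoc; reverse-++; map-∘; length-map; reverse-involutive;
         unfold-reverse; map-++; ++-identityʳ; length-reverse; length-tabulate)
open import Data.List.Relation.Binary.BagAndSetEquality using (∼bag⇒↭)
open import Data.List.Relation.Binary.Permutation.Propositional as ↭
  using (_↭_; ↭-sym; ↭-refl; ↭⇒↭ₛ; ↭-trans; ↭-prep; ↭-swap)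
open import Data.List.Relation.Binary.Permutation.Propositional.Properties
  using (++-comm; ↭-length; map⁺; ∈-resp-↭; All-resp-↭; ↭-map-inv)
open import Data.List.Relation.Binary.Pointwise using (Pointwise-≡⇒≡)
open import Data.List.Relation.Binary.Sublist.Propositional using (_⊆_; []; _∷_) renaming (_∷ʳ_ to skip)
open import Data.List.Relation.Binary.Sublist.Propositional.Properties using (filter-⊆; All-resp-⊆)
open import Data.List.Relation.Unary.All as All using (All; []; _∷_)
open import Data.List.Relation.Unary.AllPairs as AllPairs using ([]; _∷_; AllPairs)
open import Data.List.Relation.Unary.Any using (here; there)
open import Data.List.Relation.Unary.Sorted.TotalOrder.Properties using (↗↭↗⇒≋; Sorted⇒AllPairs)
open import Data.List.Relation.Unary.Unique.Propositional using (Unique)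
open import Data.Maybe.Base using (Maybe; just; nothing)
open import Data.Maybe.Properties using (just-injective)
open import Data.Nat.Base as ℕ using (ℕ; zero; suc; NonZero; _!; _≡ᵇ_; _≤ᵇ_; ⌊_/2⌋)
open import Data.Nat.Tactic.RingSolver using (solve-∀)
open import Data.Product using (_×_; _,_; proj₁; proj₂; ∃-syntax; Σ-syntax)
open import Data.Product.Relation.Binary.Lex.NonStrict using (×-decTotalOrder)
open import Data.Sum using (inj₁; inj₂; _⊎_)
open import Data.Unit using (⊤; tt)
open import Data.Vec.Base as Vec using (Vec; []; _∷_)
open import Function.Base using (_∘_; id)
open import Function.Bundles using (mk⇔)
open import Relation.Binary.Bundles using (Poset; DecTotalOrder)
open import Relation.Binary.PropositionalEquality
  using (_≡_; _≢_; refl; sym; trans; cong; cong₂; subst; subst₂; module ≡-Reasoning; setoid;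
         isEquivalence)
open import Relation.Binary.Structures using (IsDecTotalOrder)
open import Relation.Nullary using (¬_; contradiction; Dec; yes; no; does)
open import Relation.Nullary.Decidable using (recompute; map′)

import Algebra.Properties.CommutativeSemigroup as CommutativeSemigroupProperties
import Algebra.Solver.Ring.NaturalCoefficients.Default as NaturalSolver
import Data.List.Relation.Binary.Permutation.Setoid.Properties as Permutation
import Data.List.Relation.Unary.All.Properties as All
import Data.List.Relation.Unary.AllPairs.Properties as AllPairs
import Data.List.Relation.Unary.Unique.Propositional.Properties as Unique
import Data.List.Sort as Sort
import Data.Nat.Properties as ℕ
import Relation.Binary.Construct.Flip.EqAndOrd as Flip
import Relation.Binary.Reasoning.PartialOrder as PartialOrderReasoning

-- Two coupled recursions in the number s of edges seen give the estimate. Write q = 1/(s + 1). `V`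
-- is a lower bound for the probability that u → v may be accepted, and V - D one for the stronger
-- condition that this survives an arc v → x. The last arrival hits u with probability q, at the
-- cost of V, and is the arc of v with probability at most q, at the cost of D; so V(s + 1) may be
-- as large as V(s)(1 - q) - D(s)q. The two conditions differ exactly when u, v and x are all unhit.
-- D, which stands in for the chance of this, shrinks by the factor (1 - q)(1 - 2q) per arrival. In
-- the limit D = r³ and r dV/dr = V + D with V = 1 at r = 1, whence (r + r³)/2. The coins are there
-- for the sake of x: a root that was never hit would stay fresh, and every vertex first hit by an
-- arc into it would become strict. Looking backwards requires the rooted forest to depend on the
-- set of edges seen and not on their order.

module OrderedField (R : CompleteOrderedField) where

  open GraphicSecretary R using (ℝ; _+_; _*_; -_; _⁻¹; 0#; 1#; _≤_; isCommutativeRing; 0≢1; *-inverseʳ;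
    isDecTotalOrder; +-monoˡ-≤; *-nonneg; fromℕ)

  commutativeRing : CommutativeRing _ _
  commutativeRing = record { isCommutativeRing = isCommutativeRing }

  open CommutativeRing commutativeRing public
    using (+-comm; +-assoc; +-identityˡ; +-identityʳ; *-comm; *-assoc; *-identityˡ; *-identityʳ;
           distribˡ; distribʳ; zeroˡ; zeroʳ; -‿inverseˡ; -‿inverseʳ; commutativeSemiring; ring;
           +-commutativeSemigroup; *-commutativeSemigroup)

  open IsDecTotalOrder isDecTotalOrder public
    using (total; isPartialOrder)
    renaming (refl to ≤-refl; reflexive to ≤-reflexive; trans to ≤-trans; antisym to ≤-antisym)

  open NaturalSolver commutativeSemiring public using (solve; _:=_; _:+_; _:*_; con)
  open CommutativeSemigroupProperties +-commutativeSemigroup public using () renaming (interchange to +-interchange)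

  ≤-poset : Poset _ _ _
  ≤-poset = record { isPartialOrder = isPartialOrder }

  module ≤R = PartialOrderReasoning ≤-poset

  +-monoʳ-≤ : ∀ z {x y} → x ≤ y → z + x ≤ z + y
  +-monoʳ-≤ z {x} {y} p = subst₂ _≤_ (+-comm x z) (+-comm y z) (+-monoˡ-≤ z p)

  +-mono-≤ : ∀ {x y z w} → x ≤ y → z ≤ w → x + z ≤ y + w
  +-mono-≤ {y = y} {z} p q = ≤-trans (+-monoˡ-≤ z p) (+-monoʳ-≤ y q)

  +-nonneg : ∀ {x y} → 0# ≤ x → 0# ≤ y → 0# ≤ x + y
  +-nonneg p q = subst (_≤ _) (+-identityˡ 0#) (+-mono-≤ p q)

  x≤x+y : ∀ x {y} → 0# ≤ y → x ≤ x + y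
  x≤x+y x {y} p = subst (_≤ x + y) (+-identityʳ x) (+-monoʳ-≤ x p)

  x≤y+x : ∀ x {y} → 0# ≤ y → x ≤ y + x
  x≤y+x x {y} p = subst (x ≤_) (+-comm x y) (x≤x+y x p)

  +-cancelʳ-≤ : ∀ z {x y} → x + z ≤ y + z → x ≤ y
  +-cancelʳ-≤ z {x} {y} p = subst₂ _≤_ (drop x) (drop y) (+-monoˡ-≤ (- z) p)
    where
    drop : ∀ w → w + z + - z ≡ w
    drop w = trans (+-assoc w z (- z)) (trans (cong (w +_) (-‿inverseʳ z)) (+-identityʳ w))

  +-cancelˡ-≤ : ∀ z {x y} → z + x ≤ z + y → x ≤ y
  +-cancelˡ-≤ z {x} {y} p = +-cancelʳ-≤ z (subst₂ _≤_ (+-comm z x) (+-comm z y) p)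

  private
    ≤⇒0≤- : ∀ {x y} → x ≤ y → 0# ≤ y + - x
    ≤⇒0≤- {x} p = subst (_≤ _) (-‿inverseʳ x) (+-monoˡ-≤ (- x) p)

    y-x+x : ∀ x y → y + - x + x ≡ y
    y-x+x x y = trans (+-assoc y (- x) x) (trans (cong (y +_) (-‿inverseˡ x)) (+-identityʳ y))

  *-monoʳ-≤ : ∀ {z x y} → 0# ≤ z → x ≤ y → z * x ≤ z * y
  *-monoʳ-≤ {z} {x} {y} 0≤z x≤y = subst (z * x ≤_)
    (trans (sym (distribˡ z (y + - x) x)) (cong (z *_) (y-x+x x y)))
    (x≤y+x (z * x) (*-nonneg 0≤z (≤⇒0≤- x≤y)))

  *-monoˡ-≤ : ∀ {z x y} → 0# ≤ z → x ≤ y → x * z ≤ y * z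
  *-monoˡ-≤ {z} {x} {y} p q = subst₂ _≤_ (*-comm z x) (*-comm z y) (*-monoʳ-≤ p q)

  0≤1 : 0# ≤ 1#
  0≤1 with total 0# 1#
  ... | inj₁ p = p
  ... | inj₂ 1≤0 = subst (0# ≤_) [-1]²≡1 (*-nonneg 0≤-1 0≤-1)
    where
    0≤-1 : 0# ≤ - 1#
    0≤-1 = subst (0# ≤_) (+-identityˡ (- 1#)) (≤⇒0≤- 1≤0)
    [-1]²≡1 : - 1# * - 1# ≡ 1#
    [-1]²≡1 = begin
      - 1# * - 1#                     ≡⟨ sym (+-identityˡ _) ⟩
      0# + - 1# * - 1#                ≡⟨ cong (_+ - 1# * - 1#) (sym (-‿inverseʳ 1#)) ⟩
      1# + - 1# + - 1# * - 1#         ≡⟨ +-assoc 1# (- 1#) _ ⟩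
      1# + (- 1# + - 1# * - 1#)       ≡⟨ cong (λ z → 1# + (z + - 1# * - 1#)) (sym (*-identityʳ (- 1#))) ⟩
      1# + (- 1# * 1# + - 1# * - 1#)  ≡⟨ cong (1# +_) (sym (distribˡ (- 1#) 1# (- 1#))) ⟩
      1# + - 1# * (1# + - 1#)         ≡⟨ cong (λ z → 1# + - 1# * z) (-‿inverseʳ 1#) ⟩
      1# + - 1# * 0#                  ≡⟨ cong (1# +_) (zeroʳ (- 1#)) ⟩
      1# + 0#                         ≡⟨ +-identityʳ 1# ⟩
      1#                              ∎ where open ≡-Reasoning

  fromℕ-nonneg : ∀ n → 0# ≤ fromℕ n
  fromℕ-nonneg zero    = ≤-refl
  fromℕ-nonneg (suc n) = +-nonneg 0≤1 (fromℕ-nonneg n)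

  fromℕ-suc≢0 : ∀ n → fromℕ (suc n) ≢ 0#
  fromℕ-suc≢0 n eq = 0≢1 (≤-antisym 0≤1 (subst (1# ≤_) eq (x≤x+y 1# (fromℕ-nonneg n))))

  fromℕ-+ : ∀ a b → fromℕ (a ℕ.+ b) ≡ fromℕ a + fromℕ b
  fromℕ-+ zero    b = sym (+-identityˡ _)
  fromℕ-+ (suc a) b = trans (cong (1# +_) (fromℕ-+ a b)) (sym (+-assoc 1# _ _))

  fromℕ-* : ∀ a b → fromℕ (a ℕ.* b) ≡ fromℕ a * fromℕ b
  fromℕ-* zero    b = sym (zeroˡ _)
  fromℕ-* (suc a) b = begin
    fromℕ (b ℕ.+ a ℕ.* b)          ≡⟨ fromℕ-+ b (a ℕ.* b) ⟩
    fromℕ b + fromℕ (a ℕ.* b)      ≡⟨ cong₂ _+_ (sym (*-identityˡ _)) (fromℕ-* a b) ⟩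
    1# * fromℕ b + fromℕ a * fromℕ b ≡⟨ sym (distribʳ _ _ _) ⟩
    (1# + fromℕ a) * fromℕ b       ∎ where open ≡-Reasoning

  fromℕ-mono : ∀ {a b} → a ℕ.≤ b → fromℕ a ≤ fromℕ b
  fromℕ-mono {b = b} ℕ.z≤n = fromℕ-nonneg b
  fromℕ-mono (ℕ.s≤s p)     = +-monoʳ-≤ 1# (fromℕ-mono p)

  ⁻¹-nonneg : ∀ {x} → 0# ≤ x → x ≢ 0# → 0# ≤ x ⁻¹
  ⁻¹-nonneg {x} 0≤x x≢0 with total 0# (x ⁻¹)
  ... | inj₁ p = p
  ... | inj₂ p = contradiction (≤-antisym 0≤1 1≤0) 0≢1
    where
    1≤0 : 1# ≤ 0#
    1≤0 = subst₂ _≤_ (*-inverseʳ x x≢0) (zeroʳ x) (*-monoʳ-≤ 0≤x p)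

  *-cancelˡ-≤ : ∀ {z x y} → 0# ≤ z → z ≢ 0# → z * x ≤ z * y → x ≤ y
  *-cancelˡ-≤ {z} {x} {y} 0≤z z≢0 p = subst₂ _≤_ (drop x) (drop y) (*-monoʳ-≤ (⁻¹-nonneg 0≤z z≢0) p)
    where
    drop : ∀ w → z ⁻¹ * (z * w) ≡ w
    drop w = trans (sym (*-assoc _ _ _))
      (trans (cong (_* w) (trans (*-comm _ _) (*-inverseʳ z z≢0))) (*-identityˡ w))

  infix 8 1/_
  1/_ : ℕ → ℝ
  1/ n = fromℕ n ⁻¹

  1/-inverse : ∀ n .{{_ : NonZero n}} → fromℕ n * 1/ n ≡ 1#
  1/-inverse (suc n) = *-inverseʳ _ (fromℕ-suc≢0 n)

  1/-nonneg : ∀ n .{{_ : NonZero n}} → 0# ≤ 1/ n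
  1/-nonneg (suc n) = ⁻¹-nonneg (fromℕ-nonneg (suc n)) (fromℕ-suc≢0 n)

  fromℕ-cancel-≤ : ∀ n .{{_ : NonZero n}} {x y} → fromℕ n * x ≤ fromℕ n * y → x ≤ y
  fromℕ-cancel-≤ (suc n) = *-cancelˡ-≤ (fromℕ-nonneg (suc n)) (fromℕ-suc≢0 n)

  fromℕ-cancel : ∀ n .{{_ : NonZero n}} {x y} → fromℕ n * x ≡ fromℕ n * y → x ≡ y
  fromℕ-cancel n eq = ≤-antisym (fromℕ-cancel-≤ n (≤-reflexive eq)) (fromℕ-cancel-≤ n (≤-reflexive (sym eq)))

  infix 8 _÷_
  _÷_ : ℕ → ℕ → ℝ
  a ÷ b = fromℕ a * 1/ b

  ÷-nonneg : ∀ a b .{{_ : NonZero b}} → 0# ≤ a ÷ b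
  ÷-nonneg a b = *-nonneg (fromℕ-nonneg a) (1/-nonneg b)

  fromℕ-*-÷ : ∀ a b .{{_ : NonZero b}} → fromℕ b * a ÷ b ≡ fromℕ a
  fromℕ-*-÷ a b = begin
    fromℕ b * (fromℕ a * 1/ b)
      ≡⟨ solve 3 (λ x y z → x :* (y :* z) := y :* (x :* z)) refl (fromℕ b) (fromℕ a) (1/ b) ⟩
    fromℕ a * (fromℕ b * 1/ b) ≡⟨ cong (fromℕ a *_) (1/-inverse b) ⟩
    fromℕ a * 1#               ≡⟨ *-identityʳ _ ⟩
    fromℕ a                    ∎ where open ≡-Reasoning

  private
    scale : ∀ a b c .{{_ : NonZero b}} → fromℕ (b ℕ.* c) * a ÷ b ≡ fromℕ (a ℕ.* c)
    scale a b c = begin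
      fromℕ (b ℕ.* c) * a ÷ b       ≡⟨ cong (_* (a ÷ b)) (fromℕ-* b c) ⟩
      fromℕ b * fromℕ c * a ÷ b
        ≡⟨ solve 3 (λ x y z → x :* y :* z := y :* (x :* z)) refl (fromℕ b) (fromℕ c) (a ÷ b) ⟩
      fromℕ c * (fromℕ b * a ÷ b)   ≡⟨ cong (fromℕ c *_) (fromℕ-*-÷ a b) ⟩
      fromℕ c * fromℕ a             ≡⟨ *-comm _ _ ⟩
      fromℕ a * fromℕ c             ≡⟨ sym (fromℕ-* a c) ⟩
      fromℕ (a ℕ.* c)               ∎ where open ≡-Reasoning

    scale′ : ∀ a b c .{{_ : NonZero b}} → fromℕ (c ℕ.* b) * a ÷ b ≡ fromℕ (a ℕ.* c)
    scale′ a b c = trans (cong (λ z → fromℕ z * a ÷ b) (ℕ.*-comm c b)) (scale a b c)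

  ÷-≤ : ∀ a b c d .{{_ : NonZero b}} .{{_ : NonZero d}} → a ℕ.* d ℕ.≤ c ℕ.* b → a ÷ b ≤ c ÷ d
  ÷-≤ a b c d le = fromℕ-cancel-≤ (b ℕ.* d) {{ℕ.m*n≢0 b d}}
    (subst₂ _≤_ (sym (scale a b d)) (sym (scale′ c d b)) (fromℕ-mono le))

  ÷-+ : ∀ a b c d .{{_ : NonZero b}} .{{_ : NonZero d}} →
        a ÷ b + c ÷ d ≡ (a ℕ.* d ℕ.+ c ℕ.* b) ÷ (b ℕ.* d)
  ÷-+ a b c d = fromℕ-cancel (b ℕ.* d) {{ℕ.m*n≢0 b d}} (begin
    fromℕ (b ℕ.* d) * (a ÷ b + c ÷ d)                      ≡⟨ distribˡ _ _ _ ⟩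
    fromℕ (b ℕ.* d) * a ÷ b + fromℕ (b ℕ.* d) * c ÷ d     ≡⟨ cong₂ _+_ (scale a b d) (scale′ c d b) ⟩
    fromℕ (a ℕ.* d) + fromℕ (c ℕ.* b)                     ≡⟨ sym (fromℕ-+ (a ℕ.* d) (c ℕ.* b)) ⟩
    fromℕ (a ℕ.* d ℕ.+ c ℕ.* b)
      ≡⟨ sym (fromℕ-*-÷ (a ℕ.* d ℕ.+ c ℕ.* b) (b ℕ.* d) {{ℕ.m*n≢0 b d}}) ⟩
    fromℕ (b ℕ.* d) * (a ℕ.* d ℕ.+ c ℕ.* b) ÷ (b ℕ.* d) ∎)
    where open ≡-Reasoning

  ÷-* : ∀ a b c d .{{_ : NonZero b}} .{{_ : NonZero d}} → a ÷ b * c ÷ d ≡ (a ℕ.* c) ÷ (b ℕ.* d)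
  ÷-* a b c d = fromℕ-cancel (b ℕ.* d) {{ℕ.m*n≢0 b d}} (begin
    fromℕ (b ℕ.* d) * (a ÷ b * c ÷ d)         ≡⟨ cong (_* (a ÷ b * c ÷ d)) (fromℕ-* b d) ⟩
    fromℕ b * fromℕ d * (a ÷ b * c ÷ d)
      ≡⟨ solve 4 (λ x y z w → x :* y :* (z :* w) := x :* z :* (y :* w)) refl
                                                     (fromℕ b) (fromℕ d) (a ÷ b) (c ÷ d) ⟩
    fromℕ b * a ÷ b * (fromℕ d * c ÷ d)       ≡⟨ cong₂ _*_ (fromℕ-*-÷ a b) (fromℕ-*-÷ c d) ⟩
    fromℕ a * fromℕ c                         ≡⟨ sym (fromℕ-* a c) ⟩
    fromℕ (a ℕ.* c)                           ≡⟨ sym (fromℕ-*-÷ (a ℕ.* c) (b ℕ.* d) {{ℕ.m*n≢0 b d}}) ⟩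
    fromℕ (b ℕ.* d) * (a ℕ.* c) ÷ (b ℕ.* d) ∎)
    where open ≡-Reasoning

-- Finite sums, finite probability distributions and biased coins.

module Expectation (R : CompleteOrderedField) where

  open GraphicSecretary R using (ℝ; _+_; _*_; -_; _⁻¹; 0#; 1#; _≤_; *-nonneg; fromℕ; sum)
  open OrderedField R

  private variable
    A B : Set

  ∑ : List A → (A → ℝ) → ℝ
  ∑ xs f = sum (map f xs)

  ∑-cong : ∀ (xs : List A) {f g : A → ℝ} → (∀ x → f x ≡ g x) → ∑ xs f ≡ ∑ xs g
  ∑-cong []       eq = refl
  ∑-cong (x ∷ xs) eq = cong₂ _+_ (eq x) (∑-cong xs eq)

  ∑-cong-∈ : ∀ (xs : List A) {f g : A → ℝ} → (∀ {x} → x ∈ xs → f x ≡ g x) → ∑ xs f ≡ ∑ xs g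
  ∑-cong-∈ []       eq = refl
  ∑-cong-∈ (x ∷ xs) eq = cong₂ _+_ (eq (here refl)) (∑-cong-∈ xs (eq ∘ there))

  ∑-mono : ∀ (xs : List A) {f g : A → ℝ} → (∀ {x} → x ∈ xs → f x ≤ g x) → ∑ xs f ≤ ∑ xs g
  ∑-mono []       le = ≤-refl
  ∑-mono (x ∷ xs) le = +-mono-≤ (le (here refl)) (∑-mono xs (le ∘ there))

  ∑-++ : ∀ (xs ys : List A) (f : A → ℝ) → ∑ (xs ++ ys) f ≡ ∑ xs f + ∑ ys f
  ∑-++ []       ys f = sym (+-identityˡ _)
  ∑-++ (x ∷ xs) ys f = trans (cong (f x +_) (∑-++ xs ys f)) (sym (+-assoc _ _ _))

  ∑-map : ∀ (h : A → B) (xs : List A) (f : B → ℝ) → ∑ (map h xs) f ≡ ∑ xs (f ∘ h)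
  ∑-map h []       f = refl
  ∑-map h (x ∷ xs) f = cong (f (h x) +_) (∑-map h xs f)

  ∑-concatMap : ∀ (h : A → List B) (xs : List A) (f : B → ℝ) → ∑ (concatMap h xs) f ≡ ∑ xs (λ x → ∑ (h x) f)
  ∑-concatMap h []       f = refl
  ∑-concatMap h (x ∷ xs) f = trans (∑-++ (h x) (concatMap h xs) f) (cong (∑ (h x) f +_) (∑-concatMap h xs f))

  ∑-+ : ∀ (xs : List A) (f g : A → ℝ) → ∑ xs (λ x → f x + g x) ≡ ∑ xs f + ∑ xs g
  ∑-+ []       f g = sym (+-identityˡ _)
  ∑-+ (x ∷ xs) f g = trans (cong (f x + g x +_) (∑-+ xs f g)) (+-interchange _ _ _ _)

  ∑-*ˡ : ∀ (xs : List A) c (f : A → ℝ) → ∑ xs (λ x → c * f x) ≡ c * ∑ xs f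
  ∑-*ˡ []       c f = sym (zeroʳ c)
  ∑-*ˡ (x ∷ xs) c f = trans (cong (c * f x +_) (∑-*ˡ xs c f)) (sym (distribˡ c _ _))

  ∑-const : ∀ (xs : List A) c → ∑ xs (λ _ → c) ≡ fromℕ (length xs) * c
  ∑-const []       c = sym (zeroˡ c)
  ∑-const (x ∷ xs) c = begin
    c + ∑ xs (λ _ → c)                  ≡⟨ cong₂ _+_ (sym (*-identityˡ c)) (∑-const xs c) ⟩
    1# * c + fromℕ (length xs) * c      ≡⟨ sym (distribʳ c _ _) ⟩
    (1# + fromℕ (length xs)) * c        ∎ where open ≡-Reasoning

  ∑-0 : ∀ (xs : List A) → ∑ xs (λ _ → 0#) ≡ 0#
  ∑-0 xs = trans (∑-const xs 0#) (zeroʳ _)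

  ∑-nonneg : ∀ (xs : List A) {f : A → ℝ} → (∀ {x} → x ∈ xs → 0# ≤ f x) → 0# ≤ ∑ xs f
  ∑-nonneg xs {f} le = subst (_≤ ∑ xs f) (∑-0 xs) (∑-mono xs le)

  ∑-swap : ∀ (xs : List A) (ys : List B) (f : A → B → ℝ) →
           ∑ xs (λ x → ∑ ys (f x)) ≡ ∑ ys (λ y → ∑ xs (λ x → f x y))
  ∑-swap []       ys f = sym (∑-0 ys)
  ∑-swap (x ∷ xs) ys f = trans (cong (∑ ys (f x) +_) (∑-swap xs ys f)) (sym (∑-+ ys _ _))

  ∑-↭ : ∀ {xs ys : List A} (f : A → ℝ) → xs ↭ ys → ∑ xs f ≡ ∑ ys f
  ∑-↭ f ↭.refl          = refl
  ∑-↭ f (↭.prep x p)    = cong (f x +_) (∑-↭ f p)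
  ∑-↭ f (↭.swap x y p)  = trans (cong (λ z → f x + (f y + z)) (∑-↭ f p))
    (solve 3 (λ a b c → a :+ (b :+ c) := b :+ (a :+ c)) refl (f x) (f y) _)
  ∑-↭ f (↭.trans p q)   = trans (∑-↭ f p) (∑-↭ f q)

  -- Outcomes may be listed repeatedly; positions in the list later serve as the seeds of the
  -- algorithm.
  Dist : Set → Set
  Dist A = List (ℝ × A)

  ∫ : Dist A → (A → ℝ) → ℝ
  ∫ d f = ∑ d (λ pa → proj₁ pa * f (proj₂ pa))

  record IsProbability (d : Dist A) : Set where
    field
      weights≥0   : All (λ pa → 0# ≤ proj₁ pa) d
      total-mass  : ∫ d (λ _ → 1#) ≡ 1#

  open IsProbability public

  ∫-cong : ∀ (d : Dist A) {f g : A → ℝ} → (∀ a → f a ≡ g a) → ∫ d f ≡ ∫ d g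
  ∫-cong d eq = ∑-cong d (λ pa → cong (proj₁ pa *_) (eq (proj₂ pa)))

  ∫-+ : ∀ (d : Dist A) (f g : A → ℝ) → ∫ d (λ a → f a + g a) ≡ ∫ d f + ∫ d g
  ∫-+ d f g = trans (∑-cong d (λ pa → distribˡ _ _ _)) (∑-+ d _ _)

  ∫-*ˡ : ∀ (d : Dist A) c (f : A → ℝ) → ∫ d (λ a → c * f a) ≡ c * ∫ d f
  ∫-*ˡ d c f = trans (∑-cong d (λ pa → solve 3 (λ x y z → x :* (y :* z) := y :* (x :* z)) refl (proj₁ pa) c _)) (∑-*ˡ d c _)

  ∫-∑ : ∀ (d : Dist A) (xs : List B) (f : A → B → ℝ) → ∫ d (λ a → ∑ xs (f a)) ≡ ∑ xs (λ x → ∫ d (λ a → f a x))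
  ∫-∑ d xs f = trans (∑-cong d (λ pa → sym (∑-*ˡ xs (proj₁ pa) (f (proj₂ pa))))) (∑-swap d xs _)

  ∫-mono-∈ : ∀ {d : Dist A} → All (λ pa → 0# ≤ proj₁ pa) d → ∀ {f g : A → ℝ} →
           (∀ {p a} → (p , a) ∈ d → f a ≤ g a) → ∫ d f ≤ ∫ d g
  ∫-mono-∈ {d = d} w≥0 le = ∑-mono d (λ pa∈ → *-monoʳ-≤ (All.lookup w≥0 pa∈) (le pa∈))

  ∫-mono : ∀ {d : Dist A} → IsProbability d → ∀ {f g : A → ℝ} → (∀ a → f a ≤ g a) → ∫ d f ≤ ∫ d g
  ∫-mono prob le = ∫-mono-∈ (weights≥0 prob) (λ {_} {a} _ → le a)

  ∫-const : ∀ {d : Dist A} → IsProbability d → ∀ c → ∫ d (λ _ → c) ≡ c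
  ∫-const {d = d} prob c = begin
    ∫ d (λ _ → c)        ≡⟨ ∫-cong d (λ _ → sym (*-identityʳ c)) ⟩
    ∫ d (λ _ → c * 1#)   ≡⟨ ∫-*ˡ d c _ ⟩
    c * ∫ d (λ _ → 1#)   ≡⟨ cong (c *_) (total-mass prob) ⟩
    c * 1#               ≡⟨ *-identityʳ c ⟩
    c                    ∎ where open ≡-Reasoning

  return : A → Dist A
  return a = [ 1# , a ]

  ∫-return : ∀ (a : A) f → ∫ (return a) f ≡ f a
  ∫-return a f = trans (+-identityʳ _) (*-identityˡ _)

  return-isProbability : ∀ (a : A) → IsProbability (return a)
  return-isProbability a = record { weights≥0 = 0≤1 ∷ [] ; total-mass = ∫-return a (λ _ → 1#) }

  infixl 1 _>>=_
  _>>=_ : Dist A → (A → Dist B) → Dist B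
  d >>= k = concatMap (λ pa → map (λ qb → proj₁ pa * proj₁ qb , proj₂ qb) (k (proj₂ pa))) d

  ∫->>= : ∀ (d : Dist A) (k : A → Dist B) f → ∫ (d >>= k) f ≡ ∫ d (λ a → ∫ (k a) f)
  ∫->>= d k f = trans (∑-concatMap _ d _) (∑-cong d (λ pa →
    trans (∑-map _ (k (proj₂ pa)) _)
      (trans (∑-cong (k (proj₂ pa)) (λ _ → *-assoc _ _ _)) (∑-*ˡ (k (proj₂ pa)) (proj₁ pa) _))))

  >>=-isProbability : ∀ {d : Dist A} {k : A → Dist B} → IsProbability d → (∀ a → IsProbability (k a)) →
                      IsProbability (d >>= k)
  >>=-isProbability {d = d} {k} prob probs = record
    { weights≥0  = All.concat⁺ (All.map⁺ (All.map (λ {pa} p≥0 →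
        All.map⁺ (All.map (*-nonneg p≥0) (weights≥0 (probs (proj₂ pa))))) (weights≥0 prob)))
    ; total-mass = trans (∫->>= d k _)
        (trans (∫-cong d (λ a → total-mass (probs a))) (total-mass prob))
    }

  ⟦_⟧ : Bool → ℝ
  ⟦ b ⟧ = if b then 1# else 0#

  0≤⟦_⟧ : ∀ b → 0# ≤ ⟦ b ⟧
  0≤⟦ true ⟧  = 0≤1
  0≤⟦ false ⟧ = ≤-refl

  -- The coin of round s, which is tossed after s arrivals, has bias 1/(s + 1).
  coin : ℕ → Dist Bool
  coin s = (1 ÷ suc s , true) ∷ (s ÷ suc s , false) ∷ []

  coin-isProbability : ∀ s → IsProbability (coin s)
  coin-isProbability s = record
    { weights≥0  = ÷-nonneg 1 (suc s) ∷ ÷-nonneg s (suc s) ∷ []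
    ; total-mass = begin
        1 ÷ suc s * 1# + (s ÷ suc s * 1# + 0#)
          ≡⟨ solve 2 (λ b c → (con 1 :+ con 0) :* c :* con 1 :+ (b :* c :* con 1 :+ con 0) := (con 1 :+ b) :* c) refl (fromℕ s) (1/ suc s) ⟩
        fromℕ (suc s) * 1/ suc s ≡⟨ 1/-inverse (suc s) ⟩
        1# ∎
    } where open ≡-Reasoning

  ∫-coin : ∀ s → ∫ (coin s) ⟦_⟧ ≡ 1/ suc s
  ∫-coin s = solve 2 (λ b c → (con 1 :+ con 0) :* c :* con 1 :+ (b :* c :* con 0 :+ con 0) := c) refl (fromℕ s) (1/ suc s)

  coins : ∀ n → ℕ → Dist (Vec Bool n)
  coins zero    s = return []
  coins (suc n) s = coin s >>= λ b → coins n s >>= λ bs → return (b ∷ bs)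

  coins-isProbability : ∀ n s → IsProbability (coins n s)
  coins-isProbability zero    s = return-isProbability []
  coins-isProbability (suc n) s = >>=-isProbability (coin-isProbability s) λ b →
    >>=-isProbability (coins-isProbability n s) λ bs → return-isProbability (b ∷ bs)

  ∫-coins-suc : ∀ n s f → ∫ (coins (suc n) s) f ≡ ∫ (coin s) (λ b → ∫ (coins n s) (λ bs → f (b ∷ bs)))
  ∫-coins-suc n s f = trans (∫->>= (coin s) (λ b → coins n s >>= λ bs → return (b ∷ bs)) f) (∫-cong (coin s) λ b →
    trans (∫->>= (coins n s) (λ bs → return (b ∷ bs)) f) (∫-cong (coins n s) λ bs → ∫-return (b ∷ bs) f))

  ∫-coin-at : ∀ n s (i : Fin n) → ∫ (coins n s) (λ c → ⟦ Vec.lookup c i ⟧) ≡ 1/ suc s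
  ∫-coin-at (suc n) s zero = begin
    ∫ (coins (suc n) s) (λ c → ⟦ Vec.lookup c zero ⟧)      ≡⟨ ∫-coins-suc n s _ ⟩
    ∫ (coin s) (λ b → ∫ (coins n s) (λ _ → ⟦ b ⟧))
      ≡⟨ ∫-cong (coin s) (λ b → ∫-const (coins-isProbability n s) ⟦ b ⟧) ⟩
    ∫ (coin s) ⟦_⟧                                         ≡⟨ ∫-coin s ⟩
    1/ suc s                                               ∎ where open ≡-Reasoning
  ∫-coin-at (suc n) s (suc i) = begin
    ∫ (coins (suc n) s) (λ c → ⟦ Vec.lookup c (suc i) ⟧)   ≡⟨ ∫-coins-suc n s _ ⟩
    ∫ (coin s) (λ _ → ∫ (coins n s) (λ c → ⟦ Vec.lookup c i ⟧)) ≡⟨ ∫-const (coin-isProbability s) _ ⟩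
    ∫ (coins n s) (λ c → ⟦ Vec.lookup c i ⟧)               ≡⟨ ∫-coin-at n s i ⟩
    1/ suc s                                               ∎ where open ≡-Reasoning

  ∫-coin-at² : ∀ n s {i j : Fin n} → i ≢ j →
    ∫ (coins n s) (λ c → ⟦ Vec.lookup c i ⟧ * ⟦ Vec.lookup c j ⟧) ≡ 1/ suc s * 1/ suc s
  ∫-coin-at² (suc n) s {zero}  {zero}  i≢j = ⊥-elim (i≢j refl)
  ∫-coin-at² (suc n) s {zero}  {suc j} i≢j = begin
    ∫ (coins (suc n) s) (λ c → ⟦ Vec.lookup c zero ⟧ * ⟦ Vec.lookup c (suc j) ⟧) ≡⟨ ∫-coins-suc n s _ ⟩
    ∫ (coin s) (λ b → ∫ (coins n s) (λ c → ⟦ b ⟧ * ⟦ Vec.lookup c j ⟧))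
      ≡⟨ ∫-cong (coin s) (λ b → trans (∫-*ˡ (coins n s) ⟦ b ⟧ _) (trans (cong (⟦ b ⟧ *_) (∫-coin-at n s j)) (*-comm _ _))) ⟩
    ∫ (coin s) (λ b → 1/ suc s * ⟦ b ⟧)                    ≡⟨ ∫-*ˡ (coin s) (1/ suc s) ⟦_⟧ ⟩
    1/ suc s * ∫ (coin s) ⟦_⟧                              ≡⟨ cong (1/ suc s *_) (∫-coin s) ⟩
    1/ suc s * 1/ suc s                                    ∎ where open ≡-Reasoning
  ∫-coin-at² (suc n) s {suc i} {zero}  i≢j =
    trans (∫-cong (coins (suc n) s) (λ c → *-comm _ _)) (∫-coin-at² (suc n) s {zero} {suc i} (i≢j ∘ sym))
  ∫-coin-at² (suc n) s {suc i} {suc j} i≢j = begin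
    ∫ (coins (suc n) s) (λ c → ⟦ Vec.lookup c (suc i) ⟧ * ⟦ Vec.lookup c (suc j) ⟧) ≡⟨ ∫-coins-suc n s _ ⟩
    ∫ (coin s) (λ _ → ∫ (coins n s) (λ c → ⟦ Vec.lookup c i ⟧ * ⟦ Vec.lookup c j ⟧))
      ≡⟨ ∫-const (coin-isProbability s) _ ⟩
    ∫ (coins n s) (λ c → ⟦ Vec.lookup c i ⟧ * ⟦ Vec.lookup c j ⟧) ≡⟨ ∫-coin-at² n s (i≢j ∘ cong suc) ⟩
    1/ suc s * 1/ suc s                                    ∎ where open ≡-Reasoning

Unique-resp-↭ : ∀ {A : Set} {xs ys : List A} → xs ↭ ys → Unique xs → Unique ys
Unique-resp-↭ p = Permutation.Unique-resp-↭ (setoid _) (↭⇒↭ₛ p)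

-- Vertex partitions, and acyclicity as the absence of redundant merges.

module Labelling {n : ℕ.ℕ} {E : Set} (lo hi : E → Fin n) where

  -- A labelling of the vertices represents a partition into components:
  -- two vertices lie in the same component when their labels agree.
  merge : (Fin n → Fin n) → E → Fin n → Fin n
  merge c e x = if does (c x ≟ c (lo e)) then c (hi e) else c x

  Merged : (Fin n → Fin n) → E → Set
  Merged c e = c (lo e) ≡ c (hi e)

  merge-cong : ∀ c e {x y} → c x ≡ c y → merge c e x ≡ merge c e y
  merge-cong c e eq rewrite eq = refl

  merge-merged : ∀ c e → Merged (merge c e) e
  merge-merged c e with c (lo e) ≟ c (lo e) | c (hi e) ≟ c (lo e)
  ... | yes _ | yes _ = refl
  ... | yes _ | no _  = refl
  ... | no ≢  | _     = contradiction refl ≢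

  merge⁻ : ∀ c e {x y} → merge c e x ≡ merge c e y →
           c x ≡ c y ⊎ (c x ≡ c (lo e) × c y ≡ c (hi e)) ⊎ (c x ≡ c (hi e) × c y ≡ c (lo e))
  merge⁻ c e {x} {y} eq with c x ≟ c (lo e) | c y ≟ c (lo e)
  ... | yes p | yes q = inj₁ (trans p (sym q))
  ... | yes p | no _  = inj₂ (inj₁ (p , sym eq))
  ... | no _  | yes q = inj₂ (inj₂ (eq , q))
  ... | no _  | no _  = inj₁ eq

  -- An incremental form of acyclicity that can be checked along a run of Kruskal's algorithm or of
  -- the online rule. For `c = id` it is equivalent to the absence of cycles when the edges are
  -- distinct.
  Forest : (Fin n → Fin n) → List E → Set
  Forest c []       = ⊤
  Forest c (e ∷ es) = ¬ Merged c e × Forest (merge c e) es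

  Forest⇒¬Merged : ∀ {c es} → Forest c es → ∀ {e} → e ∈ es → ¬ Merged c e
  Forest⇒¬Merged (¬m , _) (here refl)      = ¬m
  Forest⇒¬Merged {c} {f ∷ _} (_ , F) (there e∈) = Forest⇒¬Merged F e∈ ∘ merge-cong c f

  -- The list is consumed from its end, so that an ascending list is merged heaviest edge first.
  components : List E → Fin n → Fin n
  components []       = id
  components (e ∷ es) = merge (components es) e

  components-merged : ∀ es {e} → e ∈ es → Merged (components es) e
  components-merged (e ∷ es) (here refl) = merge-merged (components es) e
  components-merged (f ∷ es) (there e∈)  = merge-cong (components es) f (components-merged es e∈)

  components-least : ∀ es c → (∀ {e} → e ∈ es → Merged c e) →
                     ∀ {x y} → components es x ≡ components es y → c x ≡ c y
  components-least []       c m eq = cong c eq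
  components-least (e ∷ es) c m eq with merge⁻ (components es) e eq
  ... | inj₁ p              = components-least es c (m ∘ there) p
  ... | inj₂ (inj₁ (p , q)) = trans (components-least es c (m ∘ there) p)
        (trans (m (here refl)) (sym (components-least es c (m ∘ there) q)))
  ... | inj₂ (inj₂ (p , q)) = trans (components-least es c (m ∘ there) p)
        (trans (sym (m (here refl))) (sym (components-least es c (m ∘ there) q)))

  -- The label of a vertex lies in the component of that vertex, so the labels can serve as roots.
  components-idempotent : ∀ es x → components es (components es x) ≡ components es x
  components-idempotent []       x = refl
  components-idempotent (e ∷ es) x with components es x ≟ components es (lo e)
  ... | yes _ rewrite components-idempotent es (hi e) with components es (hi e) ≟ components es (lo e)
  ...   | yes _ = refl
  ...   | no _  = refl
  components-idempotent (e ∷ es) x | no ≢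
    rewrite components-idempotent es x with components es x ≟ components es (lo e)
  ...   | yes p = contradiction p ≢
  ...   | no _  = refl

lower upper : ∀ {n m} → Multigraph n m → Fin m → Fin n
lower G e = Endpoints.lo (G e)
upper G e = Endpoints.hi (G e)

lo≢hi : ∀ {n} (p : Endpoints n) → Endpoints.lo p ≢ Endpoints.hi p
lo≢hi (endpoints l h l<h) eq = <-irrefl eq (recompute (l <? h) l<h)

lower≢upper : ∀ {n m} (G : Multigraph n m) e → lower G e ≢ upper G e
lower≢upper G e = lo≢hi (G e)

module _ {n m} (G : Multigraph n m) where

  open Labelling (lower G) (upper G)

  module _ (c : Fin n → Fin n) where

    walk-merged : ∀ {u vs es w} → Walk G u vs es w → All (Merged c) es → c u ≡ c w
    walk-merged stop []                                        = refl
    walk-merged (step (inj₁ (refl , refl)) p) (q ∷ qs) = trans q (walk-merged p qs)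
    walk-merged (step (inj₂ (refl , refl)) p) (q ∷ qs) = trans (sym q) (walk-merged p qs)

    walk-through : ∀ {e u vs es w} → Walk G u vs es w → Unique es → e ∈ es →
                   All (λ f → f ≡ e ⊎ Merged c f) es →
                   (c u ≡ c (lower G e) × c (upper G e) ≡ c w) ⊎ (c u ≡ c (upper G e) × c (lower G e) ≡ c w)
    walk-through {e} (step j p) (e∉ ∷ _) (here refl) (_ ∷ qs) = join j (walk-merged p (All.tabulate rest))
      where
      rest : ∀ {f} → f ∈ _ → Merged c f
      rest f∈ with All.lookup qs f∈
      ... | inj₁ refl = contradiction refl (All.lookup e∉ f∈)
      ... | inj₂ q    = q
      join : ∀ {u v w} → Joins (G e) u v → c v ≡ c w →
             (c u ≡ c (lower G e) × c (upper G e) ≡ c w) ⊎ (c u ≡ c (upper G e) × c (lower G e) ≡ c w)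
      join (inj₁ (refl , refl)) q = inj₁ (refl , q)
      join (inj₂ (refl , refl)) q = inj₂ (refl , q)
    walk-through (step j p) (f∉ ∷ uq) (there e∈) (inj₁ refl ∷ qs) = contradiction refl (All.lookup f∉ e∈)
    walk-through (step (inj₁ (refl , refl)) p) (_ ∷ uq) (there e∈) (inj₂ q ∷ qs) with walk-through p uq e∈ qs
    ... | inj₁ (a , b) = inj₁ (trans q a , b)
    ... | inj₂ (a , b) = inj₂ (trans q a , b)
    walk-through (step (inj₂ (refl , refl)) p) (_ ∷ uq) (there e∈) (inj₂ q ∷ qs) with walk-through p uq e∈ qs
    ... | inj₁ (a , b) = inj₁ (trans (sym q) a , b)
    ... | inj₂ (a , b) = inj₂ (trans (sym q) a , b)

  -- Induction on `S`. Once `e` is merged, all edges of the walk are merged, so none of them lies in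
  -- the rest of the forest. What remains are merged edges and `e`, at most once; but a closed walk
  -- that crosses `e` once connects the ends of `e` by merged edges, so `e` is merged as well.
  closed-walk-merged : ∀ {c S u vs es} → Forest c S → Walk G u vs es u → Unique es →
                       All (λ f → f ∈ S ⊎ Merged c f) es → All (Merged c) es
  closed-walk-merged {S = []} _ _ _ h = All.map (λ { (inj₂ q) → q }) h
  closed-walk-merged {c} {e ∷ S} {es = es} (¬m , F) p uq h = All.tabulate λ f∈ → go f∈ (All.lookup h f∈)
    where
    merged′ : All (Merged (merge c e)) es
    merged′ = closed-walk-merged F p uq (All.map (λ
      { (inj₁ (here refl)) → inj₂ (merge-merged c e)
      ; (inj₁ (there f∈))  → inj₁ f∈
      ; (inj₂ q)           → inj₂ (merge-cong c e q) }) h)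
    ∉S : ∀ {f} → f ∈ es → f ∉ S
    ∉S f∈ f∈S = Forest⇒¬Merged F f∈S (All.lookup merged′ f∈)
    e-or-merged : All (λ f → f ≡ e ⊎ Merged c f) es
    e-or-merged = All.tabulate λ {f} f∈ → case (All.lookup h f∈) f∈
      where
      case : ∀ {f} → f ∈ e ∷ S ⊎ Merged c f → f ∈ es → f ≡ e ⊎ Merged c f
      case (inj₁ (here eq))   _  = inj₁ eq
      case (inj₁ (there f∈S)) f∈ = contradiction f∈S (∉S f∈)
      case (inj₂ q)           _  = inj₂ q
    go : ∀ {f} → f ∈ es → f ∈ e ∷ S ⊎ Merged c f → Merged c f
    go f∈ (inj₂ q)           = q
    go f∈ (inj₁ (there f∈S)) = contradiction f∈S (∉S f∈)
    go f∈ (inj₁ (here refl)) with walk-through c p uq f∈ e-or-merged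
    ... | inj₁ (a , b) = trans (sym a) (sym b)
    ... | inj₂ (a , b) = trans b a

  Forest⇒Acyclic : ∀ {S} → Forest id S → Acyclic G S
  Forest⇒Acyclic F (_ , _ , []     , (es≢[] , _) , _) = es≢[] refl
  Forest⇒Acyclic F (_ , _ , e ∷ es , (_ , p , _ , uq) , es∈) =
    lower≢upper G e (All.head (closed-walk-merged F p uq (All.map inj₁ es∈)))

  -- The `inside` fields confine a path to one class of `c`. Two paths in different classes are then
  -- automatically disjoint, and `bridge` can join them without repeating a vertex or an edge.
  record Path (c : Fin n → Fin n) (S : List (Fin m)) (x y : Fin n) : Set where
    field
      {vertices} : List (Fin n)
      {edges}    : List (Fin m)
      walk       : Walk G x vertices edges y
      distinctᵛ  : Unique (vertices ∷ʳ y)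
      distinctᵉ  : Unique edges
      insideᵛ    : All (λ v → c v ≡ c y) (vertices ∷ʳ y)
      insideᵉ    : All (λ e → c (lower G e) ≡ c y × c (upper G e) ≡ c y) edges
      uses       : All (_∈ S) edges

  open Path

  _++ʷ_ : ∀ {u v w vs vs′ es es′} → Walk G u vs es v → Walk G v vs′ es′ w → Walk G u (vs ++ vs′) (es ++ es′) w
  stop     ++ʷ q = q
  step j p ++ʷ q = step j (p ++ʷ q)

  coarsen : ∀ {c S e x y} → Path c S x y → Path (merge c e) (e ∷ S) x y
  coarsen {c} {e = e} p = record
    { walk      = walk p
    ; distinctᵛ = distinctᵛ p
    ; distinctᵉ = distinctᵉ p
    ; insideᵛ   = All.map (merge-cong c e) (insideᵛ p)
    ; insideᵉ   = All.map (λ { (a , b) → merge-cong c e a , merge-cong c e b }) (insideᵉ p)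
    ; uses      = All.map there (uses p)
    }

  bridge : ∀ {c S e x a b y} → Joins (G e) a b → c a ≢ c b → Path c S x a → Path c S b y → c y ≡ c b →
           Path (merge c e) (e ∷ S) x y
  bridge {c} {S} {e} {x} {a} {b} {y} j a≢b p q y≡b = record
    { walk      = walk p ++ʷ step j (walk q)
    ; distinctᵛ = subst Unique vertices≡ (Unique.++⁺ (distinctᵛ p) (distinctᵛ q)
        λ { (v∈p , v∈q) → a≢b (trans (sym (All.lookup (insideᵛ p) v∈p)) (trans (All.lookup (insideᵛ q) v∈q) y≡b)) })
    ; distinctᵉ = Unique.++⁺ (distinctᵉ p) (All.tabulate (λ f∈ → λ { refl → e∉q j f∈ }) ∷ distinctᵉ q)
        λ { (f∈p , here refl)  → e∉p j f∈p
          ; (f∈p , there f∈q) → a≢b (trans (sym (proj₁ (All.lookup (insideᵉ p) f∈p)))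
              (trans (proj₁ (All.lookup (insideᵉ q) f∈q)) y≡b)) }
    ; insideᵛ   = subst (All _) vertices≡ (All.++⁺
        (All.map (λ eq → trans (merge-cong c e eq) a≡y) (insideᵛ p)) (All.map (merge-cong c e) (insideᵛ q)))
    ; insideᵉ   = All.++⁺
        (All.map (λ { (l , r) → trans (merge-cong c e l) a≡y , trans (merge-cong c e r) a≡y }) (insideᵉ p))
        (ends j ∷ All.map (λ { (l , r) → merge-cong c e l , merge-cong c e r }) (insideᵉ q))
    ; uses      = All.++⁺ (All.map there (uses p)) (here refl ∷ All.map there (uses q))
    }
    where
    vertices≡ : (vertices p ∷ʳ a) ++ (vertices q ∷ʳ y) ≡ (vertices p ++ a ∷ vertices q) ∷ʳ y
    vertices≡ = trans (++-assoc (vertices p) _ _) (sym (++-assoc (vertices p) _ _))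
    a≡b′ : Joins (G e) a b → merge c e a ≡ merge c e b
    a≡b′ (inj₁ (refl , refl)) = merge-merged c e
    a≡b′ (inj₂ (refl , refl)) = sym (merge-merged c e)
    a≡y : merge c e a ≡ merge c e y
    a≡y = trans (a≡b′ j) (sym (merge-cong c e y≡b))
    ends : Joins (G e) a b → merge c e (lower G e) ≡ merge c e y × merge c e (upper G e) ≡ merge c e y
    ends (inj₁ (refl , refl)) = a≡y , trans (sym (merge-merged c e)) a≡y
    ends (inj₂ (refl , refl)) = trans (merge-merged c e) a≡y , a≡y
    e∉p : Joins (G e) a b → e ∉ edges p
    e∉p (inj₁ (refl , refl)) e∈ = a≢b (sym (proj₂ (All.lookup (insideᵉ p) e∈)))
    e∉p (inj₂ (refl , refl)) e∈ = a≢b (sym (proj₁ (All.lookup (insideᵉ p) e∈)))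
    e∉q : Joins (G e) a b → e ∉ edges q
    e∉q (inj₁ (refl , refl)) e∈ = a≢b (trans (proj₁ (All.lookup (insideᵉ q) e∈)) y≡b)
    e∉q (inj₂ (refl , refl)) e∈ = a≢b (trans (proj₂ (All.lookup (insideᵉ q) e∈)) y≡b)

  Paths : (Fin n → Fin n) → List (Fin m) → Set
  Paths c S = ∀ {x y} → c x ≡ c y → Path c S x y

  trivialPaths : Paths id []
  trivialPaths refl = record
    { walk = stop ; distinctᵛ = [] ∷ [] ; distinctᵉ = [] ; insideᵛ = refl ∷ [] ; insideᵉ = [] ; uses = [] }

  extendPaths : ∀ {c S e} → ¬ Merged c e → Paths c S → Paths (merge c e) (e ∷ S)
  extendPaths {c} {e = e} ¬m paths eq with merge⁻ c e eq
  ... | inj₁ p              = coarsen (paths p)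
  ... | inj₂ (inj₁ (p , q)) = bridge (inj₁ (refl , refl)) ¬m (paths p) (paths (sym q)) q
  ... | inj₂ (inj₂ (p , q)) = bridge (inj₂ (refl , refl)) (¬m ∘ sym) (paths p) (paths (sym q)) q

  closeCycle : ∀ {c S e} → e ∉ S → Path c S (upper G e) (lower G e) →
               ∃[ u ] ∃[ vs ] ∃[ es ] IsCycle G u vs es × All (_∈ e ∷ S) es
  closeCycle {e = e} e∉S p = lower G e , lower G e ∷ vertices p , e ∷ edges p ,
    ((λ ()) , step (inj₁ (refl , refl)) (walk p)
      , Unique-resp-↭ (++-comm (vertices p) [ lower G e ]) (distinctᵛ p)
      , All.map (λ { f∈ refl → e∉S f∈ }) (uses p) ∷ distinctᵉ p)
    , here refl ∷ All.map there (uses p)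

  -- `S` holds the edges merged so far, and every class of `c` is connected by paths in `S`. An edge
  -- inside a class would close a cycle with such a path.
  acyclic-merge : ∀ {X c S} es → Acyclic G X → All (_∈ X) S → All (_∈ X) es → Unique es →
                  (∀ {e} → e ∈ es → e ∉ S) → Paths c S → Forest c es
  acyclic-merge []       ac S⊆X es⊆X uq dis paths = tt
  acyclic-merge {X} {c} {S} (e ∷ es) ac S⊆X (e∈X ∷ es⊆X) (e∉es ∷ uq) dis paths =
    ¬m , acyclic-merge es ac (e∈X ∷ S⊆X) es⊆X uq dis′ (extendPaths ¬m paths)
    where
    ¬m : ¬ Merged c e
    ¬m eq with closeCycle (dis (here refl)) (paths (sym eq))
    ... | u , vs , es′ , cyc , es∈ = ac (u , vs , es′ , cyc , All.map (All.lookup (e∈X ∷ S⊆X)) es∈)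
    dis′ : ∀ {f} → f ∈ es → f ∉ e ∷ S
    dis′ f∈ (here refl)  = All.lookup e∉es f∈ refl
    dis′ f∈ (there f∈S) = dis (there f∈) f∈S

  Acyclic⇒Forest : ∀ {X} → Unique X → Acyclic G X → Forest id X
  Acyclic⇒Forest {X} uq ac = acyclic-merge X ac [] (All.tabulate id) uq (λ _ ()) trivialPaths

-- Rooted spanning forests and parent edges.

module Parents {n : ℕ} {E : Set} (lo hi : E → Fin n) where

  open Labelling lo hi

  -- Deleting an edge splits its tree; the half that loses the old root is rooted at the tail of the
  -- deleted edge.
  reroot : (Fin n → Fin n) → (Fin n → Fin n) → Fin n → Fin n → Fin n
  reroot c ρ t x = if does (c x ≟ c t) then t else ρ x

  -- The end of `e` on the side without the root, so that arcs point towards the root.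
  tail : (Fin n → Fin n) → (Fin n → Fin n) → E → Fin n
  tail c ρ e = if does (c (ρ (lo e)) ≟ c (lo e)) then hi e else lo e

  -- The edge from each vertex to its parent in the spanning forest that Kruskal's
  -- algorithm builds from the end of the list; ρ names the root of each component.
  parent : List E → (Fin n → Fin n) → Fin n → Maybe E
  parent []       ρ v = nothing
  parent (e ∷ es) ρ v = let c = components es ; t = tail c ρ e in
    if does (c (lo e) ≟ c (hi e)) then parent es ρ v
    else if does (v ≟ t) then just e else parent es (reroot c ρ t) v

  record Roots (es : List E) (ρ : Fin n → Fin n) : Set where
    field
      inside : ∀ x → components es (ρ x) ≡ components es x
      unique : ∀ {x y} → components es x ≡ components es y → ρ x ≡ ρ y

  open Roots

  components-roots : ∀ es → Roots es (components es)
  components-roots es = record { inside = components-idempotent es ; unique = id }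

  tail-end : ∀ c ρ e → tail c ρ e ≡ lo e ⊎ tail c ρ e ≡ hi e
  tail-end c ρ e with c (ρ (lo e)) ≟ c (lo e)
  ... | yes _ = inj₂ refl
  ... | no  _ = inj₁ refl

  roots-tail : ∀ {e es ρ} → Roots (e ∷ es) ρ → ρ (tail (components es) ρ e) ≡ ρ (lo e)
  roots-tail {e} {es} {ρ} r with tail-end (components es) ρ e
  ... | inj₁ eq = cong ρ eq
  ... | inj₂ eq = trans (cong ρ eq) (sym (unique r (merge-merged (components es) e)))

  tail-cut : ∀ {e es ρ} → Roots (e ∷ es) ρ → ¬ Merged (components es) e →
             components es (ρ (lo e)) ≢ components es (tail (components es) ρ e)
  tail-cut {e} {es} {ρ} r ¬m eq with components es (ρ (lo e)) ≟ components es (lo e)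
  ... | yes p = ¬m (trans (sym p) eq)
  ... | no ¬p = ¬p eq

  skip-roots : ∀ {e es ρ} → Roots (e ∷ es) ρ → Merged (components es) e → Roots es ρ
  skip-roots {e} {es} {ρ} r m = record { inside = inside′ ; unique = unique r ∘ merge-cong (components es) e }
    where
    inside′ : ∀ x → components es (ρ x) ≡ components es x
    inside′ x with merge⁻ (components es) e (inside r x)
    ... | inj₁ eq             = eq
    ... | inj₂ (inj₁ (p , q)) = trans p (trans m (sym q))
    ... | inj₂ (inj₂ (p , q)) = trans p (trans (sym m) (sym q))

  reroot-roots : ∀ {e es ρ} → Roots (e ∷ es) ρ → ¬ Merged (components es) e →
                 Roots es (reroot (components es) ρ (tail (components es) ρ e))
  reroot-roots {e} {es} {ρ} r ¬m = record { inside = inside′ ; unique = unique′ }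
    where
    c = components es
    t = tail c ρ e
    lo-root : ∀ {x} → c x ≡ c (lo e) ⊎ c x ≡ c (hi e) → ρ x ≡ ρ (lo e)
    lo-root (inj₁ eq) = unique r (merge-cong c e eq)
    lo-root (inj₂ eq) = unique r (trans (merge-cong c e eq) (sym (merge-merged c e)))
    inside′ : ∀ x → c (reroot c ρ t x) ≡ c x
    inside′ x with c x ≟ c t
    ... | yes eq = sym eq
    ... | no ¬eq with merge⁻ c e (inside r x) | tail-end c ρ e
    ...   | inj₁ eq             | _       = eq
    ...   | inj₂ (inj₁ (p , q)) | inj₁ t≡ = contradiction
            (trans (cong c (sym (lo-root (inj₂ q)))) (trans p (cong c (sym t≡)))) (tail-cut r ¬m)
    ...   | inj₂ (inj₁ (p , q)) | inj₂ t≡ = contradiction (trans q (cong c (sym t≡))) ¬eq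
    ...   | inj₂ (inj₂ (p , q)) | inj₁ t≡ = contradiction (trans q (cong c (sym t≡))) ¬eq
    ...   | inj₂ (inj₂ (p , q)) | inj₂ t≡ = contradiction
            (trans (cong c (sym (lo-root (inj₁ q)))) (trans p (cong c (sym t≡)))) (tail-cut r ¬m)
    unique′ : ∀ {x y} → c x ≡ c y → reroot c ρ t x ≡ reroot c ρ t y
    unique′ {x} {y} eq with c x ≟ c t | c y ≟ c t
    ... | yes _ | yes _  = refl
    ... | yes p | no ¬p  = contradiction (trans (sym eq) p) ¬p
    ... | no ¬p | yes p  = contradiction (trans eq p) ¬p
    ... | no _  | no _   = unique r (merge-cong c e eq)

  reroot-tail : ∀ c ρ t → reroot c ρ t t ≡ t
  reroot-tail c ρ t with c t ≟ c t
  ... | yes _ = refl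
  ... | no ≢  = contradiction refl ≢

  parent⇒¬root : ∀ {es ρ} → Roots es ρ → ∀ {v e} → parent es ρ v ≡ just e → ρ v ≢ v
  parent⇒¬root {f ∷ es} {ρ} r {v} eq with components es (lo f) ≟ components es (hi f)
  ... | yes m = parent⇒¬root (skip-roots r m) eq
  ... | no ¬m with v ≟ tail (components es) ρ f
  ...   | yes v≡t = λ ρv≡v → tail-cut r ¬m
          (cong (components es) (trans (sym (roots-tail r)) (trans (cong ρ (sym v≡t)) (trans ρv≡v v≡t))))
  ...   | no v≢t with components es v ≟ components es (tail (components es) ρ f) | parent⇒¬root (reroot-roots r ¬m) {v} eq
  ...     | yes p | _  = λ ρv≡v → tail-cut r ¬m
            (trans (cong (components es) (trans (sym (roots-tail r))
              (trans (unique r (sym (merge-cong (components es) f p))) ρv≡v))) p)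
  ...     | no _  | ih = ih

  -- The last hypothesis says that `e` enters the forest. No edge `f` of `es₁` overrides the parent
  -- found further down: `f` goes to its tail, which is the root of its half and therefore has no
  -- parent there.
  ∃-parent : ∀ {ρ} es₁ {e es₂} → Roots (es₁ ++ e ∷ es₂) ρ → ¬ Merged (components es₂) e →
             ∃[ u ] parent (es₁ ++ e ∷ es₂) ρ u ≡ just e
  ∃-parent {ρ} [] {e} {es₂} r ¬m = tail (components es₂) ρ e , found
    where
    found : parent (e ∷ es₂) ρ (tail (components es₂) ρ e) ≡ just e
    found with components es₂ (lo e) ≟ components es₂ (hi e)
    ... | yes m = contradiction m ¬m
    ... | no _ with tail (components es₂) ρ e ≟ tail (components es₂) ρ e
    ...   | yes _ = refl
    ...   | no ≢  = contradiction refl ≢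
  ∃-parent {ρ} (f ∷ es₁) {e} {es₂} r ¬m with components (es₁ ++ e ∷ es₂) (lo f) ≟ components (es₁ ++ e ∷ es₂) (hi f)
  ... | yes m = ∃-parent es₁ (skip-roots r m) ¬m
  ... | no ¬m′ with ∃-parent es₁ (reroot-roots r ¬m′) ¬m
  ...   | u , eq = u , found
    where
    c = components (es₁ ++ e ∷ es₂)
    found : (if does (u ≟ tail c ρ f) then just f else parent (es₁ ++ e ∷ es₂) (reroot c ρ (tail c ρ f)) u) ≡ just e
    found with u ≟ tail c ρ f
    ... | yes refl = contradiction (reroot-tail c ρ (tail c ρ f)) (parent⇒¬root (reroot-roots r ¬m′) eq)
    ... | no _     = eq

  parent⁻ : ∀ es ρ {v e} → parent es ρ v ≡ just e → e ∈ es × (v ≡ lo e ⊎ v ≡ hi e)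
  parent⁻ (f ∷ es) ρ {v} eq with components es (lo f) ≟ components es (hi f)
  ... | yes _ = let e∈ , end = parent⁻ es ρ eq in there e∈ , end
  ... | no _ with v ≟ tail (components es) ρ f
  ...   | no _ = let e∈ , end = parent⁻ es _ eq in there e∈ , end
  ...   | yes v≡t with refl ← just-injective eq = here refl , subst (λ t → t ≡ lo f ⊎ t ≡ hi f) (sym v≡t) (tail-end (components es) ρ f)

  -- One arrival can thus be the arc of at most one vertex.
  parent-injective : ∀ {es} → Unique es → ∀ ρ {v w e} → parent es ρ v ≡ just e → parent es ρ w ≡ just e → v ≡ w
  parent-injective {f ∷ es} (f∉ ∷ uq) ρ {v} {w} p q with components es (lo f) ≟ components es (hi f)
  ... | yes _ = parent-injective uq ρ p q
  ... | no _ with v ≟ tail (components es) ρ f | w ≟ tail (components es) ρ f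
  ...   | yes v≡t | yes w≡t = trans v≡t (sym w≡t)
  ...   | yes v≡t | no _ with refl ← just-injective p = contradiction refl (All.lookup f∉ (proj₁ (parent⁻ es _ q)))
  ...   | no _ | yes w≡t with refl ← just-injective q = contradiction refl (All.lookup f∉ (proj₁ (parent⁻ es _ p)))
  parent-injective {f ∷ es} (f∉ ∷ uq) ρ p q | no _ | no _ | no _ = parent-injective uq _ p q

-- Kruskal's algorithm and its optimality.

module Kruskal {n : ℕ} {E : Set} (lo hi : E → Fin n) where

  open Labelling lo hi

  infix 4 _≼_
  _≼_ : (Fin n → Fin n) → (Fin n → Fin n) → Set
  c ≼ d = ∀ x y → c x ≡ c y → d x ≡ d y

  merge-≼ : ∀ c e → c ≼ merge c e
  merge-≼ c e x y = merge-cong c e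

  merge-least : ∀ {c d e} → c ≼ d → Merged d e → merge c e ≼ d
  merge-least {c} {d} {e} le m x y eq with merge⁻ c e eq
  ... | inj₁ p              = le x y p
  ... | inj₂ (inj₁ (p , q)) = trans (le _ _ p) (trans m (sym (le _ _ q)))
  ... | inj₂ (inj₂ (p , q)) = trans (le _ _ p) (trans (sym m) (sym (le _ _ q)))

  merge-mono : ∀ {c d} e → c ≼ d → merge c e ≼ merge d e
  merge-mono {c} {d} e le = merge-least (λ x y eq → merge-cong d e (le x y eq)) (merge-merged d e)

  foldl-mono : ∀ {c d} es → c ≼ d → foldl merge c es ≼ foldl merge d es
  foldl-mono []       le = le
  foldl-mono (e ∷ es) le = foldl-mono es (merge-mono e le)

  Forest-anti : ∀ {c d} es → c ≼ d → Forest d es → Forest c es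
  Forest-anti []       le F        = F
  Forest-anti (e ∷ es) le (¬m , F) = ¬m ∘ le _ _ , Forest-anti es (merge-mono e le) F

  -- Consumes the list from its front, unlike `components` and `parent`, so it is meant for
  -- descending lists.
  kruskal : (Fin n → Fin n) → List E → List E
  kruskal c []       = []
  kruskal c (e ∷ es) = if does (c (lo e) ≟ c (hi e)) then kruskal c es else e ∷ kruskal (merge c e) es

  foldl-merged : ∀ c es {f} → Merged c f → Merged (foldl merge c es) f
  foldl-merged c []       m = m
  foldl-merged c (e ∷ es) m = foldl-merged (merge c e) es (merge-cong c e m)

  foldl-merged-∈ : ∀ c es {f} → f ∈ es → Merged (foldl merge c es) f
  foldl-merged-∈ c (e ∷ es) (here refl) = foldl-merged (merge c e) es (merge-merged c e)
  foldl-merged-∈ c (e ∷ es) (there f∈)  = foldl-merged-∈ (merge c e) es f∈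

  -- Skipping a redundant edge leaves the partition unchanged, so the partition met by `e` is
  -- generated by all earlier edges, taken or not.
  kruskal⁻ : ∀ c es {e} → e ∈ kruskal c es →
             ∃[ es₁ ] ∃[ es₂ ] es ≡ es₁ ++ e ∷ es₂ × ¬ Merged (foldl merge c es₁) e
  kruskal⁻ c (f ∷ es) e∈ with c (lo f) ≟ c (hi f)
  kruskal⁻ c (f ∷ es) e∈ | yes m with kruskal⁻ c es e∈
  ... | es₁ , es₂ , refl , ¬m = f ∷ es₁ , es₂ , refl , ¬m ∘ skipped es₁
    where
    skipped : ∀ gs {g} → Merged (foldl merge (merge c f) gs) g → Merged (foldl merge c gs) g
    skipped gs {g} = foldl-mono gs (merge-least (λ _ _ → id) m) (lo g) (hi g)
  kruskal⁻ c (f ∷ es) (here refl) | no ¬m = [] , es , refl , ¬m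
  kruskal⁻ c (f ∷ es) (there e∈)  | no ¬m with kruskal⁻ (merge c f) es e∈
  ... | es₁ , es₂ , refl , ¬m′ = f ∷ es₁ , es₂ , refl , ¬m′

  kruskal-⊆ : ∀ c es → kruskal c es ⊆ es
  kruskal-⊆ c []       = []
  kruskal-⊆ c (e ∷ es) with c (lo e) ≟ c (hi e)
  ... | yes _ = skip e (kruskal-⊆ c es)
  ... | no _  = refl ∷ kruskal-⊆ (merge c e) es

module KruskalOptimal (R : CompleteOrderedField) {n : ℕ} {E : Set} (lo hi : E → Fin n)
                      (w : E → CompleteOrderedField.ℝ R) (w≥0 : ∀ e → CompleteOrderedField._≤_ R (CompleteOrderedField.0# R) (w e)) where

  open GraphicSecretary R using (ℝ; _+_; _≤_; 0#)
  open OrderedField R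
  open Expectation R
  open Labelling lo hi
  open Kruskal lo hi

  kruskalWeight : (Fin n → Fin n) → List E → ℝ
  kruskalWeight c es = ∑ (kruskal c es) w

  kruskalWeight-cong : ∀ {c d} es → c ≼ d → d ≼ c → kruskalWeight c es ≡ kruskalWeight d es
  kruskalWeight-cong []       c≼d d≼c = refl
  kruskalWeight-cong {c} {d} (e ∷ es) c≼d d≼c with c (lo e) ≟ c (hi e) | d (lo e) ≟ d (hi e)
  ... | yes _ | yes _  = kruskalWeight-cong es c≼d d≼c
  ... | no _  | no _   = cong (w e +_) (kruskalWeight-cong es (merge-mono e c≼d) (merge-mono e d≼c))
  ... | yes m | no ¬m  = contradiction (c≼d _ _ m) ¬m
  ... | no ¬m | yes m  = contradiction (d≼c _ _ m) ¬m

  -- Contracting e costs at most one greedy edge, namely the first one that e makes redundant.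
  kruskalWeight-contract : ∀ {c d e w₀} es → merge c e ≼ d → d ≼ merge c e → 0# ≤ w₀ → All (λ f → w f ≤ w₀) es →
                           kruskalWeight c es ≤ w₀ + kruskalWeight d es
  kruskalWeight-contract [] _ _ w₀≥0 _ = +-nonneg w₀≥0 ≤-refl
  kruskalWeight-contract {c} {d} {e} {w₀} (f ∷ es) le ge w₀≥0 (wf≤ ∷ ws≤)
    with c (lo f) ≟ c (hi f) | d (lo f) ≟ d (hi f)
  ... | yes _ | yes _  = kruskalWeight-contract es le ge w₀≥0 ws≤
  ... | yes m | no ¬m  = contradiction (le _ _ (merge-≼ c e _ _ m)) ¬m
  ... | no ¬m | yes m  = +-mono-≤ wf≤ (≤-reflexive (kruskalWeight-cong es
          (merge-least (λ x y eq → le x y (merge-≼ c e x y eq)) m)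
          (λ x y eq → merge-least (merge-≼ c f) e-merged x y (ge x y eq))))
    where
    e-merged : Merged (merge c f) e
    e-merged with merge⁻ c e (ge _ _ m)
    ... | inj₁ p              = contradiction p ¬m
    ... | inj₂ (inj₁ (p , q)) = trans (merge-cong c f (sym p)) (trans (merge-merged c f) (merge-cong c f q))
    ... | inj₂ (inj₂ (p , q)) = trans (merge-cong c f (sym q)) (trans (sym (merge-merged c f)) (merge-cong c f p))
  ... | no _ | no _ = begin
      w f + kruskalWeight (merge c f) es
        ≤⟨ +-monoʳ-≤ (w f) (kruskalWeight-contract es le′ ge′ w₀≥0 ws≤) ⟩
      w f + (w₀ + kruskalWeight (merge d f) es)
        ≈⟨ solve 3 (λ x y z → x :+ (y :+ z) := y :+ (x :+ z)) refl (w f) w₀ _ ⟩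
      w₀ + (w f + kruskalWeight (merge d f) es)    ∎
    where
    open ≤R
    le′ : merge (merge c f) e ≼ merge d f
    le′ = merge-least (merge-mono f (λ x y eq → le x y (merge-≼ c e x y eq)))
                      (merge-cong d f (le _ _ (merge-merged c e)))
    ge′ : merge d f ≼ merge (merge c f) e
    ge′ = merge-least (λ x y eq → merge-mono e (merge-≼ c f) x y (ge x y eq))
                      (merge-cong (merge c f) e (merge-merged c f))

  -- If `X` contains the heaviest edge, Kruskal takes it too, because `X` is a forest. If `X` omits
  -- it and Kruskal takes it, the gain of `w e` pays for the single later greedy edge that may
  -- become redundant.
  kruskal-optimal : ∀ {c X es} → X ⊆ es → AllPairs (λ e f → w f ≤ w e) es → Forest c X →
    ∑ X w ≤ kruskalWeight c es
  kruskal-optimal [] [] _ = ≤-refl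
  kruskal-optimal {c} {X} {e ∷ es} (skip _ X⊆) (e≥ ∷ desc) F with c (lo e) ≟ c (hi e) | kruskal-optimal X⊆ desc F
  ... | yes _ | ih = ih
  ... | no _  | ih = ≤-trans ih (kruskalWeight-contract {c} {e = e} es (λ _ _ → id) (λ _ _ → id) (w≥0 e) e≥)
  kruskal-optimal {c} {e ∷ X} (refl ∷ X⊆) (_ ∷ desc) (¬m , F) with c (lo e) ≟ c (hi e)
  ... | yes m = contradiction m ¬m
  ... | no _  = +-monoʳ-≤ (w e) (kruskal-optimal X⊆ desc F)

-- Uniformly random orders, read from the last arrival backwards.

picks : {A : Set} → List A → List (A × List A)
picks []       = []
picks (x ∷ xs) = (x , xs) ∷ map (λ p → proj₁ p , x ∷ proj₂ p) (picks xs)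

picks-↭ : ∀ {A : Set} {x : A} {xs ys} → (x , ys) ∈ picks xs → x ∷ ys ↭ xs
picks-↭ {xs = _ ∷ _} (here refl) = ↭-refl
picks-↭ {xs = y ∷ _} (there p∈) with ∈-map⁻ _ p∈
... | (x , ys) , p∈′ , refl = ↭-trans (↭-swap x y ↭-refl) (↭-prep y (picks-↭ p∈′))

picks-length : ∀ {A : Set} {x : A} {xs ys s} → length xs ≡ suc s → (x , ys) ∈ picks xs → length ys ≡ s
picks-length len p∈ = ℕ.suc-injective (trans (↭-length (picks-↭ p∈)) len)

map-proj₁-picks : ∀ {A : Set} (xs : List A) → map proj₁ (picks xs) ≡ xs
map-proj₁-picks []       = refl
map-proj₁-picks (x ∷ xs) = cong (x ∷_) (trans (sym (map-∘ (picks xs))) (map-proj₁-picks xs))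

module RandomOrder (R : CompleteOrderedField) where

  open GraphicSecretary R using (ℝ; _+_; _*_; _⁻¹; 0#; 1#; _≤_; *-nonneg; fromℕ; sum; average)
  open OrderedField R
  open Expectation R

  private variable
    A : Set

  ∑-insertions-∷ʳ : ∀ (x : A) π e f →
    ∑ (insertions x (π ∷ʳ e)) f ≡ ∑ (insertions x π) (λ ρ → f (ρ ∷ʳ e)) + f (π ∷ʳ e ∷ʳ x)
  ∑-insertions-∷ʳ x []      e f = solve 2 (λ a b → a :+ (b :+ con 0) := a :+ con 0 :+ b) refl (f (x ∷ e ∷ [])) (f (e ∷ x ∷ []))
  ∑-insertions-∷ʳ x (y ∷ π) e f = begin
    f (x ∷ y ∷ π ∷ʳ e) + ∑ (map (y ∷_) (insertions x (π ∷ʳ e))) f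
      ≡⟨ cong (_ +_) (trans (∑-map (y ∷_) (insertions x (π ∷ʳ e)) f) (∑-insertions-∷ʳ x π e (f ∘ (y ∷_)))) ⟩
    f (x ∷ y ∷ π ∷ʳ e) + (∑ (insertions x π) (λ ρ → f (y ∷ ρ ∷ʳ e)) + f (y ∷ (π ∷ʳ e ∷ʳ x)))
      ≡⟨ sym (+-assoc _ _ _) ⟩
    f (x ∷ y ∷ π ∷ʳ e) + ∑ (insertions x π) (λ ρ → f (y ∷ ρ ∷ʳ e)) + f (y ∷ (π ∷ʳ e ∷ʳ x))
      ≡⟨ cong (λ z → f (x ∷ y ∷ π ∷ʳ e) + z + f (y ∷ (π ∷ʳ e ∷ʳ x))) (sym (∑-map (y ∷_) (insertions x π) (λ ρ → f (ρ ∷ʳ e)))) ⟩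
    f (x ∷ y ∷ π ∷ʳ e) + ∑ (map (y ∷_) (insertions x π)) (λ ρ → f (ρ ∷ʳ e)) + f (y ∷ (π ∷ʳ e ∷ʳ x)) ∎
    where open ≡-Reasoning

  -- `permutations` builds the orders by inserting the head of the list, whereas the analysis
  -- conditions on the last arrival; this regroups the orders accordingly.
  ∑-permutations-∷ʳ : ∀ (x : A) xs f →
    ∑ (permutations (x ∷ xs)) f ≡ ∑ (picks (x ∷ xs)) (λ p → ∑ (permutations (proj₂ p)) (λ π → f (π ∷ʳ proj₁ p)))
  ∑-permutations-∷ʳ x []       f = cong (_+ 0#) (sym (+-identityʳ (f [ x ])))
  ∑-permutations-∷ʳ x (y ∷ ys) f = begin
    ∑ (permutations (x ∷ xs)) f
      ≡⟨ ∑-concatMap (insertions x) (permutations xs) f ⟩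
    ∑ (permutations xs) (λ π → ∑ (insertions x π) f)
      ≡⟨ ∑-permutations-∷ʳ y ys (λ π → ∑ (insertions x π) f) ⟩
    ∑ (picks xs) (λ p → ∑ (permutations (proj₂ p)) (λ π → ∑ (insertions x (π ∷ʳ proj₁ p)) f))
      ≡⟨ ∑-cong (picks xs) (λ p → trans (∑-cong (permutations (proj₂ p)) (λ π → ∑-insertions-∷ʳ x π (proj₁ p) f))
           (∑-+ (permutations (proj₂ p)) _ _)) ⟩
    ∑ (picks xs) (λ p → ∑ (permutations (proj₂ p)) (λ π → ∑ (insertions x π) (λ ρ → f (ρ ∷ʳ proj₁ p)))
                      + ∑ (permutations (proj₂ p)) (λ π → f (π ∷ʳ proj₁ p ∷ʳ x)))
      ≡⟨ ∑-+ (picks xs) _ _ ⟩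
    ∑ (picks xs) (λ p → ∑ (permutations (proj₂ p)) (λ π → ∑ (insertions x π) (λ ρ → f (ρ ∷ʳ proj₁ p))))
      + ∑ (picks xs) (λ p → ∑ (permutations (proj₂ p)) (λ π → f (π ∷ʳ proj₁ p ∷ʳ x)))
      ≡⟨ cong₂ _+_
           (∑-cong (picks xs) (λ p → sym (∑-concatMap (insertions x) (permutations (proj₂ p)) (λ ρ → f (ρ ∷ʳ proj₁ p)))))
           (sym (∑-permutations-∷ʳ y ys (λ π → f (π ∷ʳ x)))) ⟩
    ∑ (picks xs) (λ p → ∑ (permutations (x ∷ proj₂ p)) (λ π → f (π ∷ʳ proj₁ p)))
      + ∑ (permutations xs) (λ π → f (π ∷ʳ x))
      ≡⟨ +-comm _ _ ⟩
    ∑ (permutations xs) (λ π → f (π ∷ʳ x))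
      + ∑ (picks xs) (λ p → ∑ (permutations (x ∷ proj₂ p)) (λ π → f (π ∷ʳ proj₁ p)))
      ≡⟨ cong (∑ (permutations xs) (λ π → f (π ∷ʳ x)) +_) (sym (∑-map (λ p → proj₁ p , x ∷ proj₂ p) (picks xs) _)) ⟩
    ∑ (picks (x ∷ xs)) (λ p → ∑ (permutations (proj₂ p)) (λ π → f (π ∷ʳ proj₁ p))) ∎
    where
    open ≡-Reasoning
    xs = y ∷ ys

  module _ (n : ℕ) where

    Coins : Set
    Coins = ℕ → Vec Bool n

    noCoins : Coins
    noCoins _ = Vec.replicate n false

    update : ℕ → Vec Bool n → Coins → Coins
    update s c η i = if i ≡ᵇ s then c else η i

    seeds : ℕ → Dist Coins
    seeds zero    = return noCoins
    seeds (suc s) = coins n s >>= λ c → seeds s >>= λ η → return (update s c η)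

    seeds-isProbability : ∀ s → IsProbability (seeds s)
    seeds-isProbability zero    = return-isProbability noCoins
    seeds-isProbability (suc s) = >>=-isProbability (coins-isProbability n s) λ c →
      >>=-isProbability (seeds-isProbability s) λ η → return-isProbability (update s c η)

    ∫-seeds-suc : ∀ s f → ∫ (seeds (suc s)) f ≡ ∫ (coins n s) (λ c → ∫ (seeds s) (λ η → f (update s c η)))
    ∫-seeds-suc s f = trans (∫->>= (coins n s) (λ c → seeds s >>= λ η → return (update s c η)) f) (∫-cong (coins n s) λ c →
      trans (∫->>= (seeds s) (λ η → return (update s c η)) f) (∫-cong (seeds s) λ η → ∫-return (update s c η) f))

    -- The expectation over the orders of S, listed with the last arrival first, and over
    -- the coins, computed backwards: the last arrival is a uniformly random element of S.
    𝔼 : ℕ → List A → (List A → Coins → ℝ) → ℝ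
    𝔼 zero    S f = f [] noCoins
    𝔼 (suc s) S f = ∫ (coins n s) λ c → 1/ suc s *
      ∑ (picks S) λ p → 𝔼 s (proj₂ p) λ π η → f (proj₁ p ∷ π) (update s c η)

    𝔼-cong : ∀ s (S : List A) {f g : List A → Coins → ℝ} → (∀ π η → f π η ≡ g π η) → 𝔼 s S f ≡ 𝔼 s S g
    𝔼-cong zero    S eq = eq [] noCoins
    𝔼-cong (suc s) S eq = ∫-cong (coins n s) λ c → cong (1/ suc s *_)
      (∑-cong (picks S) λ p → 𝔼-cong s (proj₂ p) λ π η → eq _ _)

    𝔼-mono : ∀ s {S : List A} → length S ≡ s → {f g : List A → Coins → ℝ} →
             (∀ {π} η → π ↭ S → f π η ≤ g π η) → 𝔼 s S f ≤ 𝔼 s S g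
    𝔼-mono zero    {[]} _ le = le noCoins ↭-refl
    𝔼-mono (suc s) {S} len le = ∫-mono (coins-isProbability n s) λ c → *-monoʳ-≤ (1/-nonneg (suc s))
      (∑-mono (picks S) λ p∈ → 𝔼-mono s (picks-length len p∈) λ η π↭ → le _ (↭-trans (↭-prep _ π↭) (picks-↭ p∈)))

    𝔼-+ : ∀ s (S : List A) (f g : List A → Coins → ℝ) → 𝔼 s S (λ π η → f π η + g π η) ≡ 𝔼 s S f + 𝔼 s S g
    𝔼-+ zero    S f g = refl
    𝔼-+ (suc s) S f g = begin
      ∫ (coins n s) (λ c → 1/ suc s * ∑ (picks S) (λ p → 𝔼 s (proj₂ p) λ π η → F p c π η + H p c π η))
        ≡⟨ ∫-cong (coins n s) (λ c → cong (1/ suc s *_) (trans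
             (∑-cong (picks S) λ p → 𝔼-+ s (proj₂ p) (F p c) (H p c)) (∑-+ (picks S) _ _))) ⟩
      ∫ (coins n s) (λ c → 1/ suc s * (∑ (picks S) (λ p → 𝔼 s (proj₂ p) (F p c)) + ∑ (picks S) (λ p → 𝔼 s (proj₂ p) (H p c))))
        ≡⟨ ∫-cong (coins n s) (λ c → distribˡ _ _ _) ⟩
      ∫ (coins n s) (λ c → 1/ suc s * ∑ (picks S) (λ p → 𝔼 s (proj₂ p) (F p c)) + 1/ suc s * ∑ (picks S) (λ p → 𝔼 s (proj₂ p) (H p c)))
        ≡⟨ ∫-+ (coins n s) _ _ ⟩
      𝔼 (suc s) S f + 𝔼 (suc s) S g ∎
      where
      open ≡-Reasoning
      F H : _ × List _ → Vec Bool n → List _ → Coins → ℝ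
      F p c π η = f (proj₁ p ∷ π) (update s c η)
      H p c π η = g (proj₁ p ∷ π) (update s c η)

    𝔼-*ˡ : ∀ s (S : List A) a (f : List A → Coins → ℝ) → 𝔼 s S (λ π η → a * f π η) ≡ a * 𝔼 s S f
    𝔼-*ˡ zero    S a f = refl
    𝔼-*ˡ (suc s) S a f = begin
      ∫ (coins n s) (λ c → 1/ suc s * ∑ (picks S) (λ p → 𝔼 s (proj₂ p) λ π η → a * F p c π η))
        ≡⟨ ∫-cong (coins n s) (λ c → cong (1/ suc s *_) (trans
             (∑-cong (picks S) λ p → 𝔼-*ˡ s (proj₂ p) a (F p c)) (∑-*ˡ (picks S) a _))) ⟩
      ∫ (coins n s) (λ c → 1/ suc s * (a * ∑ (picks S) (λ p → 𝔼 s (proj₂ p) (F p c))))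
        ≡⟨ ∫-cong (coins n s) (λ c → solve 3 (λ x y z → x :* (y :* z) := y :* (x :* z)) refl (1/ suc s) a _) ⟩
      ∫ (coins n s) (λ c → a * (1/ suc s * ∑ (picks S) (λ p → 𝔼 s (proj₂ p) (F p c))))
        ≡⟨ ∫-*ˡ (coins n s) a _ ⟩
      a * 𝔼 (suc s) S f ∎
      where
      open ≡-Reasoning
      F : _ × List _ → Vec Bool n → List _ → Coins → ℝ
      F p c π η = f (proj₁ p ∷ π) (update s c η)

    length-picks : ∀ (xs : List A) → length (picks xs) ≡ length xs
    length-picks xs = trans (sym (length-map proj₁ (picks xs))) (cong length (map-proj₁-picks xs))

    𝔼-const : ∀ s {S : List A} → length S ≡ s → ∀ a → 𝔼 s S (λ _ _ → a) ≡ a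
    𝔼-const zero    _ a = refl
    𝔼-const (suc s) {S} len a = trans (∫-cong (coins n s) λ c → mean) (∫-const (coins-isProbability n s) a)
      where
      open ≡-Reasoning
      mean : 1/ suc s * ∑ (picks S) (λ p → 𝔼 s (proj₂ p) (λ _ _ → a)) ≡ a
      mean = begin
        1/ suc s * ∑ (picks S) (λ p → 𝔼 s (proj₂ p) (λ _ _ → a))
          ≡⟨ cong (1/ suc s *_) (∑-cong-∈ (picks S) λ p∈ → 𝔼-const s (picks-length len p∈) a) ⟩
        1/ suc s * ∑ (picks S) (λ _ → a)
          ≡⟨ cong (1/ suc s *_) (trans (∑-const (picks S) a) (cong (λ l → fromℕ l * a) (trans (length-picks S) len))) ⟩
        1/ suc s * (fromℕ (suc s) * a)
          ≡⟨ solve 3 (λ x y z → x :* (y :* z) := y :* x :* z) refl (1/ suc s) (fromℕ (suc s)) a ⟩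
        fromℕ (suc s) * 1/ suc s * a
          ≡⟨ trans (cong (_* a) (1/-inverse (suc s))) (*-identityˡ a) ⟩
        a ∎

    -- The factor `s !` takes the place of a division by the number of orders, which itself is
    -- derived from this lemma.
    !-*-𝔼 : ∀ s (S : List A) → length S ≡ s → ∀ f →
            fromℕ (s !) * 𝔼 s S f ≡ ∫ (seeds s) (λ η → ∑ (permutations S) (λ π → f (reverse π) η))
    !-*-𝔼 zero [] _ f = begin
      (1# + 0#) * f [] noCoins
        ≡⟨ solve 1 (λ x → (con 1 :+ con 0) :* x := x :+ con 0) refl (f [] noCoins) ⟩
      f [] noCoins + 0#                                ≡⟨ sym (∫-return noCoins (λ η → f [] η + 0#)) ⟩
      ∫ (return noCoins) (λ η → f [] η + 0#)           ∎ where open ≡-Reasoning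
    !-*-𝔼 (suc s) S@(x ∷ xs) len f = begin
      fromℕ (suc s !) * 𝔼 (suc s) S f
        ≡⟨ sym (∫-*ˡ (coins n s) (fromℕ (suc s !)) _) ⟩
      ∫ (coins n s) (λ c → fromℕ (suc s !) * (1/ suc s * ∑ (picks S) (λ p → 𝔼 s (proj₂ p) (F p c))))
        ≡⟨ ∫-cong (coins n s) (λ c → cancel _) ⟩
      ∫ (coins n s) (λ c → fromℕ (s !) * ∑ (picks S) (λ p → 𝔼 s (proj₂ p) (F p c)))
        ≡⟨ ∫-cong (coins n s) (λ c → trans (sym (∑-*ˡ (picks S) (fromℕ (s !)) _))
             (∑-cong-∈ (picks S) λ {p} p∈ → !-*-𝔼 s (proj₂ p) (picks-length len p∈) (F p c))) ⟩
      ∫ (coins n s) (λ c → ∑ (picks S) (λ p → ∫ (seeds s) (λ η → ∑ (permutations (proj₂ p)) (λ π → F p c (reverse π) η))))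
        ≡⟨ ∫-cong (coins n s) (λ c → sym (∫-∑ (seeds s) (picks S) _)) ⟩
      ∫ (coins n s) (λ c → ∫ (seeds s) (λ η → ∑ (picks S) (λ p → ∑ (permutations (proj₂ p)) (λ π → F p c (reverse π) η))))
        ≡⟨ ∫-cong (coins n s) (λ c → ∫-cong (seeds s) (λ η → trans
             (∑-cong (picks S) λ p → ∑-cong (permutations (proj₂ p)) λ π →
               cong (λ ρ → f ρ (update s c η)) (sym (reverse-++ π [ proj₁ p ])))
             (sym (∑-permutations-∷ʳ x xs (λ π → f (reverse π) (update s c η)))))) ⟩
      ∫ (coins n s) (λ c → ∫ (seeds s) (λ η → ∑ (permutations S) (λ π → f (reverse π) (update s c η))))
        ≡⟨ sym (∫-seeds-suc s _) ⟩
      ∫ (seeds (suc s)) (λ η → ∑ (permutations S) (λ π → f (reverse π) η)) ∎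
      where
      open ≡-Reasoning
      F : _ × List _ → Vec Bool n → List _ → Coins → ℝ
      F p c π η = f (proj₁ p ∷ π) (update s c η)
      cancel : ∀ z → fromℕ (suc s !) * (1/ suc s * z) ≡ fromℕ (s !) * z
      cancel z = begin
        fromℕ (suc s !) * (1/ suc s * z)
          ≡⟨ cong (_* (1/ suc s * z)) (fromℕ-* (suc s) (s !)) ⟩
        fromℕ (suc s) * fromℕ (s !) * (1/ suc s * z)
          ≡⟨ solve 4 (λ a b c d → a :* b :* (c :* d) := a :* c :* (b :* d)) refl (fromℕ (suc s)) (fromℕ (s !)) (1/ suc s) z ⟩
        fromℕ (suc s) * 1/ suc s * (fromℕ (s !) * z)
          ≡⟨ trans (cong (_* (fromℕ (s !) * z)) (1/-inverse (suc s))) (*-identityˡ _) ⟩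
        fromℕ (s !) * z                                       ∎

    ∫-average : ∀ s (S : List A) → length S ≡ s → ∀ f →
      ∫ (seeds s) (λ η → average (permutations S) (λ π → f (reverse π) η)) ≡ 𝔼 s S f
    ∫-average s S len f = begin
      ∫ (seeds s) (λ η → ∑ (permutations S) (λ π → f (reverse π) η) * N ⁻¹)
        ≡⟨ ∫-cong (seeds s) (λ η → *-comm _ _) ⟩
      ∫ (seeds s) (λ η → N ⁻¹ * ∑ (permutations S) (λ π → f (reverse π) η))
        ≡⟨ ∫-*ˡ (seeds s) (N ⁻¹) _ ⟩
      N ⁻¹ * ∫ (seeds s) (λ η → ∑ (permutations S) (λ π → f (reverse π) η))
        ≡⟨ cong (N ⁻¹ *_) (sym (!-*-𝔼 s S len f)) ⟩
      N ⁻¹ * (fromℕ (s !) * 𝔼 s S f)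
        ≡⟨ cong (λ z → z ⁻¹ * (fromℕ (s !) * 𝔼 s S f)) N≡! ⟩
      1/ (s !) * (fromℕ (s !) * 𝔼 s S f)
        ≡⟨ solve 3 (λ x y z → x :* (y :* z) := y :* x :* z) refl (1/ (s !)) (fromℕ (s !)) (𝔼 s S f) ⟩
      fromℕ (s !) * 1/ (s !) * 𝔼 s S f
        ≡⟨ trans (cong (_* 𝔼 s S f) (1/-inverse (s !) {{s ℕ.!≢0}})) (*-identityˡ _) ⟩
      𝔼 s S f ∎
      where
      open ≡-Reasoning
      N = fromℕ (length (permutations S))
      -- The orders are counted by applying `!-*-𝔼` to the constant function 1.
      N≡! : N ≡ fromℕ (s !)
      N≡! = begin
        N                                                          ≡⟨ sym (*-identityʳ N) ⟩
        N * 1#                                                     ≡⟨ sym (∑-const (permutations S) 1#) ⟩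
        ∑ (permutations S) (λ _ → 1#)                              ≡⟨ sym (∫-const (seeds-isProbability s) _) ⟩
        ∫ (seeds s) (λ _ → ∑ (permutations S) (λ _ → 1#))          ≡⟨ sym (!-*-𝔼 s S len (λ _ _ → 1#)) ⟩
        fromℕ (s !) * 𝔼 s S (λ _ _ → 1#)                           ≡⟨ cong (fromℕ (s !) *_) (𝔼-const s len 1#) ⟩
        fromℕ (s !) * 1#                                           ≡⟨ *-identityʳ _ ⟩
        fromℕ (s !)                                                ∎

-- A vertex is fresh until it is hit. It becomes strict if this happens through an arc to a
-- fresh vertex, and loose otherwise.
data Status : Set where
  fresh strict loose : Status

isFresh : Status → Bool
isFresh fresh  = true
isFresh strict = false
isFresh loose  = false

-- A vertex hit by its coin becomes loose: it is the sink of its component of accepted edges and,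
-- being no longer fresh, will never be left by an accepted arc.
nextStatus : (arc hit : Bool) (own head : Status) → Status
nextStatus arc hit fresh  head = if arc then (if isFresh head then strict else loose) else (if hit then loose else fresh)
nextStatus arc hit strict head = strict
nextStatus arc hit loose  head = loose

nextStatus-fresh : ∀ a h own {head} → nextStatus a h own head ≡ fresh → own ≡ fresh
nextStatus-fresh _ _ fresh _ = refl

-- The statuses of tail and head for which an arc is accepted.
good₀ : Status → Status → Bool
good₀ fresh fresh  = true
good₀ fresh loose  = true
good₀ fresh strict = false
good₀ strict _     = false
good₀ loose  _     = false

≤ᵇ-true : ∀ {m n} → (m ≤ᵇ n) ≡ true → m ℕ.≤ n
≤ᵇ-true {m} eq = ℕ.≤ᵇ⇒≤ m _ (subst T (sym eq) tt)

≤ᵇ-false : ∀ {m n} → (m ≤ᵇ n) ≡ false → n ℕ.< m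
≤ᵇ-false {m} {n} eq = ℕ.≰⇒> λ m≤n → subst T eq (ℕ.≤⇒≤ᵇ m≤n)

≤⇒≤ᵇ-true : ∀ {m n} → m ℕ.≤ n → (m ≤ᵇ n) ≡ true
≤⇒≤ᵇ-true {m} {n} m≤n with m ≤ᵇ n in eq
... | true  = refl
... | false = contradiction m≤n (ℕ.<⇒≱ (≤ᵇ-false eq))

-- The online rule and the acyclicity of what it accepts.

module SecretaryRule (R : CompleteOrderedField) (n : ℕ) where

  open GraphicSecretary R
  open RandomOrder R

  -- Arrivals reveal no label, so ties between weights are broken by the endpoints; in a simple
  -- graph different edges then have different keys.
  Key : Set
  Key = ℝ × Fin n × Fin n

  keyLo keyHi : Key → Fin n
  keyLo = proj₁ ∘ proj₂
  keyHi = proj₂ ∘ proj₂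

  keyOf : Arrival n → Key
  keyOf a = Arrival.value a , Endpoints.lo (Arrival.ends a) , Endpoints.hi (Arrival.ends a)

  private
    ℝ-decTotalOrder : DecTotalOrder _ _ _
    ℝ-decTotalOrder = record { isDecTotalOrder = isDecTotalOrder }

    module Lex = DecTotalOrder (×-decTotalOrder ℝ-decTotalOrder
      (×-decTotalOrder (≤-decTotalOrder n) (≤-decTotalOrder n)))

    fromPointwise : ∀ {k l : Key} → k Lex.≈ l → k ≡ l
    fromPointwise (refl , refl , refl) = refl

    toPointwise : ∀ {k l : Key} → k ≡ l → k Lex.≈ l
    toPointwise refl = refl , refl , refl

  keyOrder : DecTotalOrder _ _ _
  keyOrder = record { Carrier = Key ; _≈_ = _≡_ ; _≤_ = Lex._≤_ ; isDecTotalOrder = record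
    { isTotalOrder = record
      { isPartialOrder = record
        { isPreorder = record { isEquivalence = isEquivalence ; reflexive = Lex.reflexive ∘ toPointwise ; trans = Lex.trans }
        ; antisym = λ p q → fromPointwise (Lex.antisym p q) }
      ; total = Lex.total }
    ; _≟_  = λ k l → map′ fromPointwise toPointwise (k Lex.≟ l)
    ; _≤?_ = Lex._≤?_ } }

  open DecTotalOrder keyOrder public using () renaming (_≤_ to _≤ᵏ_; antisym to ≤ᵏ-antisym; totalOrder to keyTotalOrder)
  open Sort keyOrder public using (sort; sort-↭; sort-↗)

  abstract
    _≟ᵏ_ : (k l : Key) → Dec (k ≡ l)
    _≟ᵏ_ = DecTotalOrder._≟_ keyOrder

  -- This makes `parents` a function of the set of edges seen. Given that set, the last arrival is
  -- still uniform, which is what the backward analysis rests on.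
  sort-unique : ∀ {π ρ} → π ↭ ρ → sort π ≡ sort ρ
  sort-unique {π} {ρ} p = Pointwise-≡⇒≡ (↗↭↗⇒≋ keyTotalOrder (sort-↗ π) (sort-↗ ρ)
    (↭⇒↭ₛ (↭-trans (sort-↭ π) (↭-trans p (↭-sym (sort-↭ ρ))))))

  open Labelling keyLo keyHi using (components)
  open Parents keyLo keyHi using (parent)

  -- The sort is ascending and `parent` starts from the end, so the forest has maximum weight; each
  -- component is rooted at its label.
  parents : List Key → Fin n → Maybe Key
  parents π = let es = sort π in parent es (components es)

  opposite : Key → Fin n → Fin n
  opposite e x = if does (x ≟ keyLo e) then keyHi e else keyLo e

  isArc : Maybe Key → Key → Bool
  isArc (just p) e = does (p ≟ᵏ e)
  isArc nothing  e = false

  isHit : Maybe Key → Bool → Bool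
  isHit (just _) b = false
  isHit nothing  b = b

  module _ (k : ℕ) (η : Coins n) where

    -- Histories list the most recent arrival first.
    status : List Key → Fin n → Status
    status []      x = fresh
    status (e ∷ π) x = if k ≤ᵇ length π
      then nextStatus (isArc (parents (e ∷ π) x) e) (isHit (parents (e ∷ π) x) (Vec.lookup (η (length π)) x))
             (status π x) (status π (opposite e x))
      else fresh

    -- The forest already includes `e`, whereas the statuses are those before its arrival.
    takes : List Key → Key → Fin n → Fin n → Bool
    takes π e u v = isArc (parents (e ∷ π) u) e ∧ good₀ (status π u) (status π v)

    accept : List Key → Key → Bool
    accept π e = (k ≤ᵇ length π) ∧ (takes π e (keyLo e) (keyHi e) ∨ takes π e (keyHi e) (keyLo e))

    secretaryRule : Rule n
    secretaryRule past a = accept (map keyOf past) (keyOf a)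

    status-sample : ∀ π → length π ℕ.≤ k → ∀ x → status π x ≡ fresh
    status-sample []      _  x = refl
    status-sample (e ∷ π) le x with k ≤ᵇ length π in eq
    ... | true  = contradiction (≤ᵇ-true eq) (ℕ.<⇒≱ le)
    ... | false = refl

    -- c labels the components of the accepted edges by their sinks, along the accepted arcs.
    record Consistent (c : Fin n → Fin n) (σ : Fin n → Status) : Set where
      field
        fresh-sink : ∀ x → σ x ≡ fresh → c x ≡ x
        loose-sink : ∀ x → σ x ≡ loose → σ (c x) ≢ fresh

    open Consistent

    join : (Fin n → Fin n) → Fin n → Fin n → Fin n → Fin n
    join c u v x = if does (c x ≟ c u) then c v else c x

    join-away : ∀ c u v {x} → c x ≢ c u → join c u v x ≡ c x
    join-away c u v {x} ≢ with c x ≟ c u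
    ... | yes p = contradiction p ≢
    ... | no _  = refl

    join-at : ∀ c u v → join c u v u ≡ c v
    join-at c u v with c u ≟ c u
    ... | yes _ = refl
    ... | no ≢  = contradiction refl ≢

    status-fresh : ∀ e π x → status (e ∷ π) x ≡ fresh → status π x ≡ fresh
    status-fresh e π x eq with k ≤ᵇ length π in k≤?
    ... | true  = nextStatus-fresh (isArc (parents (e ∷ π) x) e) _ (status π x) eq
    ... | false = status-sample π (ℕ.<⇒≤ (≤ᵇ-false k≤?)) x

    status-loose : ∀ e π x → status (e ∷ π) x ≡ loose → status π x ≡ loose ⊎ status π x ≡ fresh
    status-loose e π x eq with k ≤ᵇ length π
    status-loose e π x eq | true with status π x
    ... | fresh = inj₂ refl
    ... | loose = inj₁ refl

    -- Freshness is only ever lost, and a vertex that has just become loose is its own sink.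
    consistent-reject : ∀ {c} e π → Consistent c (status π) → Consistent c (status (e ∷ π))
    consistent-reject {c} e π con = record
      { fresh-sink = λ x eq → fresh-sink con x (status-fresh e π x eq)
      ; loose-sink = λ x eq → sink x eq (status-loose e π x eq)
      }
      where
      sink : ∀ x → status (e ∷ π) x ≡ loose → status π x ≡ loose ⊎ status π x ≡ fresh →
        status (e ∷ π) (c x) ≢ fresh
      sink x eq (inj₁ l) eq′ = loose-sink con x l (status-fresh e π (c x) eq′)
      sink x eq (inj₂ f) eq′ = contradiction
        (trans (sym eq) (subst (λ z → status (e ∷ π) z ≡ fresh) (fresh-sink con x f) eq′)) λ ()

    good₀-fresh : ∀ a {b} → good₀ a b ≡ true → a ≡ fresh
    good₀-fresh fresh _ = refl

    good₀-sink : ∀ a b → good₀ a b ≡ true → b ≡ fresh ⊎ b ≡ loose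
    good₀-sink fresh fresh _ = inj₁ refl
    good₀-sink fresh loose _ = inj₂ refl

    -- The tail `u` is fresh, hence its own sink. A fresh head is a different sink, and a loose head
    -- has a sink that is not fresh. About strict vertices `Consistent` says nothing, and `good₀`
    -- excludes them as heads.
    accept-separates : ∀ {c σ u v} → Consistent c σ → u ≢ v → good₀ (σ u) (σ v) ≡ true → c u ≢ c v
    accept-separates {c} {σ} {u} {v} con u≢v g eq = case (good₀-sink (σ u) (σ v) g)
      where
      u-fresh : σ u ≡ fresh
      u-fresh = good₀-fresh (σ u) g
      cv≡u : c v ≡ u
      cv≡u = trans (sym eq) (fresh-sink con u u-fresh)
      case : σ v ≡ fresh ⊎ σ v ≡ loose → ⊥
      case (inj₁ f) = u≢v (trans (sym cv≡u) (fresh-sink con v f))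
      case (inj₂ l) = loose-sink con v l (trans (cong σ cv≡u) u-fresh)

    -- Only vertices with sink `u` change their sink. They are `u` itself, which is hit now, and
    -- vertices that are neither fresh nor loose, since `u` was fresh. If `v` is fresh, `u` becomes
    -- strict; otherwise `v` is loose, and `u` inherits from it a sink already hit.
    consistent-accept : ∀ {c} e π {u v} → k ℕ.≤ length π → Consistent c (status π) → u ≢ v → opposite e u ≡ v →
      isArc (parents (e ∷ π) u) e ≡ true → good₀ (status π u) (status π v) ≡ true → Consistent (join c u v) (status (e ∷ π))
    consistent-accept {c} e π {u} {v} k≤ con u≢v opp arc g = record { fresh-sink = fs ; loose-sink = ls }
      where
      σ = status π
      u-fresh : σ u ≡ fresh
      u-fresh = good₀-fresh (σ u) g
      cu≡u : c u ≡ u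
      cu≡u = fresh-sink con u u-fresh
      status-u : status (e ∷ π) u ≡ (if isFresh (σ v) then strict else loose)
      status-u rewrite ≤⇒≤ᵇ-true k≤ | arc | u-fresh | opp = refl
      u-not-fresh : status (e ∷ π) u ≢ fresh
      u-not-fresh eq with isFresh (σ v) | trans (sym status-u) eq
      ... | true  | ()
      ... | false | ()
      fs : ∀ x → status (e ∷ π) x ≡ fresh → join c u v x ≡ x
      fs x eq = trans (join-away c u v λ cx≡cu → u-not-fresh (subst (λ z → status (e ∷ π) z ≡ fresh)
          (trans (sym cx≡x) (trans cx≡cu cu≡u)) eq)) cx≡x
        where
        cx≡x : c x ≡ x
        cx≡x = fresh-sink con x (status-fresh e π x eq)
      ls : ∀ x → status (e ∷ π) x ≡ loose → status (e ∷ π) (join c u v x) ≢ fresh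
      ls x eq eq′ with status-loose e π x eq
      ... | inj₁ l = loose-sink con x l (status-fresh e π (c x) (subst (λ z → status (e ∷ π) z ≡ fresh)
              (join-away c u v λ cx≡cu → loose-sink con x l (trans (cong σ (trans cx≡cu cu≡u)) u-fresh)) eq′))
      ... | inj₂ f with x ≟ u
      ...   | no x≢u = contradiction (trans (sym eq) (subst (λ z → status (e ∷ π) z ≡ fresh)
                (trans (join-away c u v λ cx≡cu → x≢u (trans (sym (fresh-sink con x f)) (trans cx≡cu cu≡u))) (fresh-sink con x f)) eq′)) λ ()
      ...   | yes refl with good₀-sink (σ u) (σ v) g
      ...     | inj₁ vf = contradiction (trans (sym eq) (trans status-u (cong (λ s → if isFresh s then strict else loose) vf))) λ ()
      ...     | inj₂ vl = loose-sink con v vl (status-fresh e π (c v) (subst (λ z → status (e ∷ π) z ≡ fresh) (join-at c u v) eq′))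

    accept⁻ : ∀ π e → accept π e ≡ true →
              k ℕ.≤ length π × (takes π e (keyLo e) (keyHi e) ≡ true ⊎ takes π e (keyHi e) (keyLo e) ≡ true)
    accept⁻ π e eq with k ≤ᵇ length π in k≤ | takes π e (keyLo e) (keyHi e) | takes π e (keyHi e) (keyLo e)
    ... | true | true  | _    = ≤ᵇ-true k≤ , inj₁ refl
    ... | true | false | true = ≤ᵇ-true k≤ , inj₂ refl

    ∧-true : ∀ {a b} → a ∧ b ≡ true → a ≡ true × b ≡ true
    ∧-true {true} {true} _ = refl , refl

    opposite-lo : ∀ e → opposite e (keyLo e) ≡ keyHi e
    opposite-lo e with keyLo e ≟ keyLo e
    ... | yes _ = refl
    ... | no ≢  = contradiction refl ≢

    opposite-hi : ∀ e → keyLo e ≢ keyHi e → opposite e (keyHi e) ≡ keyLo e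
    opposite-hi e lo≢ with keyHi e ≟ keyLo e
    ... | yes eq = contradiction (sym eq) lo≢
    ... | no _   = refl

    accepted-forest : ∀ {m} (G : WeightedGraph n m) past es {c} → Consistent c (status (map keyOf past)) →
      Labelling.Forest (lower (WeightedGraph.graph G)) (upper (WeightedGraph.graph G)) c (acceptedFrom G secretaryRule past es)
    accepted-forest G past []       con = tt
    accepted-forest G past (e ∷ es) {c} con with accept (map keyOf past) (keyOf (reveal G e)) in acc
    ... | false = accepted-forest G (reveal G e ∷ past) es (consistent-reject (keyOf (reveal G e)) (map keyOf past) con)
    ... | true with accept⁻ (map keyOf past) (keyOf (reveal G e)) acc
    ...   | k≤ , inj₁ t = let arc , g = ∧-true t in
            accept-separates con lo≢ g ,
            accepted-forest G (reveal G e ∷ past) es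
              (consistent-accept κ π k≤ con lo≢ (opposite-lo κ) arc g)
      where
      κ = keyOf (reveal G e)
      π = map keyOf past
      lo≢ = lower≢upper (WeightedGraph.graph G) e
    ...   | k≤ , inj₂ t = let arc , g = ∧-true t in
            accept-separates con (lo≢ ∘ sym) g ∘ sym ,
            -- This arc runs from the upper to the lower end, so `join` keeps the other label than
            -- `merge` does. The partition is the same, and `Forest` depends only on the partition.
            Forest-anti _ (merge-least (λ _ _ → Flipped.merge-cong c e) (sym (Flipped.merge-merged c e)))
              (accepted-forest G (reveal G e ∷ past) es
                (consistent-accept κ π k≤ con (lo≢ ∘ sym) (opposite-hi κ lo≢) arc g))
      where
      κ = keyOf (reveal G e)
      π = map keyOf past
      lo≢ = lower≢upper (WeightedGraph.graph G) e
      open Kruskal (lower (WeightedGraph.graph G)) (upper (WeightedGraph.graph G))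
      module Flipped = Labelling (upper (WeightedGraph.graph G)) (lower (WeightedGraph.graph G))

    secretaryRule-feasible : ∀ {m} (G : WeightedGraph n m) es →
      Acyclic (WeightedGraph.graph G) (accepted G secretaryRule es)
    secretaryRule-feasible G es = Forest⇒Acyclic (WeightedGraph.graph G)
      (accepted-forest G [] es (record { fresh-sink = λ _ _ → refl ; loose-sink = λ _ () }))

-- What must hold before an arc v → x for good₀ u v to hold after it.
good₁ : Status → Status → Status → Bool
good₁ fresh loose  _      = true
good₁ fresh fresh  fresh  = false
good₁ fresh fresh  strict = true
good₁ fresh fresh  loose  = true
good₁ fresh strict _      = false
good₁ strict _     _      = false
good₁ loose  _     _      = false

good₁-arc : ∀ {u v y hu} h → good₁ u v y ≡ true →
            good₀ (nextStatus false false u hu) (nextStatus true h v y) ≡ true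
good₁-arc {fresh} {fresh} {strict} h _ = refl
good₁-arc {fresh} {fresh} {loose}  h _ = refl
good₁-arc {fresh} {loose}          h _ = refl

good₀-idle : ∀ {u v hu hv} h → good₀ u v ≡ true →
             good₀ (nextStatus false false u hu) (nextStatus false h v hv) ≡ true
good₀-idle {fresh} {fresh} true  _ = refl
good₀-idle {fresh} {fresh} false _ = refl
good₀-idle {fresh} {loose} h     _ = refl

good₁-arc′ : ∀ {u v y hu} h x → good₁ u v y ≡ true →
             good₁ (nextStatus false false u hu) (nextStatus true h v y) x ≡ true
good₁-arc′ {fresh} {fresh} {strict} h x _ = refl
good₁-arc′ {fresh} {fresh} {loose}  h x _ = refl
good₁-arc′ {fresh} {loose}          h x _ = refl

-- Whether by its arc or by its coin, `x` is hit in this step and cannot be fresh afterwards; the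
-- weaker condition `good₀` beforehand is enough.
good₁-tail : ∀ {u v hu hv} x hx h a b → a ∨ b ≡ true → good₀ u v ≡ true →
             good₁ (nextStatus false false u hu) (nextStatus false h v hv) (nextStatus a b x hx) ≡ true
good₁-tail {fresh} {loose} _      _      _     _     _    _ _ = refl
good₁-tail {fresh} {fresh} _      _      true  _     _    _ _ = refl
good₁-tail {fresh} {fresh} strict _      false _     _    _ _ = refl
good₁-tail {fresh} {fresh} loose  _      false _     _    _ _ = refl
good₁-tail {fresh} {fresh} fresh  fresh  false true  _    _ _ = refl
good₁-tail {fresh} {fresh} fresh  strict false true  _    _ _ = refl
good₁-tail {fresh} {fresh} fresh  loose  false true  _    _ _ = refl
good₁-tail {fresh} {fresh} fresh  _      false false true _ _ = refl

good₁-idle : ∀ {u v x hu hv hx} h → good₁ u v x ≡ true →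
             good₁ (nextStatus false false u hu) (nextStatus false h v hv) (nextStatus false false x hx) ≡ true
good₁-idle {fresh} {loose}          h     _ = refl
good₁-idle {fresh} {fresh} {strict} true  _ = refl
good₁-idle {fresh} {fresh} {strict} false _ = refl
good₁-idle {fresh} {fresh} {loose}  true  _ = refl
good₁-idle {fresh} {fresh} {loose}  false _ = refl

∨-false : ∀ {a b} → a ∨ b ≡ false → a ≡ false × b ≡ false
∨-false {false} {false} _ = refl , refl

-- One backward step: the last arrival and the coins of its round.

module Steps (R : CompleteOrderedField) (n : ℕ) {A : Set} (s : ℕ) (S : List A) (len : length S ≡ suc s) where

  open GraphicSecretary R using (ℝ; _+_; _*_; 0#; 1#; _≤_; *-nonneg; fromℕ)
  open OrderedField R
  open Expectation R
  open RandomOrder R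

  q : ℝ
  q = 1/ suc s

  mean : (Vec Bool n → A × List A → ℝ) → ℝ
  mean f = ∫ (coins n s) λ c → q * ∑ (picks S) (f c)

  mean-mono : ∀ {f g} → (∀ c {p} → p ∈ picks S → f c p ≤ g c p) → mean f ≤ mean g
  mean-mono le = ∫-mono (coins-isProbability n s) λ c → *-monoʳ-≤ (1/-nonneg (suc s)) (∑-mono (picks S) (le c))

  mean-+ : ∀ f g → mean (λ c p → f c p + g c p) ≡ mean f + mean g
  mean-+ f g = trans (∫-cong (coins n s) λ c → trans (cong (q *_) (∑-+ (picks S) (f c) (g c))) (distribˡ _ _ _))
    (∫-+ (coins n s) _ _)

  mean-*ˡ : ∀ a f → mean (λ c p → a * f c p) ≡ a * mean f
  mean-*ˡ a f = trans (∫-cong (coins n s) λ c → trans (cong (q *_) (∑-*ˡ (picks S) a (f c)))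
    (solve 3 (λ x y z → x :* (y :* z) := y :* (x :* z)) refl q a _)) (∫-*ˡ (coins n s) a _)

  -- The coins of a round are independent of the edge that arrives in it.
  mean-product : ∀ (a : Vec Bool n → ℝ) (b : A → ℝ) →
                 mean (λ c p → a c * b (proj₁ p)) ≡ q * ∑ S b * ∫ (coins n s) a
  mean-product a b = begin
    ∫ (coins n s) (λ c → q * ∑ (picks S) (λ p → a c * b (proj₁ p)))
      ≡⟨ ∫-cong (coins n s) (λ c → cong (q *_) (trans (∑-*ˡ (picks S) (a c) _) (cong (a c *_) (sum-firsts)))) ⟩
    ∫ (coins n s) (λ c → q * (a c * ∑ S b))
      ≡⟨ ∫-cong (coins n s) (λ c → solve 3 (λ x y z → x :* (y :* z) := x :* z :* y) refl q (a c) (∑ S b)) ⟩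
    ∫ (coins n s) (λ c → q * ∑ S b * a c)
      ≡⟨ ∫-*ˡ (coins n s) (q * ∑ S b) a ⟩
    q * ∑ S b * ∫ (coins n s) a ∎
    where
    open ≡-Reasoning
    sum-firsts : ∑ (picks S) (λ p → b (proj₁ p)) ≡ ∑ S b
    sum-firsts = trans (sym (∑-map proj₁ (picks S) b)) (cong (λ xs → ∑ xs b) (map-proj₁-picks S))

  avg-const : ∀ a → q * ∑ S (λ _ → a) ≡ a
  avg-const a = begin
    q * ∑ S (λ _ → a)            ≡⟨ cong (q *_) (trans (∑-const S a) (cong (λ l → fromℕ l * a) len)) ⟩
    q * (fromℕ (suc s) * a)      ≡⟨ solve 3 (λ x y z → x :* (y :* z) := y :* x :* z) refl q (fromℕ (suc s)) a ⟩
    fromℕ (suc s) * q * a        ≡⟨ trans (cong (_* a) (1/-inverse (suc s))) (*-identityˡ a) ⟩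
    a                            ∎ where open ≡-Reasoning

  mean-const : ∀ a → mean (λ _ _ → a) ≡ a
  mean-const a = trans (∫-cong (coins n s) λ c → cong (q *_) lemma) (trans (∫-const (coins-isProbability n s) _) (avg-const a))
    where
    lemma : ∑ (picks S) (λ _ → a) ≡ ∑ S (λ _ → a)
    lemma = trans (sym (∑-map proj₁ (picks S) (λ _ → a))) (cong (λ xs → ∑ xs (λ _ → a)) (map-proj₁-picks S))

  mean-edge : ∀ b → mean (λ c p → b (proj₁ p)) ≡ q * ∑ S b
  mean-edge b = begin
    mean (λ c p → b (proj₁ p))
      ≡⟨ ∫-cong (coins n s) (λ c → cong (q *_) (∑-cong (picks S) λ p → sym (*-identityˡ _))) ⟩
    mean (λ c p → 1# * b (proj₁ p))    ≡⟨ mean-product (λ _ → 1#) b ⟩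
    q * ∑ S b * ∫ (coins n s) (λ _ → 1#)
      ≡⟨ trans (cong (q * ∑ S b *_) (∫-const (coins-isProbability n s) 1#)) (*-identityʳ _) ⟩
    q * ∑ S b                          ∎ where open ≡-Reasoning

  mean-coin : ∀ a → mean (λ c p → a c) ≡ ∫ (coins n s) a
  mean-coin a = begin
    mean (λ c p → a c)
      ≡⟨ ∫-cong (coins n s) (λ c → cong (q *_) (∑-cong (picks S) λ p → sym (*-identityʳ _))) ⟩
    mean (λ c p → a c * 1#)            ≡⟨ mean-product a (λ _ → 1#) ⟩
    q * ∑ S (λ _ → 1#) * ∫ (coins n s) a ≡⟨ trans (cong (_* ∫ (coins n s) a) (avg-const 1#)) (*-identityˡ _) ⟩
    ∫ (coins n s) a                    ∎ where open ≡-Reasoning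

  mean-cong : ∀ {f g} → (∀ c p → f c p ≡ g c p) → mean f ≡ mean g
  mean-cong eq = ∫-cong (coins n s) λ c → cong (q *_) (∑-cong (picks S) (eq c))

module Events (R : CompleteOrderedField) (n : ℕ) {A : Set} (key : A → SecretaryRule.Key R n)
              (key-injective : ∀ {e f} → key e ≡ key f → e ≡ f)
              (s : ℕ) (S : List A) (len : length S ≡ suc s) (uniqueS : Unique S) where

  open GraphicSecretary R using (ℝ; _+_; _*_; 0#; 1#; _≤_; *-nonneg; fromℕ)
  open OrderedField R
  open Expectation R
  open RandomOrder R
  open SecretaryRule R n
  open Steps R n s S len

  -- The event that a vertex with parent edge `P` and coin `b` is hit by the arrival of `e`.
  isTail : Maybe Key → Bool → A → Bool
  isTail P b e = isArc P (key e) ∨ isHit P b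

  ∑-match : ∀ xs → Unique xs → ∀ {e} → e ∈ xs → ∑ xs (λ f → ⟦ does (key e ≟ᵏ key f) ⟧) ≡ 1#
  ∑-match (f ∷ xs) (f∉ ∷ uq) (here refl) = trans (cong₂ _+_ hit (trans (∑-cong-∈ xs miss) (∑-0 xs))) (+-identityʳ 1#)
    where
    hit : ⟦ does (key f ≟ᵏ key f) ⟧ ≡ 1#
    hit with key f ≟ᵏ key f
    ... | yes _ = refl
    ... | no ≢  = contradiction refl ≢
    miss : ∀ {g} → g ∈ xs → ⟦ does (key f ≟ᵏ key g) ⟧ ≡ 0#
    miss {g} g∈ with key f ≟ᵏ key g
    ... | yes eq = contradiction (key-injective eq) (All.lookup f∉ g∈)
    ... | no _   = refl
  ∑-match (f ∷ xs) (f∉ ∷ uq) {e} (there e∈) = trans (cong₂ _+_ miss (∑-match xs uq e∈)) (+-identityˡ 1#)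
    where
    miss : ⟦ does (key e ≟ᵏ key f) ⟧ ≡ 0#
    miss with key e ≟ᵏ key f
    ... | yes eq = contradiction (sym (key-injective eq)) (All.lookup f∉ e∈)
    ... | no _   = refl

  mean-arc : ∀ {e} → e ∈ S → q * ∑ S (λ f → ⟦ does (key e ≟ᵏ key f) ⟧) ≡ q
  mean-arc e∈ = trans (cong (q *_) (∑-match S uniqueS e∈)) (*-identityʳ q)

  ∨-falseʳ : ∀ a → a ∨ false ≡ a
  ∨-falseʳ true  = refl
  ∨-falseʳ false = refl

  -- A vertex with a parent is hit only by its arc, a root only by its coin, and the bias of the
  -- coin makes both probabilities `q`.
  mean-isTail : ∀ (P : Maybe Key) x → (∀ {p} → P ≡ just p → p ∈ map key S) →
                mean (λ c p → ⟦ isTail P (Vec.lookup c x) (proj₁ p) ⟧) ≡ q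
  mean-isTail nothing  x _    = trans (mean-coin (λ c → ⟦ Vec.lookup c x ⟧)) (∫-coin-at n s x)
  mean-isTail (just p) x P∈ with ∈-map⁻ key (P∈ refl)
  ... | e , e∈ , refl = begin
    mean (λ c p → ⟦ does (key e ≟ᵏ key (proj₁ p)) ∨ false ⟧)  ≡⟨ mean-cong (λ c p → cong ⟦_⟧ (∨-falseʳ _)) ⟩
    mean (λ c p → ⟦ does (key e ≟ᵏ key (proj₁ p)) ⟧)          ≡⟨ mean-edge (λ f → ⟦ does (key e ≟ᵏ key f) ⟧) ⟩
    q * ∑ S (λ f → ⟦ does (key e ≟ᵏ key f) ⟧)                 ≡⟨ mean-arc e∈ ⟩
    q                                                         ∎ where open ≡-Reasoning

  -- Two coins, or a coin and an arc, are independent, which gives `q * q`; two arcs are different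
  -- edges and never arrive together, which gives 0.
  mean-isTail² : ∀ (P Q : Maybe Key) {x y} → x ≢ y →
    (∀ {p} → P ≡ just p → p ∈ map key S) → (∀ {p} → Q ≡ just p → p ∈ map key S) →
    (∀ {p} → P ≡ just p → Q ≢ just p) →
    mean (λ c p → ⟦ isTail P (Vec.lookup c x) (proj₁ p) ⟧ * ⟦ isTail Q (Vec.lookup c y) (proj₁ p) ⟧) ≤ q * q
  mean-isTail² nothing nothing {x} {y} x≢y _ _ _ = ≤-reflexive
    (trans (mean-coin (λ c → ⟦ Vec.lookup c x ⟧ * ⟦ Vec.lookup c y ⟧)) (∫-coin-at² n s x≢y))
  mean-isTail² nothing (just p) {x} {y} x≢y _ Q∈ _ with ∈-map⁻ key (Q∈ refl)
  ... | e , e∈ , refl = ≤-reflexive (begin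
    mean (λ c p → ⟦ Vec.lookup c x ⟧ * ⟦ does (key e ≟ᵏ key (proj₁ p)) ∨ false ⟧)
      ≡⟨ mean-cong (λ c p → cong (λ b → ⟦ Vec.lookup c x ⟧ * ⟦ b ⟧) (∨-falseʳ _)) ⟩
    mean (λ c p → ⟦ Vec.lookup c x ⟧ * ⟦ does (key e ≟ᵏ key (proj₁ p)) ⟧)
      ≡⟨ mean-product (λ c → ⟦ Vec.lookup c x ⟧) (λ f → ⟦ does (key e ≟ᵏ key f) ⟧) ⟩
    q * ∑ S (λ f → ⟦ does (key e ≟ᵏ key f) ⟧) * ∫ (coins n s) (λ c → ⟦ Vec.lookup c x ⟧)
      ≡⟨ cong₂ _*_ (mean-arc e∈) (∫-coin-at n s x) ⟩
    q * q ∎) where open ≡-Reasoning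
  mean-isTail² (just p) nothing {x} {y} x≢y P∈ Q∈ _ = ≤-trans
    (≤-reflexive (mean-cong λ c f → *-comm _ _))
    (mean-isTail² nothing (just p) {y} {x} (x≢y ∘ sym) Q∈ P∈ (λ ()))
  mean-isTail² (just p) (just p′) {x} {y} x≢y _ _ disj = begin
    mean (λ c f → ⟦ does (p ≟ᵏ key (proj₁ f)) ∨ false ⟧ * ⟦ does (p′ ≟ᵏ key (proj₁ f)) ∨ false ⟧)
      ≈⟨ mean-cong (λ c f → never (key (proj₁ f))) ⟩
    mean (λ c f → 0#)   ≈⟨ mean-const 0# ⟩
    0#                  ≤⟨ *-nonneg (1/-nonneg (suc s)) (1/-nonneg (suc s)) ⟩
    q * q               ∎
    where
    open ≤R
    never : ∀ k → ⟦ does (p ≟ᵏ k) ∨ false ⟧ * ⟦ does (p′ ≟ᵏ k) ∨ false ⟧ ≡ 0#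
    never k with p ≟ᵏ k | p′ ≟ᵏ k
    ... | yes refl | yes refl = contradiction refl (disj refl)
    ... | yes _    | no _     = zeroʳ _
    ... | no _     | _        = zeroˡ _

picks-unique : ∀ {A : Set} {x : A} {xs ys} → Unique xs → (x , ys) ∈ picks xs → Unique ys
picks-unique uq p∈ with _ ∷ uq′ ← Unique-resp-↭ (↭-sym (picks-↭ p∈)) uq = uq′

≡ᵇ-refl : ∀ s → (s ≡ᵇ s) ≡ true
≡ᵇ-refl zero    = refl
≡ᵇ-refl (suc s) = ≡ᵇ-refl s

≡ᵇ-< : ∀ {i s} → i ℕ.< s → (i ≡ᵇ s) ≡ false
≡ᵇ-< {zero}  (ℕ.s≤s _) = refl
≡ᵇ-< {suc i} (ℕ.s≤s p) = ≡ᵇ-< p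

-- V s bounds the probability of good₀ after s arrivals from below, and V s − D s that of good₁.
record Bounds (R : CompleteOrderedField) (k m : ℕ) (V D : ℕ → CompleteOrderedField.ℝ R) : Set where
  open GraphicSecretary R using (_+_; _*_; 0#; 1#; _≤_)
  open OrderedField R using (1/_)
  field
    V≥0     : ∀ s → 0# ≤ V s
    D≥0     : ∀ s → 0# ≤ D s
    V-start : V k ≤ 1#
    D-start : V k ≤ D k
    V-step  : ∀ s → k ℕ.≤ s → suc s ℕ.< m → V (suc s) + (V s * 1/ suc s + D s * 1/ suc s) ≤ V s
    D-step  : ∀ s → k ℕ.≤ s → suc s ℕ.< m →
      D s + (D s * (1/ suc s * 1/ suc s) + D s * (1/ suc s * 1/ suc s)) ≤
      D s * 1/ suc s + (D s * 1/ suc s + D s * 1/ suc s) + D (suc s)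

-- The induction on the number of arrivals.

module Analysis (R : CompleteOrderedField) {n m : ℕ} (G : GraphicSecretary.WeightedGraph R n m)
                (simple : Simple (GraphicSecretary.WeightedGraph.graph G)) (k : ℕ) where

  open GraphicSecretary R
  open WeightedGraph G
  open OrderedField R
  open Expectation R
  open RandomOrder R
  open SecretaryRule R n

  key : Fin m → Key
  key e = keyOf (reveal G e)

  key-injective : ∀ {e f} → key e ≡ key f → e ≡ f
  key-injective {e} {f} eq = simple _ _ e f (inj₁ (refl , refl))
    (inj₁ (sym (cong keyLo eq) , sym (cong keyHi eq)))

  history : List (Fin m) → List Key
  history π = map keyOf (map (reveal G) π)

  history≡ : ∀ π → history π ≡ map key π
  history≡ π = sym (map-∘ π)

  length-history : ∀ π → length (history π) ≡ length π
  length-history π = trans (cong length (history≡ π)) (length-map key π)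

  parentIn : List (Fin m) → Fin n → Maybe Key
  parentIn S = parents (history S)

  parentIn-↭ : ∀ {π S} → π ↭ S → ∀ x → parents (history π) x ≡ parentIn S x
  parentIn-↭ p x = cong (λ L → Parents.parent keyLo keyHi L (Labelling.components keyLo keyHi L) x)
    (sort-unique (map⁺ keyOf (map⁺ (reveal G) p)))

  parentIn⁻ : ∀ S {x p} → parentIn S x ≡ just p → p ∈ map key S × (x ≡ keyLo p ⊎ x ≡ keyHi p)
  parentIn⁻ S eq with p∈ , end ← Parents.parent⁻ keyLo keyHi (sort (history S)) _ eq =
    subst (_ ∈_) (history≡ S) (∈-resp-↭ (sort-↭ (history S)) p∈) , end

  parentIn-injective : ∀ {S} → Unique S → ∀ {x y} → x ≢ y → ∀ {p} → parentIn S x ≡ just p →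
    parentIn S y ≢ just p
  parentIn-injective {S} uq x≢y eq eq′ = x≢y (Parents.parent-injective keyLo keyHi
    (Unique-resp-↭ (↭-sym (sort-↭ (history S))) (subst Unique (sym (history≡ S)) (Unique.map⁺ key-injective uq))) _ eq eq′)

  update-at : ∀ s c (η : Coins n) → update n s c η s ≡ c
  update-at s c η = cong (λ b → if b then c else η s) (≡ᵇ-refl s)

  update-below : ∀ {i s} c (η : Coins n) → i ℕ.< s → update n s c η i ≡ η i
  update-below {i} c η i<s = cong (λ b → if b then c else η i) (≡ᵇ-< i<s)

  status-agree : ∀ {η η′ : Coins n} L → (∀ {i} → i ℕ.< length L → η i ≡ η′ i) → ∀ x →
    status k η L x ≡ status k η′ L x
  status-agree []      eq x = refl
  status-agree (e ∷ L) eq x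
    rewrite eq (ℕ.n<1+n (length L)) | status-agree L (eq ∘ ℕ.m<n⇒m<1+n) x
          | status-agree L (eq ∘ ℕ.m<n⇒m<1+n) (opposite e x) = refl

  status-update : ∀ {s} π c η → length π ≡ s → ∀ x →
    status k (update n s c η) (history π) x ≡ status k η (history π) x
  status-update π c η len = status-agree (history π) λ i< → update-below c η (subst (_ ℕ.<_) (trans (length-history π) len) i<)

  module Round (s : ℕ) (k≤s : k ℕ.≤ s) (S : List (Fin m)) (len : length S ≡ suc s) (uniqueS : Unique S) where

    open Steps R n s S len public
    open Events R n key key-injective s S len uniqueS public

    arc : Fin n → Fin m → Bool
    arc x e = isArc (parentIn S x) (key e)

    hit : Fin n → Vec Bool n → Bool
    hit x c = isHit (parentIn S x) (Vec.lookup c x)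

    -- `arc` and `hit` on the right depend on the set `S` but not on the order `π` of the earlier
    -- edges, so the events of this round can be averaged separately from the past.
    status-step : ∀ {e S′ π} c η → (e , S′) ∈ picks S → π ↭ S′ → ∀ x →
      status k (update n s c η) (history (e ∷ π)) x ≡
      nextStatus (arc x e) (hit x c) (status k η (history π) x) (status k η (history π) (opposite (key e) x))
    status-step {e} {S′} {π} c η p∈ π↭ x
      rewrite trans (length-history π) (trans (↭-length π↭) (picks-length len p∈))
            | ≤⇒≤ᵇ-true k≤s | update-at s c η
            | parentIn-↭ (↭-trans (↭-prep e π↭) (picks-↭ p∈)) x
            | status-update π c η (trans (↭-length π↭) (picks-length len p∈)) x
            | status-update π c η (trans (↭-length π↭) (picks-length len p∈)) (opposite (key e) x) = refl

    arc⇒just : ∀ {x e} → arc x e ≡ true → parentIn S x ≡ just (key e)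
    arc⇒just {x} {e} eq with parentIn S x
    arc⇒just {x} {e} eq | just p with p ≟ᵏ key e
    ... | yes refl = refl

    tail : Fin n → Vec Bool n → Fin m → Bool
    tail x c e = isTail (parentIn S x) (Vec.lookup c x) e

    mean-tail : ∀ x → mean (λ c p → ⟦ tail x c (proj₁ p) ⟧) ≡ q
    mean-tail x = mean-isTail (parentIn S x) x (proj₁ ∘ parentIn⁻ S)

    mean-tail² : ∀ {x y} → x ≢ y → mean (λ c p → ⟦ tail x c (proj₁ p) ⟧ * ⟦ tail y c (proj₁ p) ⟧) ≤ q * q
    mean-tail² {x} {y} x≢y = mean-isTail² (parentIn S x) (parentIn S y) x≢y
      (proj₁ ∘ parentIn⁻ S) (proj₁ ∘ parentIn⁻ S) (parentIn-injective uniqueS x≢y)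

    arc≤tail : ∀ x c e → ⟦ arc x e ⟧ ≤ ⟦ tail x c e ⟧
    arc≤tail x c e with parentIn S x
    ... | nothing = 0≤⟦ Vec.lookup c x ⟧
    ... | just p  = ≤-reflexive (cong ⟦_⟧ (sym (∨-falseʳ _)))

    opposite-arc : ∀ {e v} → arc v e ≡ true → Joins (graph e) (opposite (key e) v) v
    opposite-arc {e} {v} a with proj₂ (parentIn⁻ S (arc⇒just a)) | v ≟ lower graph e
    ... | inj₁ refl | yes _  = inj₂ (refl , refl)
    ... | inj₁ refl | no ≢   = contradiction refl ≢
    ... | inj₂ refl | yes eq = contradiction (sym eq) (lower≢upper graph e)
    ... | inj₂ refl | no _   = inj₁ (refl , refl)

  Joins⇒≢ : ∀ {e x y} → Joins (graph e) x y → x ≢ y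
  Joins⇒≢ {e} (inj₁ (refl , refl)) eq = lower≢upper graph e eq
  Joins⇒≢ {e} (inj₂ (refl , refl)) eq = lower≢upper graph e (sym eq)

  ⟦⟧-mono : ∀ {a b} → (a ≡ true → b ≡ true) → ⟦ a ⟧ ≤ ⟦ b ⟧
  ⟦⟧-mono {false} {b}     _ = 0≤⟦ b ⟧
  ⟦⟧-mono {true}  {b}     f rewrite f refl = ≤-refl

  holds₀ : Fin n → Fin n → List (Fin m) → Coins n → Bool
  holds₀ u v π η = good₀ (status k η (history π) u) (status k η (history π) v)

  holds₁ : Fin n → Fin n → Fin n → List (Fin m) → Coins n → Bool
  holds₁ u v x π η = good₁ (status k η (history π) u) (status k η (history π) v) (status k η (history π) x)

  Good₀ : Fin n → Fin n → List (Fin m) → Coins n → ℝ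
  Good₀ u v π η = ⟦ holds₀ u v π η ⟧

  Good₁ : Fin n → Fin n → Fin n → List (Fin m) → Coins n → ℝ
  Good₁ u v x π η = ⟦ holds₁ u v x π η ⟧

  0≤Good₀ : ∀ u v π η → 0# ≤ Good₀ u v π η
  0≤Good₀ u v π η = 0≤⟦ holds₀ u v π η ⟧

  0≤Good₁ : ∀ u v x π η → 0# ≤ Good₁ u v x π η
  0≤Good₁ u v x π η = 0≤⟦ holds₁ u v x π η ⟧

  0≤𝔼 : ∀ s {S : List (Fin m)} → length S ≡ s → {f : List (Fin m) → Coins n → ℝ} → (∀ π η → 0# ≤ f π η) →
    0# ≤ 𝔼 n s S f
  0≤𝔼 s {S} len {f} le = subst (_≤ 𝔼 n s S f) (𝔼-const n s len 0#) (𝔼-mono n s len λ η _ → le _ η)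

  module _ {V D : ℕ → ℝ} (bounds : Bounds R k m V D) where

    open Bounds bounds

    -- In the application `S` lacks the arriving edge between `u` and `v`, and in a simple graph no
    -- other edge joins them. The induction carries this as a hypothesis because it passes to
    -- subsets of `S`.
    Claim₀ Claim₁ : ℕ → Set
    Claim₀ s = ∀ {S u v} → length S ≡ s → Unique S → u ≢ v → All (λ e → ¬ Joins (graph e) u v) S →
      V s ≤ 𝔼 n s S (Good₀ u v)
    Claim₁ s = ∀ {S u v x} → length S ≡ s → Unique S → u ≢ v → x ≢ u → x ≢ v → All (λ e → ¬ Joins (graph e) u v) S →
      V s ≤ 𝔼 n s S (Good₁ u v x) + D s

    module _ {s} (k≤s : k ℕ.≤ s) (s<m : suc s ℕ.< m) (claim₀ : Claim₀ s) (claim₁ : Claim₁ s)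
             {S u v} (len : length S ≡ suc s) (uniqueS : Unique S) (u≢v : u ≢ v)
             (free : All (λ e → ¬ Joins (graph e) u v) S) where

      open Round s k≤s S len uniqueS
      open ≤R

      pick-free : ∀ {e S′} → (e , S′) ∈ picks S → ¬ Joins (graph e) u v × All (λ f → ¬ Joins (graph f) u v) S′
      pick-free p∈ with e-free ∷ S′-free ← All-resp-↭ (↭-sym (picks-↭ p∈)) free = e-free , S′-free

      -- This is where simplicity pays: the head of an arc from `v` is a third vertex, so `Claim₁`
      -- applies to it.
      opposite≢u : ∀ {e S′} → (e , S′) ∈ picks S → arc v e ≡ true → opposite (key e) v ≢ u
      opposite≢u {e} p∈ a eq = proj₁ (pick-free p∈) (subst (λ y → Joins (graph e) y v) eq (opposite-arc a))

      free-rest : ∀ {e S′} → (e , S′) ∈ picks S → All (λ f → ¬ Joins (graph f) u v) S′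
      free-rest = proj₂ ∘ pick-free

      before₀ : ∀ {e S′} → (e , S′) ∈ picks S → V s ≤ 𝔼 n s S′ (Good₀ u v)
      before₀ p∈ = claim₀ (picks-length len p∈) (picks-unique uniqueS p∈) u≢v (free-rest p∈)

      before-arc : ∀ {e S′} → (e , S′) ∈ picks S → arc v e ≡ true →
                   V s ≤ 𝔼 n s S′ (Good₁ u v (opposite (key e) v)) + D s
      before-arc {e} p∈ av = claim₁ (picks-length len p∈) (picks-unique uniqueS p∈) u≢v
        (opposite≢u p∈ av) (Joins⇒≢ {e} (opposite-arc av)) (free-rest p∈)

      after : (List (Fin m) → Coins n → ℝ) → Vec Bool n → Fin m × List (Fin m) → ℝ
      after f c p = 𝔼 n s (proj₂ p) λ π η → f (proj₁ p ∷ π) (update n s c η)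

      after-mono : ∀ (b b′ : List (Fin m) → Coins n → Bool) c {p} → p ∈ picks S →
        (∀ π η → π ↭ proj₂ p → b π η ≡ true → b′ (proj₁ p ∷ π) (update n s c η) ≡ true) →
        𝔼 n s (proj₂ p) (λ π η → ⟦ b π η ⟧) ≤ after (λ π η → ⟦ b′ π η ⟧) c p
      after-mono b b′ c p∈ f = 𝔼-mono n s (picks-length len p∈) λ η π↭ → ⟦⟧-mono (f _ η π↭)

      0≤after : ∀ {f} → (∀ π η → 0# ≤ f π η) → ∀ c {p} → p ∈ picks S → 0# ≤ after f c p
      0≤after le c p∈ = 0≤𝔼 s (picks-length len p∈) λ π η → le _ _

      -- A hit of `u` forfeits everything, that is `V s`. An arc of `v` must not make `v` strict,
      -- which costs `D s`. A coin that hits `v` is harmless, as it makes `v` loose.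
      round₀ : ∀ c {p} → p ∈ picks S →
        V s ≤ after (Good₀ u v) c p + (V s * ⟦ tail u c (proj₁ p) ⟧ + D s * ⟦ arc v (proj₁ p) ⟧)
      round₀ c {p@(e , S′)} p∈ with tail u c e in tu | arc v e in av
      ... | true | b = begin
          V s                                                        ≈⟨ sym (*-identityʳ _) ⟩
          V s * 1#
            ≤⟨ x≤x+y (V s * 1#) (*-nonneg (D≥0 s) 0≤⟦ b ⟧) ⟩
          V s * 1# + D s * ⟦ b ⟧
            ≤⟨ x≤y+x (V s * 1# + D s * ⟦ b ⟧) (0≤after (0≤Good₀ u v) c p∈) ⟩
          after (Good₀ u v) c p + (V s * 1# + D s * ⟦ b ⟧)           ∎
      ... | false | true = begin
          V s
            ≤⟨ before-arc p∈ av ⟩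
          𝔼 n s S′ (Good₁ u v (opposite (key e) v)) + D s
            ≤⟨ +-monoˡ-≤ (D s) (after-mono (holds₁ u v (opposite (key e) v)) (holds₀ u v) c p∈ preserved) ⟩
          after (Good₀ u v) c p + D s
            ≈⟨ cong (after (Good₀ u v) c p +_) (solve 2 (λ a b → b := a :* con 0 :+ b :* con 1) refl (V s) (D s)) ⟩
          after (Good₀ u v) c p + (V s * 0# + D s * 1#) ∎
        where
        preserved : ∀ π η → π ↭ S′ → holds₁ u v (opposite (key e) v) π η ≡ true →
          holds₀ u v (e ∷ π) (update n s c η) ≡ true
        preserved π η π↭ g rewrite status-step c η p∈ π↭ u | status-step c η p∈ π↭ v
          | proj₁ (∨-false {arc u e} tu) | proj₂ (∨-false {arc u e} tu) | av = good₁-arc (hit v c) g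
      ... | false | false = begin
          V s
            ≤⟨ before₀ p∈ ⟩
          𝔼 n s S′ (Good₀ u v)
            ≤⟨ after-mono (holds₀ u v) (holds₀ u v) c p∈ preserved ⟩
          after (Good₀ u v) c p
            ≈⟨ solve 3 (λ a b z → z := z :+ (a :* con 0 :+ b :* con 0)) refl (V s) (D s) _ ⟩
          after (Good₀ u v) c p + (V s * 0# + D s * 0#) ∎
        where
        preserved : ∀ π η → π ↭ S′ → holds₀ u v π η ≡ true →
          holds₀ u v (e ∷ π) (update n s c η) ≡ true
        preserved π η π↭ g rewrite status-step c η p∈ π↭ u | status-step c η p∈ π↭ v
          | proj₁ (∨-false {arc u e} tu) | proj₂ (∨-false {arc u e} tu) | av = good₀-idle (hit v c) g

      claim₀-suc : V (suc s) ≤ 𝔼 n (suc s) S (Good₀ u v)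
      claim₀-suc = +-cancelʳ-≤ (V s * q + D s * q) (begin
        V (suc s) + (V s * q + D s * q)   ≤⟨ V-step s k≤s s<m ⟩
        V s                               ≈⟨ sym (mean-const (V s)) ⟩
        mean (λ _ _ → V s)                ≤⟨ mean-mono round₀ ⟩
        mean (λ c p → after (Good₀ u v) c p + (V s * ⟦ tail u c (proj₁ p) ⟧ + D s * ⟦ arc v (proj₁ p) ⟧))
          ≈⟨ trans (mean-+ (after (Good₀ u v)) _) (cong (mean (after (Good₀ u v)) +_) (trans (mean-+ _ _)
               (cong₂ _+_ (mean-*ˡ (V s) _) (mean-*ˡ (D s) _)))) ⟩
        mean (after (Good₀ u v)) + (V s * mean (λ c p → ⟦ tail u c (proj₁ p) ⟧) + D s * mean (λ c p → ⟦ arc v (proj₁ p) ⟧))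
          ≤⟨ +-monoʳ-≤ _ (+-mono-≤ (*-monoʳ-≤ (V≥0 s) (≤-reflexive (mean-tail u)))
               (*-monoʳ-≤ (D≥0 s) (≤-trans (mean-mono (λ c {p} _ → arc≤tail v c (proj₁ p))) (≤-reflexive (mean-tail v))))) ⟩
        mean (after (Good₀ u v)) + (V s * q + D s * q) ∎)

      module _ {x} (x≢u : x ≢ u) (x≢v : x ≢ v) where

        -- Let h_u, h_x be the indicators of hits and a_v that of the arc of v. The bound on what
        -- follows the arrival is V - D + D(h_u + h_x) - V h_u - D h_x(h_u + a_v); `gain` and `loss`
        -- are its positive and negative corrections. It is at most 0 if u is hit, V - D if instead
        -- the arc of v arrives, V if only x is hit, since x is then not fresh, and V - D otherwise.
        gain loss : Vec Bool n → Fin m × List (Fin m) → ℝ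
        gain c p = D s * ⟦ tail u c (proj₁ p) ⟧ + D s * ⟦ tail x c (proj₁ p) ⟧
        loss c p = V s * ⟦ tail u c (proj₁ p) ⟧ + (D s * (⟦ tail x c (proj₁ p) ⟧ * ⟦ tail u c (proj₁ p) ⟧)
                 + D s * (⟦ tail x c (proj₁ p) ⟧ * ⟦ arc v (proj₁ p) ⟧))

        round₁ : ∀ c {p} → p ∈ picks S → V s + gain c p ≤ after (Good₁ u v x) c p + (D s + loss c p)
        round₁ c {p@(e , S′)} p∈ with tail u c e in tu | arc v e in av | tail x c e in tx
        ... | true | b | d = begin
            V s + (D s * 1# + D s * ⟦ d ⟧)
              ≤⟨ x≤y+x _ (*-nonneg (D≥0 s) (*-nonneg 0≤⟦ d ⟧ 0≤⟦ b ⟧)) ⟩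
            D s * (⟦ d ⟧ * ⟦ b ⟧) + (V s + (D s * 1# + D s * ⟦ d ⟧))
              ≈⟨ solve 4 (λ V D x y → D :* (x :* y) :+ (V :+ (D :* con 1 :+ D :* x)) :=
                   D :+ (V :* con 1 :+ (D :* (x :* con 1) :+ D :* (x :* y)))) refl (V s) (D s) ⟦ d ⟧ ⟦ b ⟧ ⟩
            D s + (V s * 1# + (D s * (⟦ d ⟧ * 1#) + D s * (⟦ d ⟧ * ⟦ b ⟧)))
              ≤⟨ x≤y+x _ (0≤after (0≤Good₁ u v x) c p∈) ⟩
            after (Good₁ u v x) c p + (D s + (V s * 1# + (D s * (⟦ d ⟧ * 1#) + D s * (⟦ d ⟧ * ⟦ b ⟧)))) ∎
        ... | false | true | d = begin
            V s + (D s * 0# + D s * ⟦ d ⟧)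
              ≤⟨ +-monoˡ-≤ _ (before-arc p∈ av) ⟩
            𝔼 n s S′ (Good₁ u v (opposite (key e) v)) + D s + (D s * 0# + D s * ⟦ d ⟧)
              ≤⟨ +-monoˡ-≤ _ (+-monoˡ-≤ (D s) (after-mono (holds₁ u v (opposite (key e) v)) (holds₁ u v x) c p∈ preserved)) ⟩
            after (Good₁ u v x) c p + D s + (D s * 0# + D s * ⟦ d ⟧)
              ≈⟨ solve 4 (λ V D x z → z :+ D :+ (D :* con 0 :+ D :* x) :=
                   z :+ (D :+ (V :* con 0 :+ (D :* (x :* con 0) :+ D :* (x :* con 1))))) refl (V s) (D s) ⟦ d ⟧ _ ⟩
            after (Good₁ u v x) c p + (D s + (V s * 0# + (D s * (⟦ d ⟧ * 0#) + D s * (⟦ d ⟧ * 1#)))) ∎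
          where
          preserved : ∀ π η → π ↭ S′ → holds₁ u v (opposite (key e) v) π η ≡ true →
            holds₁ u v x (e ∷ π) (update n s c η) ≡ true
          preserved π η π↭ g rewrite status-step c η p∈ π↭ u | status-step c η p∈ π↭ v
            | proj₁ (∨-false {arc u e} tu) | proj₂ (∨-false {arc u e} tu) | av = good₁-arc′ (hit v c) _ g
        ... | false | false | true = begin
            V s + (D s * 0# + D s * 1#)
              ≤⟨ +-monoˡ-≤ _ (before₀ p∈) ⟩
            𝔼 n s S′ (Good₀ u v) + (D s * 0# + D s * 1#)
              ≤⟨ +-monoˡ-≤ _ (after-mono (holds₀ u v) (holds₁ u v x) c p∈ preserved) ⟩
            after (Good₁ u v x) c p + (D s * 0# + D s * 1#)
              ≈⟨ solve 3 (λ V D z → z :+ (D :* con 0 :+ D :* con 1) :=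
                   z :+ (D :+ (V :* con 0 :+ (D :* (con 1 :* con 0) :+ D :* (con 1 :* con 0))))) refl (V s) (D s) _ ⟩
            after (Good₁ u v x) c p + (D s + (V s * 0# + (D s * (1# * 0#) + D s * (1# * 0#)))) ∎
          where
          preserved : ∀ π η → π ↭ S′ → holds₀ u v π η ≡ true →
            holds₁ u v x (e ∷ π) (update n s c η) ≡ true
          preserved π η π↭ g rewrite status-step c η p∈ π↭ u | status-step c η p∈ π↭ v | status-step c η p∈ π↭ x
            | proj₁ (∨-false {arc u e} tu) | proj₂ (∨-false {arc u e} tu) | av = good₁-tail (status k η (history π) x) (status k η (history π) (opposite (key e) x)) (hit v c) (arc x e) (hit x c) tx g
        ... | false | false | false = begin
            V s + (D s * 0# + D s * 0#)
              ≤⟨ +-monoˡ-≤ _ (claim₁ (picks-length len p∈) (picks-unique uniqueS p∈) u≢v x≢u x≢v (free-rest p∈)) ⟩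
            𝔼 n s S′ (Good₁ u v x) + D s + (D s * 0# + D s * 0#)
              ≤⟨ +-monoˡ-≤ _ (+-monoˡ-≤ (D s) (after-mono (holds₁ u v x) (holds₁ u v x) c p∈ preserved)) ⟩
            after (Good₁ u v x) c p + D s + (D s * 0# + D s * 0#)
              ≈⟨ solve 3 (λ V D z → z :+ D :+ (D :* con 0 :+ D :* con 0) :=
                   z :+ (D :+ (V :* con 0 :+ (D :* (con 0 :* con 0) :+ D :* (con 0 :* con 0))))) refl (V s) (D s) _ ⟩
            after (Good₁ u v x) c p + (D s + (V s * 0# + (D s * (0# * 0#) + D s * (0# * 0#)))) ∎
          where
          preserved : ∀ π η → π ↭ S′ → holds₁ u v x π η ≡ true →
            holds₁ u v x (e ∷ π) (update n s c η) ≡ true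
          preserved π η π↭ g rewrite status-step c η p∈ π↭ u | status-step c η p∈ π↭ v | status-step c η p∈ π↭ x
            | proj₁ (∨-false {arc u e} tu) | proj₂ (∨-false {arc u e} tu) | av
            | proj₁ (∨-false {arc x e} tx) | proj₂ (∨-false {arc x e} tx) = good₁-idle (hit v c) g

        mean-gain : mean gain ≡ D s * q + D s * q
        mean-gain = trans (mean-+ _ _) (cong₂ _+_
          (trans (mean-*ˡ (D s) _) (cong (D s *_) (mean-tail u))) (trans (mean-*ˡ (D s) _) (cong (D s *_) (mean-tail x))))

        mean-loss : mean loss ≤ V s * q + (D s * (q * q) + D s * (q * q))
        mean-loss = begin
          mean loss
            ≈⟨ trans (mean-+ _ _) (cong₂ _+_ (mean-*ˡ (V s) _) (trans (mean-+ _ _) (cong₂ _+_ (mean-*ˡ (D s) _) (mean-*ˡ (D s) _)))) ⟩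
          V s * mean (λ c p → ⟦ tail u c (proj₁ p) ⟧)
            + (D s * mean (λ c p → ⟦ tail x c (proj₁ p) ⟧ * ⟦ tail u c (proj₁ p) ⟧) + D s * mean (λ c p → ⟦ tail x c (proj₁ p) ⟧ * ⟦ arc v (proj₁ p) ⟧))
            ≤⟨ +-mono-≤ (*-monoʳ-≤ (V≥0 s) (≤-reflexive (mean-tail u))) (+-mono-≤ (*-monoʳ-≤ (D≥0 s) (mean-tail² x≢u))
                 (*-monoʳ-≤ (D≥0 s) (≤-trans (mean-mono λ c {p} _ → *-monoʳ-≤ 0≤⟦ tail x c (proj₁ p) ⟧ (arc≤tail v c (proj₁ p))) (mean-tail² x≢v)))) ⟩
          V s * q + (D s * (q * q) + D s * (q * q)) ∎

        -- The mean of `round₁` is V - D - Vq + 2Dq - 2Dq², which is exactly what `V-step` and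
        -- `D-step` allow for the difference of `V (suc s)` and `D (suc s)`. The cancelled summand
        -- collects all terms that would otherwise be subtracted.
        claim₁-suc : V (suc s) ≤ 𝔼 n (suc s) S (Good₁ u v x) + D (suc s)
        claim₁-suc = +-cancelʳ-≤ (V s * q + D s * q + (D s + (D s * (q * q) + D s * (q * q)) + (D s * q + D s * q))) (begin
          V (suc s) + (V s * q + D s * q + (D s + DD + (D s * q + D s * q)))
            ≈⟨ solve 6 (λ a b c d e f → a :+ (b :+ c :+ (d :+ e :+ f)) := a :+ (b :+ c) :+ (d :+ e :+ f)) refl (V (suc s)) (V s * q) (D s * q) (D s) DD (D s * q + D s * q) ⟩
          V (suc s) + (V s * q + D s * q) + (D s + DD + (D s * q + D s * q))
            ≤⟨ +-mono-≤ (V-step s k≤s s<m) (+-monoˡ-≤ _ (D-step s k≤s s<m)) ⟩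
          V s + (D s * q + (D s * q + D s * q) + D (suc s) + (D s * q + D s * q))
            ≈⟨ solve 3 (λ a b c → a :+ (b :+ (b :+ b) :+ c :+ (b :+ b)) := a :+ (b :+ b) :+ (c :+ (b :+ (b :+ b)))) refl (V s) (D s * q) (D (suc s)) ⟩
          V s + (D s * q + D s * q) + (D (suc s) + (D s * q + (D s * q + D s * q)))
            ≈⟨ cong (_+ (D (suc s) + (D s * q + (D s * q + D s * q)))) (sym (cong₂ _+_ (mean-const (V s)) mean-gain)) ⟩
          mean (λ _ _ → V s) + mean gain + (D (suc s) + (D s * q + (D s * q + D s * q)))
            ≈⟨ cong (_+ (D (suc s) + (D s * q + (D s * q + D s * q)))) (sym (mean-+ _ _)) ⟩
          mean (λ c p → V s + gain c p) + (D (suc s) + (D s * q + (D s * q + D s * q)))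
            ≤⟨ +-monoˡ-≤ _ (mean-mono round₁) ⟩
          mean (λ c p → after (Good₁ u v x) c p + (D s + loss c p)) + (D (suc s) + (D s * q + (D s * q + D s * q)))
            ≈⟨ cong (_+ (D (suc s) + (D s * q + (D s * q + D s * q)))) (trans (mean-+ _ _) (cong (mean (after (Good₁ u v x)) +_) (trans (mean-+ _ _) (cong (_+ mean loss) (mean-const (D s)))))) ⟩
          mean (after (Good₁ u v x)) + (D s + mean loss) + (D (suc s) + (D s * q + (D s * q + D s * q)))
            ≤⟨ +-monoˡ-≤ _ (+-monoʳ-≤ _ (+-monoʳ-≤ (D s) mean-loss)) ⟩
          mean (after (Good₁ u v x)) + (D s + (V s * q + DD)) + (D (suc s) + (D s * q + (D s * q + D s * q)))
            ≈⟨ solve 6 (λ a d v e f g → a :+ (d :+ (v :+ e)) :+ (g :+ (f :+ (f :+ f))) := a :+ g :+ (v :+ f :+ (d :+ e :+ (f :+ f)))) refl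
                 (mean (after (Good₁ u v x))) (D s) (V s * q) DD (D s * q) (D (suc s)) ⟩
          mean (after (Good₁ u v x)) + D (suc s) + (V s * q + D s * q + (D s + DD + (D s * q + D s * q))) ∎)
          where DD = D s * (q * q) + D s * (q * q)

    claims : ∀ s → k ℕ.≤ s → s ℕ.< m → Claim₀ s × Claim₁ s
    claims s k≤s s<m with ℕ.m≤n⇒m<n∨m≡n k≤s
    -- At the end of the sample every vertex is fresh: `good₀` is certain and `good₁` fails, so `D`
    -- has to start at least as high as `V`.
    claims s k≤s s<m | inj₂ refl = base₀ , base₁
      where
      all-fresh : ∀ {S π} η → length S ≡ s → π ↭ S → ∀ x → status s η (history π) x ≡ fresh
      all-fresh {S} {π} η len π↭ = status-sample s η (history π)
        (ℕ.≤-reflexive (trans (length-history π) (trans (↭-length π↭) len)))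
      base₀ : Claim₀ s
      base₀ {S} {u} {v} len _ _ _ = begin
        V s                       ≤⟨ V-start ⟩
        1#                        ≈⟨ sym (𝔼-const n s len 1#) ⟩
        𝔼 n s S (λ _ _ → 1#)      ≤⟨ 𝔼-mono n s len (λ η π↭ → ≤-reflexive (sym
                                       (cong₂ (λ a b → ⟦ good₀ a b ⟧) (all-fresh η len π↭ u) (all-fresh η len π↭ v)))) ⟩
        𝔼 n s S (Good₀ u v)       ∎ where open ≤R
      base₁ : Claim₁ s
      base₁ {S} {u} {v} {x} len _ _ _ _ _ = ≤-trans D-start (x≤y+x (D s) (0≤𝔼 s len (0≤Good₁ u v x)))
    claims (suc s) k≤s s<m | inj₁ (ℕ.s≤s k≤s′) with claims s k≤s′ (ℕ.<⇒≤ s<m)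
    ... | claim₀ , claim₁ =
      (λ len uq u≢v free → claim₀-suc k≤s′ s<m claim₀ claim₁ len uq u≢v free) ,
      (λ len uq u≢v x≢u x≢v free → claim₁-suc k≤s′ s<m claim₀ claim₁ len uq u≢v free x≢u x≢v)

-- The expected accepted weight.

module PartialSums (R : CompleteOrderedField) where

  open GraphicSecretary R using (ℝ; _+_; 0#)

  V⁺ : ℕ → (ℕ → ℝ) → ℕ → ℝ
  V⁺ k V s = if k ≤ᵇ s then V s else 0#

  -- The term `V t` belongs to the arrival with `t` predecessors, so the sum is over t from k to s -
  -- 1.
  ∑V : ℕ → (ℕ → ℝ) → ℕ → ℝ
  ∑V k V zero    = 0#
  ∑V k V (suc s) = ∑V k V s + V⁺ k V s

module Weight (R : CompleteOrderedField) {n m : ℕ} (G : GraphicSecretary.WeightedGraph R n m)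
              (simple : Simple (GraphicSecretary.WeightedGraph.graph G)) (k : ℕ) where

  open GraphicSecretary R
  open WeightedGraph G
  open OrderedField R
  open Expectation R
  open RandomOrder R
  open SecretaryRule R n
  open Analysis R G simple k
  open PartialSums R

  acceptedFrom-∷ʳ : ∀ rule past es e → acceptedFrom G rule past (es ∷ʳ e) ≡
    acceptedFrom G rule past es ++ (if rule (map (reveal G) (reverse es) ++ past) (reveal G e) then [ e ] else [])
  acceptedFrom-∷ʳ rule past []       e = refl
  acceptedFrom-∷ʳ rule past (f ∷ es) e
    rewrite acceptedFrom-∷ʳ rule (reveal G f ∷ past) es e
          | unfold-reverse f es | map-++ (reveal G) (reverse es) [ f ] | ++-assoc (map (reveal G) (reverse es)) [ reveal G f ] past
    with rule past (reveal G f)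
  ... | true  = refl
  ... | false = refl

  W : List (Fin m) → Coins n → ℝ
  W π η = totalWeight (accepted G (secretaryRule k η) (reverse π))

  0≤W : ∀ π η → 0# ≤ W π η
  0≤W π η = ∑-nonneg (accepted G (secretaryRule k η) (reverse π)) (λ {e} _ → weight≥0 e)

  W-∷ : ∀ η e π → W (e ∷ π) η ≡ W π η + weight e * ⟦ accept k η (history π) (key e) ⟧
  W-∷ η e π = begin
    totalWeight (accepted G rule (reverse (e ∷ π)))
      ≡⟨ cong (λ es → totalWeight (accepted G rule es)) (unfold-reverse e π) ⟩
    totalWeight (accepted G rule (reverse π ∷ʳ e))
      ≡⟨ cong totalWeight (acceptedFrom-∷ʳ rule [] (reverse π) e) ⟩
    totalWeight (accepted G rule (reverse π) ++ (if rule (map (reveal G) (reverse (reverse π)) ++ []) (reveal G e) then [ e ] else []))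
      ≡⟨ cong (λ past → totalWeight (accepted G rule (reverse π) ++ (if rule past (reveal G e) then [ e ] else [])))
           (trans (++-identityʳ _) (cong (map (reveal G)) (reverse-involutive π))) ⟩
    totalWeight (accepted G rule (reverse π) ++ (if accept k η (history π) (key e) then [ e ] else []))
      ≡⟨ ∑-++ (accepted G rule (reverse π)) _ weight ⟩
    W π η + totalWeight (if accept k η (history π) (key e) then [ e ] else [])
      ≡⟨ cong (W π η +_) (last (accept k η (history π) (key e))) ⟩
    W π η + weight e * ⟦ accept k η (history π) (key e) ⟧ ∎
    where
    open ≡-Reasoning
    rule = secretaryRule k η
    last : ∀ b → totalWeight (if b then [ e ] else []) ≡ weight e * ⟦ b ⟧
    last true  = trans (+-identityʳ _) (sym (*-identityʳ _))
    last false = sym (zeroʳ _)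

  accept-agree : ∀ {η η′ : Coins n} L e → (∀ {i} → i ℕ.< length L → η i ≡ η′ i) →
    accept k η L e ≡ accept k η′ L e
  accept-agree L e eq rewrite status-agree L eq (keyLo e) | status-agree L eq (keyHi e) = refl

  accepted-agree : ∀ {η η′ : Coins n} past es → (∀ {i} → i ℕ.< length past ℕ.+ length es → η i ≡ η′ i) →
    acceptedFrom G (secretaryRule k η) past es ≡ acceptedFrom G (secretaryRule k η′) past es
  accepted-agree past []       eq = refl
  accepted-agree {η} {η′} past (e ∷ es) eq
    rewrite accept-agree {η} {η′} (map keyOf past) (key e)
              (λ i< → eq (ℕ.<-≤-trans (subst (_ ℕ.<_) (length-map keyOf past) i<) (ℕ.m≤m+n (length past) _)))
          | accepted-agree {η} {η′} (reveal G e ∷ past) es (λ {i} i< → eq (subst (i ℕ.<_) (sym (ℕ.+-suc (length past) (length es))) i<)) = refl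

  -- The decision on an arrival uses only coins of earlier rounds, so the coins of round `s` affect
  -- neither `e` nor its predecessors.
  W-update : ∀ {s} e π c η → length π ≡ s →
             W (e ∷ π) (update n s c η) ≡ W π η + weight e * ⟦ accept k η (history π) (key e) ⟧
  W-update {s} e π c η len = trans (W-∷ (update n s c η) e π) (cong₂ (λ a b → totalWeight a + weight e * ⟦ b ⟧)
    (accepted-agree [] (reverse π) (λ i< → update-below c η (subst (_ ℕ.<_) (trans (length-reverse π) len) i<)))
    (accept-agree (history π) (key e) (λ i< → update-below c η (subst (_ ℕ.<_) (trans (length-history π) len) i<))))

  -- Whichever edges have arrived along with it, `e` belongs to their maximum-weight forest.
  Essential : Fin m → Set
  Essential e = ∀ {S} → Unique S → e ∈ S → ∃[ u ] parentIn S u ≡ just (key e)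

  module _ {V D : ℕ → ℝ} (bounds : Bounds R k m V D) where

    open Bounds bounds

    accept-takes : ∀ {η L e u v} → k ℕ.≤ length L → (u ≡ keyLo e × v ≡ keyHi e) ⊎ (u ≡ keyHi e × v ≡ keyLo e) →
      parents (e ∷ L) u ≡ just e → good₀ (status k η L u) (status k η L v) ≡ true → accept k η L e ≡ true
    accept-takes {η} {L} {e} {u} {v} k≤ ends arc g = cong₂ _∧_ (≤⇒≤ᵇ-true k≤) (either ends)
      where
      isArc-refl : isArc (just e) e ≡ true
      isArc-refl with e ≟ᵏ e
      ... | yes _ = refl
      ... | no ≢  = contradiction refl ≢
      taken : takes k η L e u v ≡ true
      taken = cong₂ _∧_ (trans (cong (λ P → isArc P e) arc) isArc-refl) g
      either : (u ≡ keyLo e × v ≡ keyHi e) ⊎ (u ≡ keyHi e × v ≡ keyLo e) →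
               takes k η L e (keyLo e) (keyHi e) ∨ takes k η L e (keyHi e) (keyLo e) ≡ true
      either (inj₁ (refl , refl)) = cong (_∨ takes k η L e (keyHi e) (keyLo e)) taken
      either (inj₂ (refl , refl)) = trans (cong (takes k η L e (keyLo e) (keyHi e) ∨_) taken) (∨-zeroʳ (takes k η L e (keyLo e) (keyHi e)))

    -- `e` is the arc of some vertex, in one direction or the other, and by simplicity no edge of
    -- `S′` joins its ends; so `Claim₀` applies to `S′`.
    essential-accepted : ∀ {s S e S′} → k ℕ.≤ s → s ℕ.< m → length S ≡ suc s → Unique S → (e , S′) ∈ picks S →
      Essential e →
      V s ≤ 𝔼 n s S′ (λ π η → ⟦ accept k η (history π) (key e) ⟧)
    essential-accepted {s} {S} {e} {S′} k≤s s<m len uniqueS p∈ ess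
      with ess uniqueS (∈-resp-↭ (picks-↭ p∈) (here refl))
    ... | u , arc = go (proj₂ (parentIn⁻ S arc))
      where
      e∉∷ : Unique (e ∷ S′)
      e∉∷ = Unique-resp-↭ (↭-sym (picks-↭ p∈)) uniqueS
      S′-free : ∀ {u v} → Joins (graph e) u v → All (λ f → ¬ Joins (graph f) u v) S′
      S′-free j with e∉ ∷ _ ← e∉∷ = All.map (λ e≢f j′ → e≢f (simple _ _ _ _ j j′)) e∉
      by : ∀ {v} → Joins (graph e) u v →
        (u ≡ keyLo (key e) × v ≡ keyHi (key e)) ⊎ (u ≡ keyHi (key e) × v ≡ keyLo (key e)) →
           V s ≤ 𝔼 n s S′ (λ π η → ⟦ accept k η (history π) (key e) ⟧)
      by {v} j ends = ≤-trans
        (proj₁ (claims bounds s k≤s s<m) (picks-length len p∈) (picks-unique uniqueS p∈) (Joins⇒≢ {e} j) (S′-free j))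
        (𝔼-mono n s (picks-length len p∈) λ {π} η π↭ → ⟦⟧-mono (accept-takes {η} {history π} {key e}
          (subst (k ℕ.≤_) (sym (trans (length-history π) (trans (↭-length π↭) (picks-length len p∈)))) k≤s) ends
          (trans (parentIn-↭ (↭-trans (↭-prep e π↭) (picks-↭ p∈)) u) arc)))
      go : u ≡ lower graph e ⊎ u ≡ upper graph e → V s ≤ 𝔼 n s S′ (λ π η → ⟦ accept k η (history π) (key e) ⟧)
      go (inj₁ eq) = by (inj₁ (sym eq , refl)) (inj₁ (eq , refl))
      go (inj₂ eq) = by (inj₂ (refl , sym eq)) (inj₂ (eq , refl))

    0≤V⁺ : ∀ s → 0# ≤ V⁺ k V s
    0≤V⁺ s with k ≤ᵇ s
    ... | true  = V≥0 s
    ... | false = ≤-refl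

    0≤∑V : ∀ s → 0# ≤ ∑V k V s
    0≤∑V zero    = ≤-refl
    0≤∑V (suc s) = +-nonneg (0≤∑V s) (0≤V⁺ s)

    module _ (ω : Fin m → ℝ) (ω-spec : ∀ e → ω e ≡ 0# ⊎ (ω e ≡ weight e × Essential e)) where

      -- Each edge is left over in all picks but the one that removes it.
      picks-weight : ∀ {s S} → length S ≡ suc s → fromℕ s * ∑ S ω ≤ ∑ (picks S) (λ p → ∑ (proj₂ p) ω)
      picks-weight {s} {S} len = +-cancelˡ-≤ (∑ S ω) (≤-reflexive (begin
        ∑ S ω + fromℕ s * ∑ S ω
          ≡⟨ solve 2 (λ a b → a :+ b :* a := (con 1 :+ b) :* a) refl (∑ S ω) (fromℕ s) ⟩
        fromℕ (suc s) * ∑ S ω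
          ≡⟨ cong (λ l → fromℕ l * ∑ S ω) (sym (trans (length-picks n S) len)) ⟩
        fromℕ (length (picks S)) * ∑ S ω                           ≡⟨ sym (∑-const (picks S) (∑ S ω)) ⟩
        ∑ (picks S) (λ _ → ∑ S ω)
          ≡⟨ ∑-cong-∈ (picks S) (λ p∈ → sym (∑-↭ ω (picks-↭ p∈))) ⟩
        ∑ (picks S) (λ p → ω (proj₁ p) + ∑ (proj₂ p) ω)
          ≡⟨ ∑-+ (picks S) (λ p → ω (proj₁ p)) (λ p → ∑ (proj₂ p) ω) ⟩
        ∑ (picks S) (λ p → ω (proj₁ p)) + ∑ (picks S) (λ p → ∑ (proj₂ p) ω)
          ≡⟨ cong (_+ ∑ (picks S) (λ p → ∑ (proj₂ p) ω)) firsts ⟩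
        ∑ S ω + ∑ (picks S) (λ p → ∑ (proj₂ p) ω)                  ∎))
        where
        open ≡-Reasoning
        firsts : ∑ (picks S) (λ p → ω (proj₁ p)) ≡ ∑ S ω
        firsts = trans (sym (∑-map proj₁ (picks S) ω)) (cong (λ xs → ∑ xs ω) (map-proj₁-picks S))

      last-weight : ∀ {s S e S′} → s ℕ.< m → length S ≡ suc s → Unique S → (e , S′) ∈ picks S →
        ω e * V⁺ k V s ≤ weight e * 𝔼 n s S′ (λ π η → ⟦ accept k η (history π) (key e) ⟧)
      last-weight {s} {S} {e} {S′} s<m len uniqueS p∈ = bound (ω-spec e) (k ≤ᵇ s) refl
        where
        rhs = weight e * 𝔼 n s S′ (λ π η → ⟦ accept k η (history π) (key e) ⟧)
        0≤rhs : 0# ≤ rhs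
        0≤rhs = *-nonneg (weight≥0 e) (0≤𝔼 s {S′} (picks-length len p∈) λ π η → 0≤⟦ accept k η (history π) (key e) ⟧)
        bound : ω e ≡ 0# ⊎ (ω e ≡ weight e × Essential e) → ∀ b → (k ≤ᵇ s) ≡ b →
          ω e * (if b then V s else 0#) ≤ rhs
        bound (inj₁ eq)         b     _  = subst (_≤ rhs) (sym (trans (cong (_* (if b then V s else 0#)) eq) (zeroˡ _))) 0≤rhs
        bound (inj₂ _)          false _  = subst (_≤ rhs) (sym (zeroʳ (ω e))) 0≤rhs
        bound (inj₂ (eq , ess)) true  k≤ = subst (λ z → z * V s ≤ rhs) (sym eq)
          (*-monoʳ-≤ (weight≥0 e) (essential-accepted (≤ᵇ-true k≤) s<m len uniqueS p∈ ess))

      earlier-weight : ∀ s {S} → length S ≡ suc s →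
        (∀ {e S′} → (e , S′) ∈ picks S → ∑V k V s * ∑ S′ ω ≤ fromℕ s * 𝔼 n s S′ W) →
        ∑V k V s * ∑ S ω ≤ ∑ (picks S) (λ p → 𝔼 n s (proj₂ p) W)
      earlier-weight zero {S} len ih = subst (_≤ ∑ (picks S) (λ p → 𝔼 n zero (proj₂ p) W)) (sym (zeroˡ _))
        (∑-nonneg (picks S) (λ {p} p∈ → 0≤𝔼 zero {proj₂ p} (picks-length len p∈) 0≤W))
      earlier-weight (suc s) {S} len ih = fromℕ-cancel-≤ (suc s) (begin
        N * (∑V k V (suc s) * ∑ S ω)
          ≈⟨ solve 3 (λ a b c → a :* (b :* c) := b :* (a :* c)) refl N (∑V k V (suc s)) (∑ S ω) ⟩
        ∑V k V (suc s) * (N * ∑ S ω)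
          ≤⟨ *-monoʳ-≤ (0≤∑V (suc s)) (picks-weight {S = S} len) ⟩
        ∑V k V (suc s) * ∑ (picks S) (λ p → ∑ (proj₂ p) ω)
          ≈⟨ sym (∑-*ˡ (picks S) (∑V k V (suc s)) _) ⟩
        ∑ (picks S) (λ p → ∑V k V (suc s) * ∑ (proj₂ p) ω)            ≤⟨ ∑-mono (picks S) ih ⟩
        ∑ (picks S) (λ p → N * 𝔼 n (suc s) (proj₂ p) W)           ≈⟨ ∑-*ˡ (picks S) N _ ⟩
        N * ∑ (picks S) (λ p → 𝔼 n (suc s) (proj₂ p) W)           ∎)
        where
        open ≤R
        N = fromℕ (suc s)

      -- The last arrival is uniform in `S` and contributes the new term of `∑V`; the earlier
      -- arrivals are covered by the induction hypothesis for each remainder `S′`, averaged by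
      -- `picks-weight`.
      expected-weight : ∀ s {S} → s ℕ.≤ m → length S ≡ s → Unique S → ∑V k V s * ∑ S ω ≤ fromℕ s * 𝔼 n s S W
      expected-weight zero    {S} _   len uniqueS = ≤-reflexive (trans (zeroˡ _) (sym (zeroˡ _)))
      expected-weight (suc s) {S} s<m len uniqueS = begin
        ∑V k V (suc s) * ∑ S ω
          ≈⟨ sym (trans (cong (_* (∑V k V (suc s) * ∑ S ω)) (1/-inverse (suc s))) (*-identityˡ _)) ⟩
        fromℕ (suc s) * 1/ suc s * (∑V k V (suc s) * ∑ S ω)
          ≈⟨ *-assoc _ _ _ ⟩
        fromℕ (suc s) * (1/ suc s * (∑V k V (suc s) * ∑ S ω))
          ≈⟨ cong (fromℕ (suc s) *_) (sym (∫-const (coins-isProbability n s) _)) ⟩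
        fromℕ (suc s) * ∫ (coins n s) (λ c → 1/ suc s * (∑V k V (suc s) * ∑ S ω))
          ≤⟨ *-monoʳ-≤ (fromℕ-nonneg (suc s)) (∫-mono (coins-isProbability n s) λ c → *-monoʳ-≤ (1/-nonneg (suc s)) (per-coin c)) ⟩
        fromℕ (suc s) * 𝔼 n (suc s) S W ∎
        where
        open ≤R
        per-pick : ∀ c {e S′} → (e , S′) ∈ picks S →
          𝔼 n s S′ W + ω e * V⁺ k V s ≤ 𝔼 n s S′ (λ π η → W (e ∷ π) (update n s c η))
        per-pick c {e} {S′} p∈ = begin
          𝔼 n s S′ W + ω e * V⁺ k V s
            ≤⟨ +-monoʳ-≤ _ (last-weight s<m len uniqueS p∈) ⟩
          𝔼 n s S′ W + weight e * 𝔼 n s S′ (λ π η → ⟦ accept k η (history π) (key e) ⟧)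
            ≈⟨ cong (𝔼 n s S′ W +_) (sym (𝔼-*ˡ n s S′ (weight e) (λ π η → ⟦ accept k η (history π) (key e) ⟧))) ⟩
          𝔼 n s S′ W + 𝔼 n s S′ (λ π η → weight e * ⟦ accept k η (history π) (key e) ⟧)
            ≈⟨ sym (𝔼-+ n s S′ W (λ π η → weight e * ⟦ accept k η (history π) (key e) ⟧)) ⟩
          𝔼 n s S′ (λ π η → W π η + weight e * ⟦ accept k η (history π) (key e) ⟧)
            ≤⟨ 𝔼-mono n s (picks-length len p∈) (λ {π} η π↭ → ≤-reflexive (sym
                 (W-update e π c η (trans (↭-length π↭) (picks-length len p∈))))) ⟩
          𝔼 n s S′ (λ π η → W (e ∷ π) (update n s c η)) ∎
        firsts : ∑ (picks S) (λ p → ω (proj₁ p) * V⁺ k V s) ≡ V⁺ k V s * ∑ S ω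
        firsts = trans (sym (∑-map proj₁ (picks S) (λ e → ω e * V⁺ k V s)))
          (trans (cong (λ xs → ∑ xs (λ e → ω e * V⁺ k V s)) (map-proj₁-picks S))
            (trans (∑-cong S (λ e → *-comm (ω e) (V⁺ k V s))) (∑-*ˡ S (V⁺ k V s) ω)))
        per-coin : ∀ c →
          ∑V k V (suc s) * ∑ S ω ≤ ∑ (picks S) (λ p → 𝔼 n s (proj₂ p) (λ π η → W (proj₁ p ∷ π) (update n s c η)))
        per-coin c = begin
          (∑V k V s + V⁺ k V s) * ∑ S ω
            ≈⟨ distribʳ _ _ _ ⟩
          ∑V k V s * ∑ S ω + V⁺ k V s * ∑ S ω
            ≤⟨ +-monoˡ-≤ _ (earlier-weight s len λ p∈ → expected-weight s (ℕ.<⇒≤ s<m) (picks-length len p∈) (picks-unique uniqueS p∈)) ⟩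
          ∑ (picks S) (λ p → 𝔼 n s (proj₂ p) W) + V⁺ k V s * ∑ S ω
            ≈⟨ cong (∑ (picks S) (λ p → 𝔼 n s (proj₂ p) W) +_) (sym firsts) ⟩
          ∑ (picks S) (λ p → 𝔼 n s (proj₂ p) W) + ∑ (picks S) (λ p → ω (proj₁ p) * V⁺ k V s)
            ≈⟨ sym (∑-+ (picks S) _ _) ⟩
          ∑ (picks S) (λ p → 𝔼 n s (proj₂ p) W + ω (proj₁ p) * V⁺ k V s)
            ≤⟨ ∑-mono (picks S) (per-pick c) ⟩
          ∑ (picks S) (λ p → 𝔼 n s (proj₂ p) (λ π η → W (proj₁ p ∷ π) (update n s c η))) ∎

AllPairs-after : ∀ {A : Set} {_∼_ : A → A → Set} xs {y ys} → AllPairs _∼_ (xs ++ y ∷ ys) → All (y ∼_) ys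
AllPairs-after []       (y∼ ∷ _)  = y∼
AllPairs-after (x ∷ xs) (_ ∷ rest) = AllPairs-after xs rest

∈-sublists : ∀ {A : Set} (xs : List A) {ys} → ys ∈ sublists xs → ys ⊆ xs
∈-sublists []       (here refl) = []
∈-sublists (x ∷ xs) ys∈ with ∈-++⁻ (map (x ∷_) (sublists xs)) ys∈
... | inj₂ ys∈′ = skip x (∈-sublists xs ys∈′)
... | inj₁ ys∈′ with ∈-map⁻ (x ∷_) ys∈′
...   | zs , zs∈ , refl = refl ∷ ∈-sublists xs zs∈

⊆-unique : ∀ {A : Set} {xs ys : List A} → xs ⊆ ys → Unique ys → Unique xs
⊆-unique []         []        = []
⊆-unique (skip y s)   (_ ∷ uq)  = ⊆-unique s uq
⊆-unique (refl ∷ s) (y∉ ∷ uq) = All-resp-⊆ s y∉ ∷ ⊆-unique s uq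

-- The optimum and Kruskal's forest of the whole graph.

module Optimum (R : CompleteOrderedField) {n m : ℕ} (G : GraphicSecretary.WeightedGraph R n m)
               (simple : Simple (GraphicSecretary.WeightedGraph.graph G)) (k : ℕ) where

  open GraphicSecretary R
  open WeightedGraph G
  open OrderedField R
  open Expectation R
  open SecretaryRule R n
  open Analysis R G simple k
  open Weight R G simple k
  open Labelling (lower graph) (upper graph)
  open Kruskal (lower graph) (upper graph)
  open KruskalOptimal R (lower graph) (upper graph) weight weight≥0
  module Keys = Labelling keyLo keyHi
  module KeyParents = Parents keyLo keyHi

  descendingOrder : DecTotalOrder _ _ _
  descendingOrder = Flip.decTotalOrder keyOrder

  private
    module Desc = Sort descendingOrder

    descending-labels : ∃[ D ] Desc.sort (map key (allFin m)) ≡ map key D × allFin m ↭ D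
    descending-labels = ↭-map-inv key (↭-sym (Desc.sort-↭ (map key (allFin m))))

  descending : List (Fin m)
  descending = proj₁ descending-labels

  descending-↭ : allFin m ↭ descending
  descending-↭ = proj₂ (proj₂ descending-labels)

  descending-sorted : AllPairs (λ e f → key f ≤ᵏ key e) descending
  descending-sorted = AllPairs.map⁻ (subst (AllPairs _) (proj₁ (proj₂ descending-labels))
    (Sorted⇒AllPairs (DecTotalOrder.totalOrder descendingOrder) (Desc.sort-↗ (map key (allFin m)))))

  descending-unique : Unique descending
  descending-unique = Unique-resp-↭ descending-↭ (Unique.allFin⁺ m)

  maximumForest : List (Fin m)
  maximumForest = kruskal id descending

  -- The edges of `S` above `e` all precede `e` in `descending`. The partition they generate is
  -- therefore finer than the one Kruskal has reached at `e` in the whole graph, and the ends of `e`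
  -- are still separate.
  maximumForest-essential : ∀ {e} → e ∈ maximumForest → Essential e
  maximumForest-essential {e} e∈ {S} uq e∈S with kruskal⁻ id descending e∈
  ... | D₁ , D₂ , split , ¬m with ∈-∃++ (∈-resp-↭ (↭-sym (sort-↭ (history S))) (subst (key e ∈_) (sym (history≡ S)) (∈-map⁺ key e∈S)))
  ...   | L₁ , L₂ , split′ = subst (λ L → ∃[ u ] KeyParents.parent L (Keys.components L) u ≡ just (key e)) (sym split′)
          (KeyParents.∃-parent L₁ (KeyParents.components-roots (L₁ ++ key e ∷ L₂))
            (¬m ∘ Keys.components-least L₂ (foldl merge id D₁) heavier))
    where
    sorted-S : AllPairs _≤ᵏ_ (L₁ ++ key e ∷ L₂)
    sorted-S = subst (AllPairs _≤ᵏ_) split′ (Sorted⇒AllPairs keyTotalOrder (sort-↗ (history S)))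
    unique-S : Unique (L₁ ++ key e ∷ L₂)
    unique-S = subst Unique split′ (Unique-resp-↭ (↭-sym (sort-↭ (history S)))
      (subst Unique (sym (history≡ S)) (Unique.map⁺ key-injective uq)))
    heavier : ∀ {κ} → κ ∈ L₂ → Keys.Merged (foldl merge id D₁) κ
    heavier {κ} κ∈ with ∈-map⁻ key (subst (κ ∈_) (history≡ S)
      (∈-resp-↭ (sort-↭ (history S)) (subst (κ ∈_) (sym split′) (∈-++⁺ʳ L₁ (there κ∈)))))
    ... | f , _ , refl with ∈-++⁻ D₁ (subst (f ∈_) split (∈-resp-↭ descending-↭ (∈-allFin f)))
    ...   | inj₁ f∈            = foldl-merged-∈ id D₁ f∈
    ...   | inj₂ (here refl)   = contradiction refl (All.lookup (AllPairs-after L₁ unique-S) κ∈)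
    ...   | inj₂ (there f∈)    = contradiction
            (≤ᵏ-antisym (All.lookup (AllPairs-after L₁ sorted-S) κ∈)
              (All.lookup (AllPairs-after D₁ (subst (AllPairs _) split descending-sorted)) f∈))
            (All.lookup (AllPairs-after L₁ unique-S) κ∈)

  ≤ᵏ⇒≤ : ∀ {e f} → key e ≤ᵏ key f → weight e ≤ weight f
  ≤ᵏ⇒≤ (inj₁ (le , _)) = le
  ≤ᵏ⇒≤ (inj₂ (eq , _)) = ≤-reflexive eq

  -- `kruskal-optimal` compares sublists of one sorted list, so `X` is first rearranged into the
  -- order of `descending`.
  acyclic-bound : ∀ {X} → Unique X → Acyclic graph X → totalWeight X ≤ totalWeight maximumForest
  acyclic-bound {X} uq ac = begin
    totalWeight X      ≈⟨ ∑-↭ weight (∼bag⇒↭ (unique∧set⇒bag uq X′-unique (mk⇔ to from))) ⟩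
    totalWeight X′     ≤⟨ kruskal-optimal (filter-⊆ X? descending) (AllPairs.map ≤ᵏ⇒≤ descending-sorted)
                            (Acyclic⇒Forest graph X′-unique λ { (u , vs , es , cyc , es∈) → ac (u , vs , es , cyc , All.map from es∈) }) ⟩
    totalWeight maximumForest ∎
    where
    open ≤R
    X? = λ e → _∈?_ _≟_ e X
    X′ = filter X? descending
    X′-unique : Unique X′
    X′-unique = Unique.filter⁺ X? descending-unique
    to : ∀ {e} → e ∈ X → e ∈ X′
    to {e} e∈ = ∈-filter⁺ X? (∈-resp-↭ descending-↭ (∈-allFin e)) e∈
    from : ∀ {e} → e ∈ X′ → e ∈ X
    from e∈ = proj₂ (∈-filter⁻ X? {xs = descending} e∈)

  forestWeight : Fin m → ℝ
  forestWeight e = if does (_∈?_ _≟_ e maximumForest) then weight e else 0#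

  forestWeight-spec : ∀ e → forestWeight e ≡ 0# ⊎ (forestWeight e ≡ weight e × Essential e)
  forestWeight-spec e with _∈?_ _≟_ e maximumForest
  ... | yes e∈ = inj₂ (refl , maximumForest-essential e∈)
  ... | no _   = inj₁ refl

  forestWeight≥0 : ∀ e → 0# ≤ forestWeight e
  forestWeight≥0 e with _∈?_ _≟_ e maximumForest
  ... | yes _ = weight≥0 e
  ... | no _  = ≤-refl

  ∑-⊆ : ∀ {xs ys} → xs ⊆ ys → ∑ xs forestWeight ≤ ∑ ys forestWeight
  ∑-⊆ []         = ≤-refl
  ∑-⊆ (skip y s)   = ≤-trans (∑-⊆ s) (x≤y+x _ (forestWeight≥0 y))
  ∑-⊆ (refl ∷ s) = +-monoʳ-≤ _ (∑-⊆ s)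

  OPT≤ : OPT ≤ ∑ (allFin m) forestWeight
  OPT≤ = max≤v⁺ totalOrder (∑-nonneg (allFin m) λ {e} _ → forestWeight≥0 e)
    (All.map⁺ (All.tabulate λ {X} X∈ → bound X (∈-filter⁻ (acyclic? graph) {xs = sublists (allFin m)} X∈)))
    where
    bound : ∀ X → X ∈ sublists (allFin m) × Acyclic graph X → totalWeight X ≤ ∑ (allFin m) forestWeight
    bound X (X∈ , ac) = begin
      totalWeight X
        ≤⟨ acyclic-bound (⊆-unique (∈-sublists (allFin m) X∈) (Unique.allFin⁺ m)) ac ⟩
      totalWeight maximumForest         ≈⟨ ∑-cong-∈ maximumForest (λ e∈ → sym (in-forest e∈)) ⟩
      ∑ maximumForest forestWeight      ≤⟨ ∑-⊆ (kruskal-⊆ id descending) ⟩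
      ∑ descending forestWeight         ≈⟨ sym (∑-↭ forestWeight descending-↭) ⟩
      ∑ (allFin m) forestWeight         ∎
      where
      open ≤R
      in-forest : ∀ {e} → e ∈ maximumForest → forestWeight e ≡ weight e
      in-forest {e} e∈ with _∈?_ _≟_ e maximumForest
      ... | yes _  = refl
      ... | no e∉ = contradiction e∈ e∉

-- Closed forms of the bounds and numerical estimates.

module Polynomials where

  open import Data.Nat.Base using (_+_; _*_; _≤_)

  ≤-by : ∀ {a c} r → a + r ≡ c → a ≤ c
  ≤-by {a} r eq = subst (a ≤_) eq (ℕ.m≤m+n a r)

  -- This and the identities below are inequalities or equations between fractions, cross-multiplied
  -- and left in the unsimplified form that `num` and `den` compute. An extra summand on the left is
  -- the slack.
  harmonic-poly : ∀ j →
    (1 * (2 + j) + 1 * (7 + 4 * (1 + j))) * ((7 + 4 * j) * (((2 + j) + (2 + j)) * (1 + ((2 + j) + (2 + j))))) + 3 * (2 + j) ≡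
    (1 * (((2 + j) + (2 + j)) * (1 + ((2 + j) + (2 + j)))) + (1 * (1 + ((2 + j) + (2 + j))) + 1 * ((2 + j) + (2 + j))) * (7 + 4 * j))
      * ((7 + 4 * (1 + j)) * (2 + j))
  harmonic-poly = solve-∀

  recip-poly : ∀ i → (1 * ((2 + i) * (3 + i)) + 1 * 1 * (3 + i)) * (2 + i) ≡ 1 * ((3 + i) * ((2 + i) * (3 + i)))
  recip-poly = solve-∀

  G E : ℕ → ℕ
  G i = 2 * (2 + i) * (1 + i) * (4 + 3 * i)
  E i = (2 + i) * (2 + i) * (1 + i)

  g-poly : ∀ i →
    (3 * ((2 * (2 + i) * (1 + i) * (4 + 3 * i)) * ((2 + i) * (2 + i) * (1 + i)) * (3 + i))
      + (3 * ((2 + i) * (2 + i) * (1 + i)) + 1 * (2 * (2 + i) * (1 + i) * (4 + 3 * i))) * 1 * (2 * (3 + i) * (2 + i) * (4 + 3 * (1 + i))))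
      * (2 * (2 + i) * (1 + i) * (4 + 3 * i))
      + 16 * ((2 + i) * (2 + i) * (2 + i) * (1 + i) * (1 + i) * (4 + 3 * i) * (3 + i)) ≡
    3 * ((2 * (3 + i) * (2 + i) * (4 + 3 * (1 + i))) * ((2 * (2 + i) * (1 + i) * (4 + 3 * i)) * ((2 + i) * (2 + i) * (1 + i)) * (3 + i)))
  g-poly = solve-∀

  ρ-poly : ∀ i →
    (1 * (((3 + i) * (3 + i)) * ((3 + i) * (3 + i))) + (1 * 1 * ((3 + i) * (3 + i)) + 1 * 1 * ((3 + i) * (3 + i))) * 1)
      * ((3 + i) * ((3 + i) * (3 + i)) * ((3 + i) * (3 + i))) ≡
    ((1 * ((3 + i) * (3 + i)) + (1 * (3 + i) + 1 * (3 + i)) * (3 + i)) * ((3 + i) * (3 + i))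
      + (2 + i) * (1 + i) * ((3 + i) * ((3 + i) * (3 + i)))) * (1 * (((3 + i) * (3 + i)) * ((3 + i) * (3 + i))))
  ρ-poly = solve-∀

  d-poly : ∀ i →
    1 * ((2 + i) * (1 + i)) * ((3 + i) * (3 + i) * (2 + i)) ≡ 1 * ((2 + i) * (2 + i) * (1 + i) * ((3 + i) * (3 + i)))
  d-poly = solve-∀

  telescope-poly : ∀ i →
    1 * ((2 * (2 + i) * (1 + i) * (4 + 3 * i)) * (4 * ((2 + i) * (2 + i)))) + i * 8 * (1 + i) * (2 + i) ≡
    (3 * (4 * ((2 + i) * (2 + i))) + 1 * (2 * (2 + i) * (1 + i) * (4 + 3 * i))) * (4 * ((1 + i) * (1 + i)))
  telescope-poly = solve-∀

  start-poly : ∀ j →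
    ((2 + j) * (2 + 3 * j) * 1 * (1 * (2 * (2 + j) * (1 + j) * (4 + 3 * j)))
      + (2 + j) * (2 + j) * (1 + j) * 3 * (2 * (4 + 3 * j) * (2 + j))) * 1 ≡
    1 * (2 * (4 + 3 * j) * (2 + j) * (1 * (2 * (2 + j) * (1 + j) * (4 + 3 * j))))
  start-poly = solve-∀

  unit-poly : ∀ j → 1 * (1 * ((2 + j) * (2 + j) * (1 + j))) ≡ (2 + j) * (2 + j) * (1 + j) * 1 * 1
  unit-poly = solve-∀

  even-poly : ∀ j →
    (32 * (13 * ((2 + j) + (2 + j))) + 49 * (2 * (2 + j))) * (1 * (1 * (4 + 3 * j) * (1 * (1 + j)))) + (2 + j) * (494 + j * (105 + j * 3)) ≡
    49 * (11 * (2 + j) * (2 + 3 * j) * (1 * (1 + j)) + 8 * (2 + j) * (2 + j) * (1 * (4 + 3 * j))) * 1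
  even-poly = solve-∀

  odd-poly : ∀ j →
    (32 * (13 * (1 + ((2 + j) + (2 + j)))) + 49 * (2 * (1 + j))) * (1 * (1 * (4 + 3 * j) * (1 * (1 + j)))) + (500 + j * (438 + j * (333 + j * 3))) ≡
    49 * ((11 * (2 + j) + 8) * (2 + 3 * j) * (1 * (1 + j)) + 8 * (2 + j) * (2 + j) * (1 * (4 + 3 * j))) * 1
  odd-poly = solve-∀

  even-α-poly : ∀ j →
    11 * (2 + j) * (2 + 3 * j) * (2 * (4 + 3 * j) * 1) ≡ (2 + j) * (2 + 3 * j) * 22 * (1 * (4 + 3 * j))
  even-α-poly = solve-∀

  odd-α-poly : ∀ j → (11 * (2 + j) + 8) * (2 + 3 * j) * (2 * (4 + 3 * j) * (1 * ((2 + j) + (2 + j)))) ≡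
    (2 + j) * (2 + 3 * j) * (22 * ((2 + j) + (2 + j)) + 32 * 1) * (1 * (4 + 3 * j))
  odd-α-poly = solve-∀

  quarter-poly : ∀ j → 8 * (2 + j) * (2 + j) * (1 * (1 * (4 * ((1 + j) * (1 + j))))) ≡
    32 * ((2 + j) * (2 + j) * (1 + j) * 1) * (1 * (1 + j))
  quarter-poly = solve-∀

  even-quarter-poly : ∀ j → 32 * ((2 + j) * (2 + j) * (1 + j) * 1) * 1 + 8 * (2 + j) ≡
    2 * (2 + j) * (1 * (1 * (4 * ((1 + (j + (2 + j))) * (1 + (j + (2 + j)))))))
  even-quarter-poly = solve-∀

  odd-quarter-poly : ∀ j → 32 * ((2 + j) * (2 + j) * (1 + j) * 1) * 1 ≡
    2 * (1 + j) * (1 * (1 * (4 * ((2 + (j + (2 + j))) * (2 + (j + (2 + j)))))))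
  odd-quarter-poly = solve-∀

module Rates (R : CompleteOrderedField) where

  open GraphicSecretary R using (ℝ; _+_; _*_; 0#; 1#; _≤_; +-monoˡ-≤; *-nonneg; fromℕ)
  open OrderedField R
  open PartialSums R
  open Polynomials

  infixr 6 _⊕_
  infixr 7 _⊗_
  infix  8 _∕_
  -- Reflected fractions: a comparison of real expressions reduces to one inequality between natural
  -- numbers.
  data Expr : Set where
    _∕_     : (a b : ℕ) .{{_ : NonZero b}} → Expr
    nat     : ℕ → Expr
    _⊕_ _⊗_ : Expr → Expr → Expr

  value : Expr → ℝ
  value (a ∕ b) = a ÷ b
  value (nat c) = fromℕ c
  value (e ⊕ f) = value e + value f
  value (e ⊗ f) = value e * value f

  num den : Expr → ℕ
  num (a ∕ b) = a
  num (nat c) = c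
  num (e ⊕ f) = num e ℕ.* den f ℕ.+ num f ℕ.* den e
  num (e ⊗ f) = num e ℕ.* num f
  den (a ∕ b) = b
  den (nat c) = 1
  den (e ⊕ f) = den e ℕ.* den f
  den (e ⊗ f) = den e ℕ.* den f

  den≢0 : ∀ e → NonZero (den e)
  den≢0 ((a ∕ b) {{nz}}) = ℕ.≢-nonZero (ℕ.≢-nonZero⁻¹ b {{nz}})
  den≢0 (nat c)          = _
  den≢0 (e ⊕ f)          = ℕ.m*n≢0 _ _ {{den≢0 e}} {{den≢0 f}}
  den≢0 (e ⊗ f)          = ℕ.m*n≢0 _ _ {{den≢0 e}} {{den≢0 f}}

  value≡ : ∀ e → value e ≡ num e ÷ den e
  value≡ (a ∕ b) = refl
  value≡ (nat c) = trans (sym (*-identityʳ _)) (cong (fromℕ c *_) (sym 1/1≡1))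
    where
    1/1≡1 : 1/ 1 ≡ 1#
    1/1≡1 = trans (sym (*-identityˡ (1/ 1))) (trans (cong (_* 1/ 1) (sym (+-identityʳ 1#))) (1/-inverse 1))
  value≡ (e ⊕ f) = trans (cong₂ _+_ (value≡ e) (value≡ f)) (÷-+ (num e) (den e) (num f) (den f) {{den≢0 e}} {{den≢0 f}})
  value≡ (e ⊗ f) = trans (cong₂ _*_ (value≡ e) (value≡ f)) (÷-* (num e) (den e) (num f) (den f) {{den≢0 e}} {{den≢0 f}})

  compare : ∀ e f → num e ℕ.* den f ℕ.≤ num f ℕ.* den e → value e ≤ value f
  compare e f le = subst₂ _≤_ (sym (value≡ e)) (sym (value≡ f))
    (÷-≤ (num e) (den e) (num f) (den f) {{den≢0 e}} {{den≢0 f}} le)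

  1÷≡1/ : ∀ n → 1 ÷ n ≡ 1/ n
  1÷≡1/ n = solve 1 (λ x → (con 1 :+ con 0) :* x := x) refl (1/ n)

  ∑V-below : ∀ k f s → s ℕ.≤ k → ∑V k f s ≡ 0#
  ∑V-below k f zero    _  = refl
  ∑V-below k f (suc s) le with k ≤ᵇ s in eq
  ... | true  = contradiction (≤ᵇ-true eq) (ℕ.<⇒≱ le)
  ... | false = trans (+-identityʳ _) (∑V-below k f s (ℕ.<⇒≤ le))

  ∑V-suc : ∀ k f {s} → k ℕ.≤ s → ∑V k f (suc s) ≡ ∑V k f s + f s
  ∑V-suc k f {s} le = cong (λ b → ∑V k f s + (if b then f s else 0#)) (≤⇒≤ᵇ-true le)

  ∑V-shift : ∀ k f s → k ℕ.< s → f k + ∑V (suc k) f s ≡ ∑V k f s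
  ∑V-shift k f (suc s) (ℕ.s≤s k≤s) with ℕ.m≤n⇒m<n∨m≡n k≤s
  ... | inj₁ k<s = trans (cong (f k +_) (∑V-suc (suc k) f k<s)) (trans (sym (+-assoc _ _ _))
          (trans (cong (_+ f s) (∑V-shift k f s k<s)) (sym (∑V-suc k f k≤s))))
  ... | inj₂ refl = trans (cong (f k +_) (∑V-below (suc k) f (suc k) ℕ.≤-refl)) (trans (+-comm _ _)
          (trans (cong (_+ f k) (sym (∑V-below k f k ℕ.≤-refl))) (sym (∑V-suc k f k≤s))))

  recip : ℕ → ℝ
  recip t = 1 ÷ t

  -- The correction 1/(4k − 1) decreases faster than the sum itself, so the bound survives k ↦ k + 1.
  harmonic : ∀ j → 29 ÷ 42 + 1 ÷ (7 ℕ.+ 4 ℕ.* j) ≤ ∑V (2 ℕ.+ j) recip ((2 ℕ.+ j) ℕ.+ (2 ℕ.+ j))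
  harmonic zero    = begin
    29 ÷ 42 + 1 ÷ 7                 ≤⟨ compare (29 ∕ 42 ⊕ 1 ∕ 7) (1 ∕ 2 ⊕ 1 ∕ 3) (ℕ.≤ᵇ⇒≤ _ _ _) ⟩
    1 ÷ 2 + 1 ÷ 3
      ≈⟨ solve 2 (λ x y → x :+ y := con 0 :+ con 0 :+ con 0 :+ x :+ y) refl (1 ÷ 2) (1 ÷ 3) ⟩
    ∑V 2 recip 4                    ∎ where open ≤R
  harmonic (suc j) = +-cancelˡ-≤ (recip k) (begin
    recip k + (29 ÷ 42 + 1 ÷ (7 ℕ.+ 4 ℕ.* suc j))
      ≈⟨ solve 3 (λ x y z → x :+ (y :+ z) := y :+ (z :+ x)) refl (recip k) (29 ÷ 42) _ ⟩
    29 ÷ 42 + (1 ÷ (7 ℕ.+ 4 ℕ.* suc j) + 1 ÷ k)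
      ≤⟨ +-monoʳ-≤ (29 ÷ 42) (compare (1 ∕ (7 ℕ.+ 4 ℕ.* suc j) ⊕ 1 ∕ (2 ℕ.+ j))
           (1 ∕ (7 ℕ.+ 4 ℕ.* j) ⊕ (1 ∕ ((2 ℕ.+ j) ℕ.+ (2 ℕ.+ j)) ⊕ 1 ∕ (1 ℕ.+ ((2 ℕ.+ j) ℕ.+ (2 ℕ.+ j)))))
           (≤-by (3 ℕ.* (2 ℕ.+ j)) (harmonic-poly j))) ⟩
    29 ÷ 42 + (1 ÷ (7 ℕ.+ 4 ℕ.* j) + (1 ÷ (k ℕ.+ k) + 1 ÷ suc (k ℕ.+ k)))
      ≈⟨ sym (+-assoc _ _ _) ⟩
    29 ÷ 42 + 1 ÷ (7 ℕ.+ 4 ℕ.* j) + (1 ÷ (k ℕ.+ k) + 1 ÷ suc (k ℕ.+ k))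
      ≤⟨ +-monoˡ-≤ _ (harmonic j) ⟩
    ∑V k recip (k ℕ.+ k) + (recip (k ℕ.+ k) + recip (suc (k ℕ.+ k)))
      ≈⟨ sym (+-assoc _ _ _) ⟩
    ∑V k recip (k ℕ.+ k) + recip (k ℕ.+ k) + recip (suc (k ℕ.+ k))
      ≈⟨ sym (trans (∑V-suc k recip (ℕ.m≤n⇒m≤1+n (ℕ.m≤m+n k k))) (cong (_+ recip (suc (k ℕ.+ k))) (∑V-suc k recip (ℕ.m≤m+n k k)))) ⟩
    ∑V k recip (2 ℕ.+ (k ℕ.+ k))
      ≈⟨ sym (∑V-shift k recip (2 ℕ.+ (k ℕ.+ k)) (ℕ.s≤s (ℕ.m≤n⇒m≤1+n (ℕ.m≤m+n k k)))) ⟩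
    recip k + ∑V (suc k) recip (2 ℕ.+ (k ℕ.+ k))
      ≈⟨ cong (λ l → recip k + ∑V (suc k) recip (suc l)) (sym (ℕ.+-suc k k)) ⟩
    recip k + ∑V (suc k) recip (suc k ℕ.+ suc k) ∎)
    where
    open ≤R
    k = 2 ℕ.+ j

  module _ (j : ℕ) where

    k κ : ℕ
    k = 2 ℕ.+ j
    κ = (2 ℕ.+ j) ℕ.* (2 ℕ.+ j) ℕ.* (1 ℕ.+ j)

    -- Determined by V(k) = 1: at t = k the second term of `V` is 3k/(2(3k - 2)).
    α : Expr
    α = ((2 ℕ.+ j) ℕ.* (2 ℕ.+ 3 ℕ.* j)) ∕ (2 ℕ.* (4 ℕ.+ 3 ℕ.* j))

    -- In closed form, with t = 2 + i:
    -- V t = k(3k−4)/(2(3k−2)t) + 3k²(k−1)/(2t(t−1)(3t−2)) and D t = k²(k−1)/(t²(t−1)).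
    V D : ℕ → ℝ
    V (suc (suc i)) = value α * 1 ÷ (2 ℕ.+ i) + fromℕ κ * 3 ÷ G i
    V _             = 0#
    D (suc (suc i)) = fromℕ κ * 1 ÷ E i
    D _             = 0#

    α≥0 : 0# ≤ value α
    α≥0 = ÷-nonneg ((2 ℕ.+ j) ℕ.* (2 ℕ.+ 3 ℕ.* j)) (2 ℕ.* (4 ℕ.+ 3 ℕ.* j))

    V≥0 : ∀ s → 0# ≤ V s
    V≥0 zero          = ≤-refl
    V≥0 (suc zero)    = ≤-refl
    V≥0 (suc (suc i)) = +-nonneg (*-nonneg α≥0 (÷-nonneg 1 (2 ℕ.+ i))) (*-nonneg (fromℕ-nonneg κ) (÷-nonneg 3 (G i)))

    D≥0 : ∀ s → 0# ≤ D s
    D≥0 zero          = ≤-refl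
    D≥0 (suc zero)    = ≤-refl
    D≥0 (suc (suc i)) = *-nonneg (fromℕ-nonneg κ) (÷-nonneg 1 (E i))

    fromℕ-1 : fromℕ 1 ≡ 1#
    fromℕ-1 = +-identityʳ 1#

    V-start : V k ≤ 1#
    V-start = ≤-trans (compare (α ⊗ 1 ∕ (2 ℕ.+ j) ⊕ nat κ ⊗ 3 ∕ G j) (nat 1) (ℕ.≤-reflexive (start-poly j))) (≤-reflexive fromℕ-1)

    D-start : V k ≤ D k
    D-start = ≤-trans V-start (≤-trans (≤-reflexive (sym fromℕ-1))
      (compare (nat 1) (nat κ ⊗ 1 ∕ E j) (ℕ.≤-reflexive (unit-poly j))))

    -- The part 1/t satisfies the recursion with equality. For the other part, written h(t)/t up to
    -- the factor `κ`, the claim is h(t) - h(t + 1) ≥ 1/(t²(t - 1)). The exact solution vanishing at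
    -- infinity, 1/(t - 1) minus the sum of 1/s² over s ≥ t, is not a rational function; h(t) =
    -- 3/(2(t - 1)(3t - 2)) is a rational substitute.
    V-step : ∀ s → k ℕ.≤ s → V (suc s) + (V s * 1/ suc s + D s * 1/ suc s) ≤ V s
    V-step (suc zero) (ℕ.s≤s ())
    V-step (suc (suc i)) _ = begin
      a * x′ + b * g′ + ((a * x + b * g) * 1/ (3 ℕ.+ i) + b * d * 1/ (3 ℕ.+ i))
        ≈⟨ cong (λ q → a * x′ + b * g′ + ((a * x + b * g) * q + b * d * q)) (sym (1÷≡1/ (3 ℕ.+ i))) ⟩
      a * x′ + b * g′ + ((a * x + b * g) * x′ + b * d * x′)
        ≈⟨ regroup a b x x′ g g′ d ⟩
      a * (x′ + x * x′) + b * (g′ + (g + d) * x′)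
        ≤⟨ +-mono-≤
             (*-monoʳ-≤ α≥0 (compare (1 ∕ (3 ℕ.+ i) ⊕ 1 ∕ (2 ℕ.+ i) ⊗ 1 ∕ (3 ℕ.+ i)) (1 ∕ (2 ℕ.+ i)) (ℕ.≤-reflexive (recip-poly i))))
             (*-monoʳ-≤ (fromℕ-nonneg κ) (compare (3 ∕ G (suc i) ⊕ (3 ∕ G i ⊕ 1 ∕ E i) ⊗ 1 ∕ (3 ℕ.+ i)) (3 ∕ G i) (≤-by _ (g-poly i)))) ⟩
      a * x + b * g ∎
      where
      open ≤R
      a = value α
      b = fromℕ κ
      x = 1 ÷ (2 ℕ.+ i)
      x′ = 1 ÷ (3 ℕ.+ i)
      g = 3 ÷ G i
      g′ = 3 ÷ G (suc i)
      d = 1 ÷ E i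
      regroup : ∀ a b x x′ g g′ d →
        a * x′ + b * g′ + ((a * x + b * g) * x′ + b * d * x′) ≡ a * (x′ + x * x′) + b * (g′ + (g + d) * x′)
      regroup = solve 7 (λ a b x x′ g g′ d → a :* x′ :+ b :* g′ :+ ((a :* x :+ b :* g) :* x′ :+ b :* d :* x′) :=
        a :* (x′ :+ x :* x′) :+ b :* (g′ :+ (g :+ d) :* x′)) refl

    -- With q = 1/(s + 1) the claim is D(s + 1) ≥ D(s)(1 - q)(1 - 2q). It holds with equality, the
    -- factor being s(s - 1)/(s + 1)².
    D-step : ∀ s → k ℕ.≤ s → D s + (D s * (1/ suc s * 1/ suc s) + D s * (1/ suc s * 1/ suc s)) ≤
      D s * 1/ suc s + (D s * 1/ suc s + D s * 1/ suc s) + D (suc s)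
    D-step (suc zero) (ℕ.s≤s ())
    D-step (suc (suc i)) _ = subst (λ q → D s + (D s * (q * q) + D s * (q * q)) ≤ D s * q + (D s * q + D s * q) + D (suc s)) (1÷≡1/ (3 ℕ.+ i)) (begin
      D s + (D s * (q * q) + D s * (q * q))
        ≈⟨ solve 2 (λ d q → d :+ (d :* (q :* q) :+ d :* (q :* q)) := d :* ((con 1 :+ con 0) :+ (q :* q :+ q :* q))) refl (D s) q ⟩
      D s * (fromℕ 1 + (q * q + q * q))
        ≤⟨ *-monoʳ-≤ (D≥0 s) (compare (nat 1 ⊕ (1 ∕ (3 ℕ.+ i) ⊗ 1 ∕ (3 ℕ.+ i) ⊕ 1 ∕ (3 ℕ.+ i) ⊗ 1 ∕ (3 ℕ.+ i)))
             ((1 ∕ (3 ℕ.+ i) ⊕ (1 ∕ (3 ℕ.+ i) ⊕ 1 ∕ (3 ℕ.+ i))) ⊕ ((2 ℕ.+ i) ℕ.* (1 ℕ.+ i)) ∕ ((3 ℕ.+ i) ℕ.* (3 ℕ.+ i))) (ℕ.≤-reflexive (ρ-poly i))) ⟩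
      D s * (q + (q + q) + ρ)
        ≈⟨ solve 3 (λ d q r → d :* (q :+ (q :+ q) :+ r) := d :* q :+ (d :* q :+ d :* q) :+ d :* r) refl (D s) q ρ ⟩
      D s * q + (D s * q + D s * q) + D s * ρ
        ≈⟨ cong (D s * q + (D s * q + D s * q) +_) (*-assoc _ _ _) ⟩
      D s * q + (D s * q + D s * q) + fromℕ κ * (1 ÷ E i * ρ)
        ≤⟨ +-monoʳ-≤ _ (*-monoʳ-≤ (fromℕ-nonneg κ) (compare (1 ∕ E i ⊗ ((2 ℕ.+ i) ℕ.* (1 ℕ.+ i)) ∕ ((3 ℕ.+ i) ℕ.* (3 ℕ.+ i))) (1 ∕ E (suc i)) (ℕ.≤-reflexive (d-poly i)))) ⟩
      D s * q + (D s * q + D s * q) + D (suc s) ∎)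
      where
      open ≤R
      s = 2 ℕ.+ i
      q = 1 ÷ (3 ℕ.+ i)
      ρ = ((2 ℕ.+ i) ℕ.* (1 ℕ.+ i)) ÷ ((3 ℕ.+ i) ℕ.* (3 ℕ.+ i))

    rates-bounds : ∀ m → Bounds R k m V D
    rates-bounds m = record
      { V≥0 = V≥0 ; D≥0 = D≥0 ; V-start = V-start ; D-start = D-start
      ; V-step = λ s k≤s _ → V-step s k≤s ; D-step = λ s k≤s _ → D-step s k≤s }

    quarter : ℕ → ℝ
    quarter i = fromℕ κ * 1 ÷ (4 ℕ.* ((1 ℕ.+ i) ℕ.* (1 ℕ.+ i)))

    -- The second term of V(t) is at least κ/(4(t - 1)²) - κ/(4t²), with equality at t = 2, and
    -- these differences telescope.
    ∑V-bound : ∀ i → j ℕ.≤ i → value α * ∑V k recip (2 ℕ.+ i) + quarter j ≤ ∑V k V (2 ℕ.+ i) + quarter i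
    ∑V-bound i j≤i with ℕ.m≤n⇒m<n∨m≡n j≤i
    ... | inj₂ refl = +-monoˡ-≤ (quarter i) (≤-reflexive (trans (cong (value α *_) (∑V-below k recip k ℕ.≤-refl))
            (trans (zeroʳ _) (sym (∑V-below k V k ℕ.≤-refl)))))
    ∑V-bound (suc i) _ | inj₁ (ℕ.s≤s j≤i) = begin
      value α * ∑V k recip (3 ℕ.+ i) + quarter j
        ≈⟨ cong (λ h → value α * h + quarter j) (∑V-suc k recip (ℕ.s≤s (ℕ.s≤s j≤i))) ⟩
      value α * (∑V k recip (2 ℕ.+ i) + x) + quarter j
        ≈⟨ solve 4 (λ a h x q → a :* (h :+ x) :+ q := a :* h :+ q :+ a :* x) refl (value α) _ x (quarter j) ⟩
      value α * ∑V k recip (2 ℕ.+ i) + quarter j + value α * x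
        ≤⟨ +-monoˡ-≤ _ (∑V-bound i j≤i) ⟩
      ∑V k V (2 ℕ.+ i) + quarter i + value α * x
        ≤⟨ +-monoˡ-≤ _ (+-monoʳ-≤ _ (*-monoʳ-≤ (fromℕ-nonneg κ) (compare (1 ∕ (4 ℕ.* ((1 ℕ.+ i) ℕ.* (1 ℕ.+ i))))
             (3 ∕ G i ⊕ 1 ∕ (4 ℕ.* ((2 ℕ.+ i) ℕ.* (2 ℕ.+ i)))) (≤-by (i ℕ.* 8 ℕ.* (1 ℕ.+ i) ℕ.* (2 ℕ.+ i)) (telescope-poly i))))) ⟩
      ∑V k V (2 ℕ.+ i) + fromℕ κ * (3 ÷ G i + 1 ÷ (4 ℕ.* ((2 ℕ.+ i) ℕ.* (2 ℕ.+ i)))) + value α * x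
        ≈⟨ solve 5 (λ s b g y z → s :+ b :* (g :+ y) :+ z := s :+ (z :+ b :* g) :+ b :* y) refl (∑V k V (2 ℕ.+ i)) (fromℕ κ) (3 ÷ G i) _ (value α * x) ⟩
      ∑V k V (2 ℕ.+ i) + V (2 ℕ.+ i) + quarter (suc i)
        ≈⟨ cong (_+ quarter (suc i)) (sym (∑V-suc k V (ℕ.s≤s (ℕ.s≤s j≤i)))) ⟩
      ∑V k V (3 ℕ.+ i) + quarter (suc i) ∎
      where
      open ≤R
      x = 1 ÷ (2 ℕ.+ i)

    module _ {m i L₁ L₂ N h} (m≡ : 2 ℕ.+ i ≡ m) (j≤i : j ℕ.≤ i)
             (L-large : fromℕ (32 ℕ.* (13 ℕ.* m) ℕ.+ 49 ℕ.* N) ≤ fromℕ 49 * (L₁ + L₂))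
             (L₁≤ : L₁ ≤ value α * h) (L₂≤ : L₂ ≤ fromℕ 32 * quarter j) (h≤ : h ≤ fromℕ 32 * ∑V k recip m)
             (quarter≤ : fromℕ 32 * quarter i ≤ fromℕ N) where

      -- `N` bounds what the telescoping sum loses at its far end; all terms are scaled by 32. To
      -- leading order the estimate is 11k + 8k - 2k out of 32 · 2k, that is 17/64, which exceeds
      -- 13/49 by only 1/3136.
      ratio : fromℕ (13 ℕ.* m) ≤ fromℕ 49 * ∑V k V m
      ratio = fromℕ-cancel-≤ 32 (+-cancelʳ-≤ (fromℕ (49 ℕ.* N)) (begin
        fromℕ 32 * fromℕ (13 ℕ.* m) + fromℕ (49 ℕ.* N)
          ≈⟨ trans (cong (_+ fromℕ (49 ℕ.* N)) (sym (fromℕ-* 32 (13 ℕ.* m)))) (sym (fromℕ-+ (32 ℕ.* (13 ℕ.* m)) (49 ℕ.* N))) ⟩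
        fromℕ (32 ℕ.* (13 ℕ.* m) ℕ.+ 49 ℕ.* N)
          ≤⟨ L-large ⟩
        fromℕ 49 * (L₁ + L₂)
          ≤⟨ *-monoʳ-≤ (fromℕ-nonneg 49) (+-mono-≤ (≤-trans L₁≤ (*-monoʳ-≤ α≥0 h≤)) L₂≤) ⟩
        fromℕ 49 * (value α * (fromℕ 32 * ∑V k recip m) + fromℕ 32 * quarter j)
          ≈⟨ solve 5 (λ c d a x y → c :* (a :* (d :* x) :+ d :* y) := c :* (d :* (a :* x :+ y))) refl (fromℕ 49) (fromℕ 32) (value α) _ (quarter j) ⟩
        fromℕ 49 * (fromℕ 32 * (value α * ∑V k recip m + quarter j))
          ≤⟨ *-monoʳ-≤ (fromℕ-nonneg 49) (*-monoʳ-≤ (fromℕ-nonneg 32)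
               (subst (λ l → value α * ∑V k recip l + quarter j ≤ ∑V k V l + quarter i) m≡ (∑V-bound i j≤i))) ⟩
        fromℕ 49 * (fromℕ 32 * (∑V k V m + quarter i))
          ≈⟨ solve 4 (λ c d x y → c :* (d :* (x :+ y)) := d :* (c :* x) :+ c :* (d :* y)) refl (fromℕ 49) (fromℕ 32) _ (quarter i) ⟩
        fromℕ 32 * (fromℕ 49 * ∑V k V m) + fromℕ 49 * (fromℕ 32 * quarter i)
          ≤⟨ +-monoʳ-≤ _ (*-monoʳ-≤ (fromℕ-nonneg 49) quarter≤) ⟩
        fromℕ 32 * (fromℕ 49 * ∑V k V m) + fromℕ 49 * fromℕ N
          ≈⟨ cong (fromℕ 32 * (fromℕ 49 * ∑V k V m) +_) (sym (fromℕ-* 49 N)) ⟩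
        fromℕ 32 * (fromℕ 49 * ∑V k V m) + fromℕ (49 ℕ.* N) ∎))
        where open ≤R

    X Y H quarterᴱ : Expr
    X = (2 ℕ.+ 3 ℕ.* j) ∕ (4 ℕ.+ 3 ℕ.* j)
    Y = (2 ℕ.+ j) ∕ (1 ℕ.+ j)
    -- 1/2 + 1/3 - 1/7, the constant for which `harmonic` is an equality at k = 2.
    H = 29 ∕ 42
    quarterᴱ = nat κ ⊗ 1 ∕ (4 ℕ.* ((1 ℕ.+ j) ℕ.* (1 ℕ.+ j)))

    quarter-large : value (nat (8 ℕ.* (2 ℕ.+ j)) ⊗ Y) ≤ fromℕ 32 * quarter j
    quarter-large = compare (nat (8 ℕ.* (2 ℕ.+ j)) ⊗ Y) (nat 32 ⊗ quarterᴱ) (ℕ.≤-reflexive (quarter-poly j))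

    harmonic-even : value H ≤ ∑V k recip (k ℕ.+ k)
    harmonic-even = ≤-trans (x≤x+y _ (÷-nonneg 1 (7 ℕ.+ 4 ℕ.* j))) (harmonic j)

    harmonic-odd : value H + 1 ÷ (k ℕ.+ k) ≤ ∑V k recip (suc (k ℕ.+ k))
    harmonic-odd = ≤-trans (+-monoˡ-≤ _ harmonic-even) (≤-reflexive (sym (∑V-suc k recip (ℕ.m≤m+n k k))))

    -- 22/32 is the value that stands in for ln 2.
    22≤32H : fromℕ 22 ≤ fromℕ 32 * value H
    22≤32H = compare (nat 22) (nat 32 ⊗ H) (ℕ.≤ᵇ⇒≤ _ _ _)

    -- The far end costs 8k²(k - 1)/(2k - 1)², which is at most 2k.
    ratio-even : fromℕ (13 ℕ.* (k ℕ.+ k)) ≤ fromℕ 49 * ∑V k V (k ℕ.+ k)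
    ratio-even = ratio {m = k ℕ.+ k} {N = 2 ℕ.* k} {h = fromℕ 22} refl (ℕ.m≤m+n j (2 ℕ.+ j))
      (compare (nat (32 ℕ.* (13 ℕ.* (k ℕ.+ k)) ℕ.+ 49 ℕ.* (2 ℕ.* k)))
        (nat 49 ⊗ (nat (11 ℕ.* (2 ℕ.+ j)) ⊗ X ⊕ nat (8 ℕ.* (2 ℕ.+ j)) ⊗ Y)) (≤-by _ (even-poly j)))
      (compare (nat (11 ℕ.* (2 ℕ.+ j)) ⊗ X) (α ⊗ nat 22) (ℕ.≤-reflexive (even-α-poly j)))
      quarter-large
      (≤-trans 22≤32H (*-monoʳ-≤ (fromℕ-nonneg 32) harmonic-even))
      (compare (nat 32 ⊗ (nat κ ⊗ 1 ∕ (4 ℕ.* ((1 ℕ.+ (j ℕ.+ (2 ℕ.+ j))) ℕ.* (1 ℕ.+ (j ℕ.+ (2 ℕ.+ j)))))))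
        (nat (2 ℕ.* k)) (≤-by _ (even-quarter-poly j)))

    -- The additional harmonic term 1/(2k) appears in `h` as 32/(2k), and the far end costs exactly
    -- 2(k - 1).
    ratio-odd : fromℕ (13 ℕ.* suc (k ℕ.+ k)) ≤ fromℕ 49 * ∑V k V (suc (k ℕ.+ k))
    ratio-odd = ratio {m = suc (k ℕ.+ k)} {N = 2 ℕ.* (1 ℕ.+ j)} {h = fromℕ 22 + 32 ÷ (k ℕ.+ k)} refl (ℕ.m≤n⇒m≤1+n (ℕ.m≤m+n j (2 ℕ.+ j)))
      (compare (nat (32 ℕ.* (13 ℕ.* suc (k ℕ.+ k)) ℕ.+ 49 ℕ.* (2 ℕ.* (1 ℕ.+ j))))
        (nat 49 ⊗ (nat (11 ℕ.* (2 ℕ.+ j) ℕ.+ 8) ⊗ X ⊕ nat (8 ℕ.* (2 ℕ.+ j)) ⊗ Y)) (≤-by _ (odd-poly j)))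
      (compare (nat (11 ℕ.* (2 ℕ.+ j) ℕ.+ 8) ⊗ X) (α ⊗ (nat 22 ⊕ 32 ∕ ((2 ℕ.+ j) ℕ.+ (2 ℕ.+ j)))) (ℕ.≤-reflexive (odd-α-poly j)))
      quarter-large
      (begin
        fromℕ 22 + 32 ÷ (k ℕ.+ k)
          ≤⟨ +-mono-≤ 22≤32H (≤-reflexive (cong (fromℕ 32 *_) (sym (1÷≡1/ (k ℕ.+ k))))) ⟩
        fromℕ 32 * value H + fromℕ 32 * 1 ÷ (k ℕ.+ k)  ≈⟨ sym (distribˡ _ _ _) ⟩
        fromℕ 32 * (value H + 1 ÷ (k ℕ.+ k))           ≤⟨ *-monoʳ-≤ (fromℕ-nonneg 32) harmonic-odd ⟩
        fromℕ 32 * ∑V k recip (suc (k ℕ.+ k))          ∎)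
      (compare (nat 32 ⊗ (nat κ ⊗ 1 ∕ (4 ℕ.* ((2 ℕ.+ (j ℕ.+ (2 ℕ.+ j))) ℕ.* (2 ℕ.+ (j ℕ.+ (2 ℕ.+ j)))))))
        (nat (2 ℕ.* (1 ℕ.+ j))) (ℕ.≤-reflexive (odd-quarter-poly j)))
      where open ≤R

data Half : ℕ → Set where
  even : ∀ k → Half (k ℕ.+ k)
  odd  : ∀ k → Half (suc (k ℕ.+ k))

half : ∀ m → Half m
half zero    = even zero
half (suc m) with half m
... | even k = odd k
... | odd k  = subst Half (cong suc (ℕ.+-suc k k)) (even (suc k))

-- The algorithm and its competitive ratio.

module Competitiveness (R : CompleteOrderedField) where

  open GraphicSecretary R
  open OrderedField R
  open Expectation R
  open RandomOrder R
  open PartialSums R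
  open Rates R

  Rates : ℕ → ℕ → Set
  Rates k m = ∃[ V ] ∃[ D ] Bounds R k m V D × fromℕ (13 ℕ.* m) ≤ fromℕ 49 * ∑V k V m

  -- The closed forms start at k = 2. For m ≤ 3 it suffices to count the first arrival after the
  -- sample, which finds every vertex fresh.
  δ : ℕ → ℕ → ℝ
  δ k s = ⟦ s ≡ᵇ k ⟧

  rates-1 : Rates 0 1
  rates-1 = δ 0 , δ 0 , record
    { V≥0 = λ s → 0≤⟦ s ≡ᵇ 0 ⟧ ; D≥0 = λ s → 0≤⟦ s ≡ᵇ 0 ⟧ ; V-start = ≤-refl ; D-start = ≤-refl
    ; V-step = λ { _ _ (ℕ.s≤s ()) } ; D-step = λ { _ _ (ℕ.s≤s ()) } } , (begin
      fromℕ 13                   ≤⟨ fromℕ-mono {13} {49} (ℕ.≤ᵇ⇒≤ 13 49 _) ⟩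
      fromℕ 49                   ≈⟨ sym (trans (cong (fromℕ 49 *_) (+-identityˡ 1#)) (*-identityʳ _)) ⟩
      fromℕ 49 * (0# + 1#)       ∎)
    where open ≤R

  rates-2 : Rates 1 2
  rates-2 = δ 1 , δ 1 , record
    { V≥0 = λ s → 0≤⟦ s ≡ᵇ 1 ⟧ ; D≥0 = λ s → 0≤⟦ s ≡ᵇ 1 ⟧ ; V-start = ≤-refl ; D-start = ≤-refl
    ; V-step = λ { _ (ℕ.s≤s _) (ℕ.s≤s (ℕ.s≤s ())) } ; D-step = λ { _ (ℕ.s≤s _) (ℕ.s≤s (ℕ.s≤s ())) } } , (begin
      fromℕ 26                   ≤⟨ fromℕ-mono {26} {49} (ℕ.≤ᵇ⇒≤ 26 49 _) ⟩
      fromℕ 49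
        ≈⟨ sym (trans (cong (fromℕ 49 *_) (trans (cong (_+ 1#) (+-identityˡ 0#)) (+-identityˡ 1#))) (*-identityʳ _)) ⟩
      fromℕ 49 * (0# + 0# + 1#)  ∎)
    where open ≤R

  rates-3 : Rates 1 3
  rates-3 = δ 1 , δ 1 , record
    { V≥0 = λ s → 0≤⟦ s ≡ᵇ 1 ⟧ ; D≥0 = λ s → 0≤⟦ s ≡ᵇ 1 ⟧ ; V-start = ≤-refl ; D-start = ≤-refl
    ; V-step = λ { 1 _ _ → ≤-reflexive (trans (solve 1 (λ h → con 0 :+ (con 1 :* h :+ con 1 :* h) := (con 1 :+ (con 1 :+ con 0)) :* h) refl h) 2h≡1)
                 ; (suc (suc s)) _ (ℕ.s≤s (ℕ.s≤s (ℕ.s≤s ()))) }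
    ; D-step = λ { 1 _ _ → ≤-reflexive d-step
                 ; (suc (suc s)) _ (ℕ.s≤s (ℕ.s≤s (ℕ.s≤s ()))) } } , (begin
      fromℕ 39                        ≤⟨ fromℕ-mono {39} {49} (ℕ.≤ᵇ⇒≤ 39 49 _) ⟩
      fromℕ 49
        ≈⟨ sym (trans (cong (fromℕ 49 *_) (solve 0 (con 0 :+ con 0 :+ con 1 :+ con 0 := con 1) refl)) (*-identityʳ _)) ⟩
      fromℕ 49 * (0# + 0# + 1# + 0#)  ∎)
    where
    open ≤R
    h = 1/ 2
    2h≡1 : fromℕ 2 * h ≡ 1#
    2h≡1 = 1/-inverse 2
    d-step : 1# + (1# * (h * h) + 1# * (h * h)) ≡ 1# * h + (1# * h + 1# * h) + 0#
    d-step = trans (cong (1# +_) (trans (solve 1 (λ h → con 1 :* (h :* h) :+ con 1 :* (h :* h) := (con 1 :+ (con 1 :+ con 0)) :* h :* h) refl h)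
               (trans (cong (_* h) 2h≡1) (*-identityˡ h))))
             (trans (cong (_+ h) (sym 2h≡1))
               (solve 1 (λ h → (con 1 :+ (con 1 :+ con 0)) :* h :+ h := con 1 :* h :+ (con 1 :* h :+ con 1 :* h) :+ con 0) refl h))

  rates : ∀ m → m ≢ 0 → Rates ⌊ m /2⌋ m
  rates m m≢0 with half m
  ... | even zero          = ⊥-elim (m≢0 refl)
  ... | even (suc zero)    = rates-2
  ... | even (suc (suc j)) = subst (λ k → Rates k m) (ℕ.n≡⌊n+n/2⌋ (2 ℕ.+ j))
          (V j , D j , rates-bounds j m , ratio-even j)
  ... | odd zero           = rates-1
  ... | odd (suc zero)     = rates-3
  ... | odd (suc (suc j))  = subst (λ k → Rates k m) (ℕ.n≡⌈n+n/2⌉ (2 ℕ.+ j))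
          (V j , D j , rates-bounds j m , ratio-odd j)

  ∑-lookup : ∀ {A : Set} (xs : List A) f → ∑ (allFin (length xs)) (f ∘ lookup xs) ≡ ∑ xs f
  ∑-lookup xs f = cong sum (trans (map-tabulate id (f ∘ lookup xs))
    (trans (sym (map-tabulate (lookup xs) f)) (cong (map f) (tabulate-lookup xs))))

  module _ (n m : ℕ) where

    open SecretaryRule R n

    private
      d = seeds n m
      d-prob = seeds-isProbability n m

    algorithm : Algorithm n m
    algorithm = record
      { seeds    = length d
      ; prob     = proj₁ ∘ lookup d
      ; prob≥0   = λ s → All.lookup (weights≥0 d-prob) (∈-lookup {xs = d} s)
      ; prob-sum = trans (∑-lookup d proj₁) (trans (∑-cong d (λ pa → sym (*-identityʳ (proj₁ pa)))) (total-mass d-prob))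
      ; rule     = λ s → secretaryRule ⌊ m /2⌋ (proj₂ (lookup d s))
      ; feasible = λ G s {es} _ t → secretaryRule-feasible ⌊ m /2⌋ (proj₂ (lookup d s)) G (take t es)
      }

    module _ (G : WeightedGraph n m) (simple : SimpleGraph G) where

      open WeightedGraph G
      open Weight R G simple ⌊ m /2⌋
      open Optimum R G simple ⌊ m /2⌋

      length-allFin : length (allFin m) ≡ m
      length-allFin = length-tabulate id

      𝔼ALG≡ : Algorithm.𝔼[ALG] algorithm G ≡ 𝔼 n m (allFin m) W
      𝔼ALG≡ = begin
        ∑ (orders m) (λ es → ∑ (allFin (length d)) (λ s → proj₁ (lookup d s) * weightOf es (proj₂ (lookup d s)))) * N⁻¹
          ≡⟨ cong (_* N⁻¹) (∑-cong (orders m) λ es → ∑-lookup d (λ pa → proj₁ pa * weightOf es (proj₂ pa))) ⟩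
        ∑ (orders m) (λ es → ∫ d (weightOf es)) * N⁻¹
          ≡⟨ cong (_* N⁻¹) (sym (∫-∑ d (orders m) (λ η es → weightOf es η))) ⟩
        ∫ d (λ η → ∑ (orders m) (λ es → weightOf es η)) * N⁻¹
          ≡⟨ trans (*-comm _ _) (sym (∫-*ˡ d N⁻¹ _)) ⟩
        ∫ d (λ η → N⁻¹ * ∑ (orders m) (λ es → weightOf es η))
          ≡⟨ ∫-cong d (λ η → trans (*-comm _ _) (cong (_* N⁻¹) (∑-cong (orders m) λ es →
               cong (λ es′ → weightOf es′ η) (sym (reverse-involutive es))))) ⟩
        ∫ d (λ η → average (orders m) (λ es → W (reverse es) η))
          ≡⟨ ∫-average n m (allFin m) length-allFin W ⟩
        𝔼 n m (allFin m) W ∎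
        where
        open ≡-Reasoning
        N⁻¹ = fromℕ (length (orders m)) ⁻¹
        weightOf : List (Fin m) → Coins n → ℝ
        weightOf es η = totalWeight (accepted G (secretaryRule ⌊ m /2⌋ η) es)

      OPT-bound : fromℕ 13 * OPT ≤ fromℕ 49 * 𝔼 n m (allFin m) W
      OPT-bound with m ℕ.≟ 0
      -- Without edges there is no factor `m` to cancel, but the optimum is at most 0.
      ... | yes refl = begin
        fromℕ 13 * OPT   ≤⟨ *-monoʳ-≤ (fromℕ-nonneg 13) OPT≤ ⟩
        fromℕ 13 * 0#    ≈⟨ zeroʳ _ ⟩
        0#                ≤⟨ *-nonneg (fromℕ-nonneg 49) (0≤W [] (noCoins n)) ⟩
        fromℕ 49 * _     ∎
        where open ≤R
      ... | no m≢0 with rates m m≢0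
      ...   | V , D , bounds , ratio = fromℕ-cancel-≤ m {{ℕ.≢-nonZero m≢0}} (begin
        fromℕ m * (fromℕ 13 * OPT)        ≤⟨ *-monoʳ-≤ (fromℕ-nonneg m) (*-monoʳ-≤ (fromℕ-nonneg 13) OPT≤) ⟩
        fromℕ m * (fromℕ 13 * K)
          ≈⟨ solve 3 (λ x y z → x :* (y :* z) := y :* x :* z) refl (fromℕ m) (fromℕ 13) K ⟩
        fromℕ 13 * fromℕ m * K            ≈⟨ cong (_* K) (sym (fromℕ-* 13 m)) ⟩
        fromℕ (13 ℕ.* m) * K              ≤⟨ *-monoˡ-≤ (∑-nonneg (allFin m) λ {e} _ → forestWeight≥0 e) ratio ⟩
        fromℕ 49 * ∑V ⌊ m /2⌋ V m * K    ≈⟨ *-assoc _ _ _ ⟩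
        fromℕ 49 * (∑V ⌊ m /2⌋ V m * K)
          ≤⟨ *-monoʳ-≤ (fromℕ-nonneg 49) (expected-weight bounds forestWeight forestWeight-spec m ℕ.≤-refl length-allFin (Unique.allFin⁺ m)) ⟩
        fromℕ 49 * (fromℕ m * 𝔼 n m (allFin m) W)
          ≈⟨ solve 3 (λ x y z → x :* (y :* z) := y :* (x :* z)) refl (fromℕ 49) (fromℕ m) _ ⟩
        fromℕ m * (fromℕ 49 * 𝔼 n m (allFin m) W) ∎)
        where
        open ≤R
        K = ∑ (allFin m) forestWeight

      competitive : OPT ≤ fromℕ 377 * fromℕ 100 ⁻¹ * Algorithm.𝔼[ALG] algorithm G
      competitive = begin
        OPT                   ≤⟨ fromℕ-cancel-≤ 13 (≤-trans OPT-bound (≤-reflexive (sym rescale))) ⟩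
        49 ÷ 13 * 𝔼W
          -- The comparison is 4900 ≤ 4901.
          ≤⟨ *-monoˡ-≤ (0≤𝔼 m length-allFin 0≤W) (÷-≤ 49 13 377 100 (ℕ.≤ᵇ⇒≤ (49 ℕ.* 100) (377 ℕ.* 13) _)) ⟩
        377 ÷ 100 * 𝔼W        ≈⟨ cong (377 ÷ 100 *_) (sym 𝔼ALG≡) ⟩
        377 ÷ 100 * Algorithm.𝔼[ALG] algorithm G ∎
        where
        open ≤R
        open Analysis R G simple ⌊ m /2⌋ using (0≤𝔼)
        𝔼W = 𝔼 n m (allFin m) W
        rescale : fromℕ 13 * (49 ÷ 13 * 𝔼W) ≡ fromℕ 49 * 𝔼W
        rescale = trans (sym (*-assoc _ _ _)) (cong (_* 𝔼W) (fromℕ-*-÷ 49 13))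

theorem1 : (R : CompleteOrderedField) → let open GraphicSecretary R in
    Σ[ A ∈ (∀ n m → Algorithm n m) ] Competitive (fromℕ 377 * fromℕ 100 ⁻¹) SimpleGraph A
theorem1 R = algorithm , competitive
  where open Competitiveness R
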